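{- For $|q|<1$, $$\mathrm{C}\Phi_6(q)=\frac49\frac{(q;q)_\infty^5(q^4;q^4)_\infty^2}{(q^2;q^2)_\infty^5(q^3;q^3)_\infty^3}-\frac13\frac{(q^2;q^2)_\infty^4(q^4;q^4)_\infty^2}{(q;q)_\infty^4(q^6;q^6)_\infty^3}+\frac89\frac{(q^4;q^4)_\infty^{11}}{(q;q)_\infty^4(q^2;q^2)_\infty^5(q^{12};q^{12})_\infty^3}$$ $$+36q\frac{(q^4;q^4)_\infty^2(q^3;q^3)_\infty^9}{(q;q)_\infty^7(q^2;q^2)_\infty^5}+27q^2\frac{(q^4;q^4)_\infty^2(q^6;q^6)_\infty^9}{(q;q)_\infty^4(q^2;q^2)_\infty^8}+72q^4\frac{(q^{12};q^{12})_\infty^9}{(q;q)_\infty^4(q^2;q^2)_\infty^5(q^4;q^4)_\infty}.$$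
   Context: A $k$-colored generalized Frobenius symbol is a two-row array with $d\ge 0$ columns whose entries are colored nonnegative integers $\ell_c$ ($\ell\ge 0$, color $c\in\{1,\dots,k\}$), each row strictly decreasing with respect to the total order $0_1\prec 0_2\prec\cdots\prec 0_k\prec 1_1\prec\cdots\prec 1_k\prec 2_1\prec\cdots$. It is a $k$-colored generalized Frobenius partition of $n=d+\sum(\text{integer values of all entries})$. $c\phi_k(n)$ is the number of such partitions of $n$ (with $c\phi_k(0)=1$), and $\mathrm{C}\Phi_k(q)=\sum_{n\ge0}c\phi_k(n)q^n$. $(a;q)_\infty=\prod_{j\ge1}(1-aq^{j-1})$. -}

module Defs where

open import Data.Nat as ℕ using (ℕ; zero; suc; _∸_; _≤?_; _<?_)
open import Data.Fin using (Fin)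
import Data.Fin as Fin
open import Data.Product using (Σ; _×_; _,_; proj₁)
open import Data.Product.Relation.Binary.Lex.Strict using (×-Lex)
open import Data.List using (List; length; map)
open import Data.Nat.ListAction using (sum)
open import Data.List.Relation.Unary.Linked using (Linked)
open import Data.Integer using (+_)
open import Data.Rational using (ℚ; 0ℚ; 1ℚ; _+_; _*_; -_)
open import Relation.Binary.PropositionalEquality using (_≡_)
open import Relation.Nullary.Decidable using (does)
open import Data.Bool using (if_then_else_)
open import Function using (flip)

-- colored nonnegative integer ℓ_c : value ℓ, color c ∈ Fin k
-- (Fin index 0 ↔ color 1, …, index k-1 ↔ color k)
Colored : ℕ → Set
Colored k = ℕ × Fin k

_≺_ : ∀ {k} → Colored k → Colored k → Set
_≺_ = ×-Lex _≡_ ℕ._<_ Fin._<_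

StrictlyDecreasing : ∀ {k} → List (Colored k) → Set
StrictlyDecreasing = Linked (flip _≺_)

rowValueSum : ∀ {k} → List (Colored k) → ℕ
rowValueSum r = sum (map proj₁ r)

record FrobeniusPartition (k n : ℕ) : Set where
  constructor frob
  field
    top    : List (Colored k)
    bottom : List (Colored k)
    sameLength : length top ≡ length bottom
    topDecr    : StrictlyDecreasing top
    bottomDecr : StrictlyDecreasing bottom
    weight     : length top ℕ.+ rowValueSum top ℕ.+ rowValueSum bottom ≡ n

-- formal power series over ℚ (coefficient sequences)

PS : Set
PS = ℕ → ℚ

sumTo : ℕ → (ℕ → ℚ) → ℚ
sumTo zero    f = f 0
sumTo (suc n) f = sumTo n f + f (suc n)

_⊕_ : PS → PS → PS
(a ⊕ b) n = a n + b n

_⊖_ : PS → PS → PS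
(a ⊖ b) n = a n + (- b n)

_⊗_ : PS → PS → PS
(a ⊗ b) n = sumTo n (λ i → a i * b (n ∸ i))

infixl 6 _⊕_ _⊖_
infixl 7 _⊗_

one : PS
one zero    = 1ℚ
one (suc _) = 0ℚ

const : ℚ → PS
const c zero    = c
const c (suc _) = 0ℚ

qpow : ℕ → PS
qpow j n = if does (n ℕ.≟ j) then 1ℚ else 0ℚ

pow : PS → ℕ → PS
pow a zero    = one
pow a (suc e) = a ⊗ pow a e

finProd : ℕ → ℕ → PS
finProd m zero    = one
finProd m (suc N) = finProd m N ⊗ (one ⊖ qpow (m ℕ.* suc N))

-- (q^m ; q^m)_∞ as a formal power series (m ≥ 1): coefficient n is the
-- coefficient of q^n in the finite product over j ≤ n (later factors
-- 1 - q^{mj} with mj > n do not affect it)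
qPoch : ℕ → PS
qPoch m n = finProd m n n

-- reciprocal of a power series with constant term 1:
-- b 0 = 1,  b n = - Σ_{i=1}^{n} a i * b (n - i)
invApprox : PS → ℕ → PS
invApprox a zero    = λ _ → 1ℚ
invApprox a (suc n) i =
  if does (i ≤? n) then invApprox a n i
  else - sumTo n (λ j → a (suc j) * invApprox a n (n ∸ j))

inv : PS → PS
inv a n = invApprox a n n

{-# OPTIONS --safe #-}

-- Let z record the length of the top row minus that of the bottom row. The generating function of the
-- partitions is the coefficient of z^0 in J(z)^6, where J(z) = ∏ (1 + z q^(i+1)) (1 + z^(-1) q^i), and
-- (q;q)_∞ J(z) = Σ z^m q^(m(m+1)/2) by Jacobi's triple product. Writing J^6 = J^3 J^3, this coefficient
-- times (q;q)_∞^6 is φ(q^3) a² + 2 q f(q,q^5) c², where a and c (the theta series of the lattice A₂ and,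
-- up to a power of q, of its nontrivial cosets) are sums of two products of theta functions.
-- Products of two theta functions of base q^6 are quadratic forms in four theta functions of base q^12.
-- Eliminating the latter gives linear relations between eta quotients of level 12: there is an eta
-- quotient p such that 1 + p, 1 + 2p, 1 + 4p and 1 - 2p are eta quotients as well. Both sides of the
-- theorem are then one eta quotient times a polynomial in p, and the two polynomials agree.
module Submission where

open import Algebra.Bundles using (CommutativeRing; CommutativeMonoid)
open import Algebra.Core using (Op₂)
import Algebra.Properties.AbelianGroup
import Algebra.Properties.Ring
import Algebra.Properties.Semiring.Mult.TCOptimised as Mult
import Algebra.Solver.Ring
open import Algebra.Solver.Ring.AlmostCommutativeRing using (fromCommutativeRing; _-Raw-AlmostCommutative⟶_)
open import Data.Integer as ℤ using (ℤ; -[1+_])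
import Data.Integer.Properties as ℤₚ
open import Data.Maybe.Base using (Maybe; just; nothing)
open import Data.Nat as ℕ using (ℕ; zero; suc; _∸_; _≤_; _<_; z≤n; s≤s)
import Data.Nat.Properties as ℕₚ
open import Data.Product using (_,_)
open import Function using (_∘_)
open import Relation.Binary using (IsEquivalence)
open import Relation.Binary.PropositionalEquality as ≡ using (_≡_; refl)
open import Relation.Nullary using (yes; no)

-- Γ₀(12) has genus 0 and six cusps, where `p` takes the values 0, ∞, -1, -1/2, -1/4 and 1/2. This
-- is why exactly these linear factors of `p` are eta quotients, and why every term of the theorem
-- is a common factor times a monomial in them. The modular picture is only a guide: each relation
-- is proved from theta products. The obstacle is J(z), infinite in both directions in z, so that
-- its powers have no ready-made ring. Two devices replace it. Sums over ℤ or ℤ² are families in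
-- which each power of q meets finitely many members; their total is unique and may be computed
-- after any splitting or recentring of the index set. And J itself occurs only modulo q^(M+1),
-- multiplied by z^N, as a product of N factors of each kind, which is a polynomial in z. What
-- remains is mechanical: identities between exponents are polynomial identities in ℤ, equalities of
-- eta quotients are equalities of integer vectors, and the last step is a polynomial identity in
-- `p`.

module IntegerSolver {c ℓ} (R : CommutativeRing c ℓ) where
  private
    open module R = CommutativeRing R using (Carrier; _≈_; _+_; _*_; -_; 0#; 1#; setoid; +-cong; +-congˡ; +-congʳ; *-cong; -‿cong)
    open Mult R.semiring using (_×_; ×-homo-+; ×1-homo-*)
    open Algebra.Properties.Ring R.ring using (-‿distribˡ-*; -‿distribʳ-*; -0#≈0#; -‿involutive)
    open Algebra.Properties.AbelianGroup R.+-abelianGroup using (⁻¹-∙-comm)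
    import Relation.Binary.Reasoning.Setoid setoid as ≈-R

  -- `_×_` is the variant of iterated addition with 1 × x = x by computation. Hence the numerals 0,
  -- 1 and 2 unfold to 0#, 1# and 1# + 1#.
  fromℤ : ℤ → Carrier
  fromℤ (ℤ.+ n)  = n × 1#
  fromℤ -[1+ n ] = - (suc n × 1#)

  private
    ⟦_⟧ = fromℤ

    suc-× : ∀ n → suc n × 1# ≈ 1# + n × 1#
    suc-× n = ×-homo-+ 1# 1 n

    ⟦⟧-⊖ : ∀ m n → ⟦ m ℤ.⊖ n ⟧ ≈ m × 1# + - (n × 1#)
    ⟦⟧-⊖ zero zero = R.sym (R.trans (+-congˡ -0#≈0#) (R.+-identityʳ 0#))
    ⟦⟧-⊖ zero (suc n) = R.sym (R.+-identityˡ _)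
    ⟦⟧-⊖ (suc m) zero = R.sym (R.trans (+-congˡ -0#≈0#) (R.+-identityʳ _))
    ⟦⟧-⊖ (suc m) (suc n) = begin
      ⟦ suc m ℤ.⊖ suc n ⟧                      ≡⟨ ≡.cong ⟦_⟧ (ℤₚ.[1+m]⊖[1+n]≡m⊖n m n) ⟩
      ⟦ m ℤ.⊖ n ⟧                              ≈⟨ ⟦⟧-⊖ m n ⟩
      m × 1# + - (n × 1#)                      ≈⟨ R.+-identityˡ _ ⟨
      0# + (m × 1# + - (n × 1#))               ≈⟨ +-congʳ (R.-‿inverseʳ 1#) ⟨
      (1# + - 1#) + (m × 1# + - (n × 1#))      ≈⟨ interchange 1# (- 1#) _ _ ⟩
      (1# + m × 1#) + (- 1# + - (n × 1#))      ≈⟨ +-cong (R.sym (suc-× m)) (R.trans (⁻¹-∙-comm _ _) (-‿cong (R.sym (suc-× n)))) ⟩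
      suc m × 1# + - (suc n × 1#)              ∎
      where
      open ≈-R
      open import Algebra.Properties.CommutativeSemigroup R.+-commutativeSemigroup using (interchange)

    +-homo : ∀ x y → ⟦ x ℤ.+ y ⟧ ≈ ⟦ x ⟧ + ⟦ y ⟧
    +-homo (ℤ.+ m) (ℤ.+ n)    = ×-homo-+ 1# m n
    +-homo (ℤ.+ m) -[1+ n ]   = ⟦⟧-⊖ m (suc n)
    +-homo -[1+ m ] (ℤ.+ n)   = R.trans (⟦⟧-⊖ n (suc m)) (R.+-comm _ _)
    +-homo -[1+ m ] -[1+ n ]  = R.trans (-‿cong (R.trans (R.reflexive (≡.cong (λ k → suc k × 1#) (≡.sym (ℕₚ.+-suc m n)))) (×-homo-+ 1# (suc m) (suc n)))) (R.sym (⁻¹-∙-comm _ _))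

    -‿homo : ∀ x → ⟦ ℤ.- x ⟧ ≈ - ⟦ x ⟧
    -‿homo (ℤ.+ zero)  = R.sym -0#≈0#
    -‿homo (ℤ.+ suc n) = R.refl
    -‿homo -[1+ n ]    = R.sym (-‿involutive _)

    *-homo⁺ : ∀ m y → ⟦ ℤ.+ m ℤ.* y ⟧ ≈ ⟦ ℤ.+ m ⟧ * ⟦ y ⟧
    *-homo⁺ m (ℤ.+ n) = R.trans (R.reflexive (≡.cong ⟦_⟧ (≡.sym (ℤₚ.pos-* m n)))) (×1-homo-* m n)
    *-homo⁺ m -[1+ n ] = begin
      ⟦ ℤ.+ m ℤ.* -[1+ n ] ⟧         ≡⟨ ≡.cong ⟦_⟧ (ℤₚ.neg-distribʳ-* (ℤ.+ m) (ℤ.+ suc n)) ⟨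
      ⟦ ℤ.- (ℤ.+ m ℤ.* ℤ.+ suc n) ⟧  ≈⟨ -‿homo (ℤ.+ m ℤ.* ℤ.+ suc n) ⟩
      - ⟦ ℤ.+ m ℤ.* ℤ.+ suc n ⟧      ≈⟨ -‿cong (*-homo⁺ m (ℤ.+ suc n)) ⟩
      - (m × 1# * (suc n × 1#))      ≈⟨ -‿distribʳ-* _ _ ⟩
      m × 1# * - (suc n × 1#)        ∎
      where open ≈-R

    *-homo : ∀ x y → ⟦ x ℤ.* y ⟧ ≈ ⟦ x ⟧ * ⟦ y ⟧
    *-homo (ℤ.+ m) y = *-homo⁺ m y
    *-homo -[1+ m ] y = begin
      ⟦ -[1+ m ] ℤ.* y ⟧             ≡⟨ ≡.cong ⟦_⟧ (ℤₚ.neg-distribˡ-* (ℤ.+ suc m) y) ⟨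
      ⟦ ℤ.- (ℤ.+ suc m ℤ.* y) ⟧      ≈⟨ -‿homo (ℤ.+ suc m ℤ.* y) ⟩
      - ⟦ ℤ.+ suc m ℤ.* y ⟧          ≈⟨ -‿cong (*-homo⁺ (suc m) y) ⟩
      - (suc m × 1# * ⟦ y ⟧)         ≈⟨ -‿distribˡ-* _ _ ⟩
      - (suc m × 1#) * ⟦ y ⟧         ∎
      where open ≈-R

    morphism : ℤ.+-*-rawRing -Raw-AlmostCommutative⟶ fromCommutativeRing R
    morphism = record
      { ⟦_⟧ = ⟦_⟧ ; +-homo = +-homo ; *-homo = *-homo ; -‿homo = -‿homo ; 0-homo = R.refl ; 1-homo = R.refl }

    _≟?_ : ∀ x y → Maybe (⟦ x ⟧ ≈ ⟦ y ⟧)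
    x ≟? y with x ℤ.≟ y
    ... | yes eq = just (R.reflexive (≡.cong ⟦_⟧ eq))
    ... | no _   = nothing

  open Algebra.Solver.Ring ℤ.+-*-rawRing (fromCommutativeRing R) morphism _≟?_ public
    using (solve; _:=_; _:+_; _:*_; _:-_; :-_; _:^_; con; Polynomial)

  num : ∀ {n} → ℕ → Polynomial n
  num k = con (ℤ.+ k)

module Cancel {c ℓ} (R : CommutativeRing c ℓ) where
  open CommutativeRing R hiding (refl; trans)
  open import Relation.Binary.Reasoning.Setoid setoid

  cancelˡ : ∀ u v {x y} → u * v ≈ 1# → u * x ≈ u * y → x ≈ y
  cancelˡ u v {x} {y} uv≈1 p = begin
    x            ≈⟨ expand x ⟩
    v * (u * x)  ≈⟨ *-congˡ p ⟩
    v * (u * y)  ≈⟨ expand y ⟨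
    y            ∎
    where
    expand : ∀ z → z ≈ v * (u * z)
    expand z = begin
      z            ≈⟨ *-identityˡ z ⟨
      1# * z       ≈⟨ *-congʳ uv≈1 ⟨
      u * v * z    ≈⟨ *-congʳ (*-comm u v) ⟩
      v * u * z    ≈⟨ *-assoc v u z ⟩
      v * (u * z)  ∎

-- The Cauchy product enters only through its two recursion equations, so that the ring structure
-- applies both to the product of Defs and to iterated power series.
module PowerSeries {c ℓ} (R : CommutativeRing c ℓ)
  (_⊛_ : Op₂ (ℕ → CommutativeRing.Carrier R))
  (⊛-zero : ∀ a b → CommutativeRing._≈_ R ((a ⊛ b) 0) (CommutativeRing._*_ R (a 0) (b 0)))
  (⊛-suc : ∀ a b n → CommutativeRing._≈_ R ((a ⊛ b) (suc n)) (CommutativeRing._+_ R (CommutativeRing._*_ R (a 0) (b (suc n))) (((a ∘ suc) ⊛ b) n)))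
  where
  private
    module R = CommutativeRing R
    open R using (Carrier; _≈_; _+_; _*_; -_; 0#; 1#; +-cong; *-cong; +-congˡ; +-congʳ; *-congˡ)
    open import Relation.Binary.Reasoning.Setoid R.setoid
    open import Algebra.Properties.CommutativeSemigroup R.+-commutativeSemigroup using (interchange)

  Series : Set c
  Series = ℕ → Carrier

  infix 4 _≋_ _≋[_]_
  _≋_ : Series → Series → Set ℓ
  a ≋ b = ∀ n → a n ≈ b n

  -- Congruence modulo q^(N+1): the coefficient of q^N still counts.
  _≋[_]_ : Series → ℕ → Series → Set ℓ
  a ≋[ N ] b = ∀ n → n ≤ N → a n ≈ b n

  0S 1S : Series
  0S _ = 0#
  1S zero    = 1#
  1S (suc _) = 0#

  infixl 6 _+S_
  _+S_ : Op₂ Series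
  (a +S b) n = a n + b n

  -S_ : Series → Series
  (-S a) n = - a n

  infixl 7 _*S_
  _*S_ : Op₂ Series
  a *S b = a ⊛ b

  -- Coefficient n of a product involves only the coefficients up to n of its factors. The truncated
  -- form comes first because plain congruence is its case N = n.
  *S-cong[] : ∀ N {a a′ b b′} → a ≋[ N ] a′ → b ≋[ N ] b′ → a *S b ≋[ N ] a′ *S b′
  *S-cong[] N {a} {a′} {b} {b′} p q zero n≤N =
    R.trans (⊛-zero a b) (R.trans (*-cong (p 0 z≤n) (q 0 z≤n)) (R.sym (⊛-zero a′ b′)))
  *S-cong[] (suc N) {a} {a′} {b} {b′} p q (suc n) (s≤s n≤N) = begin
    (a *S b) (suc n)                             ≈⟨ ⊛-suc a b n ⟩
    a 0 * b (suc n) + ((a ∘ suc) *S b) n          ≈⟨ +-cong (*-cong (p 0 z≤n) (q (suc n) (s≤s n≤N)))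
                                                    (*S-cong[] N (λ i i≤ → p (suc i) (s≤s i≤)) (λ i i≤ → q i (ℕₚ.m≤n⇒m≤1+n i≤)) n n≤N) ⟩
    a′ 0 * b′ (suc n) + ((a′ ∘ suc) *S b′) n      ≈⟨ ⊛-suc a′ b′ n ⟨
    (a′ *S b′) (suc n)                           ∎

  *S-cong : ∀ {a a′ b b′} → a ≋ a′ → b ≋ b′ → a *S b ≋ a′ *S b′
  *S-cong p q n = *S-cong[] n (λ i _ → p i) (λ i _ → q i) n ℕₚ.≤-refl

  private
    distribʳ : ∀ c a b → (a +S b) *S c ≋ a *S c +S b *S c
    distribʳ c a b zero = begin
      ((a +S b) *S c) 0              ≈⟨ ⊛-zero _ c ⟩
      (a 0 + b 0) * c 0              ≈⟨ R.distribʳ _ _ _ ⟩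
      a 0 * c 0 + b 0 * c 0          ≈⟨ +-cong (⊛-zero a c) (⊛-zero b c) ⟨
      (a *S c +S b *S c) 0           ∎
    distribʳ c a b (suc n) = begin
      ((a +S b) *S c) (suc n)                                                     ≈⟨ ⊛-suc _ c n ⟩
      (a 0 + b 0) * c (suc n) + (((a +S b) ∘ suc) *S c) n                         ≈⟨ +-cong (R.distribʳ _ _ _) (distribʳ c (a ∘ suc) (b ∘ suc) n) ⟩
      (a 0 * c (suc n) + b 0 * c (suc n)) + (((a ∘ suc) *S c) n + ((b ∘ suc) *S c) n)
                                                                                  ≈⟨ interchange _ _ _ _ ⟩
      (a 0 * c (suc n) + ((a ∘ suc) *S c) n) + (b 0 * c (suc n) + ((b ∘ suc) *S c) n)
                                                                                  ≈⟨ +-cong (⊛-suc a c n) (⊛-suc b c n) ⟨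
      (a *S c +S b *S c) (suc n)                                                  ∎

    -- Mirror image of `⊛-suc`. Commutativity needs it because the recursion peels only the first
    -- factor.
    sucʳ : ∀ a b n → (a *S b) (suc n) ≈ (a *S (b ∘ suc)) n + a (suc n) * b 0
    sucʳ a b zero = begin
      (a *S b) 1                             ≈⟨ ⊛-suc a b 0 ⟩
      a 0 * b 1 + ((a ∘ suc) *S b) 0         ≈⟨ +-cong (R.sym (⊛-zero a (b ∘ suc))) (⊛-zero (a ∘ suc) b) ⟩
      (a *S (b ∘ suc)) 0 + a 1 * b 0         ∎
    sucʳ a b (suc n) = begin
      (a *S b) (suc (suc n))                                                  ≈⟨ ⊛-suc a b (suc n) ⟩
      a 0 * b (suc (suc n)) + ((a ∘ suc) *S b) (suc n)                        ≈⟨ +-congˡ (sucʳ (a ∘ suc) b n) ⟩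
      a 0 * b (suc (suc n)) + (((a ∘ suc) *S (b ∘ suc)) n + a (suc (suc n)) * b 0)
                                                                              ≈⟨ R.+-assoc _ _ _ ⟨
      a 0 * b (suc (suc n)) + ((a ∘ suc) *S (b ∘ suc)) n + a (suc (suc n)) * b 0
                                                                              ≈⟨ +-congʳ (⊛-suc a (b ∘ suc) n) ⟨
      (a *S (b ∘ suc)) (suc n) + a (suc (suc n)) * b 0                        ∎

    comm : ∀ a b → a *S b ≋ b *S a
    comm a b zero    = R.trans (⊛-zero a b) (R.trans (R.*-comm _ _) (R.sym (⊛-zero b a)))
    comm a b (suc n) = begin
      (a *S b) (suc n)                             ≈⟨ ⊛-suc a b n ⟩
      a 0 * b (suc n) + ((a ∘ suc) *S b) n         ≈⟨ +-cong (R.*-comm _ _) (comm (a ∘ suc) b n) ⟩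
      b (suc n) * a 0 + (b *S (a ∘ suc)) n         ≈⟨ R.+-comm _ _ ⟩
      (b *S (a ∘ suc)) n + b (suc n) * a 0         ≈⟨ sucʳ b a n ⟨
      (b *S a) (suc n)                             ∎

    scale : ∀ k a b n → ((λ i → k * a i) *S b) n ≈ k * (a *S b) n
    scale k a b zero    = R.trans (⊛-zero _ b) (R.trans (R.*-assoc _ _ _) (*-congˡ (R.sym (⊛-zero a b))))
    scale k a b (suc n) = begin
      ((λ i → k * a i) *S b) (suc n)                               ≈⟨ ⊛-suc _ b n ⟩
      k * a 0 * b (suc n) + ((λ i → k * a (suc i)) *S b) n         ≈⟨ +-cong (R.*-assoc _ _ _) (scale k (a ∘ suc) b n) ⟩
      k * (a 0 * b (suc n)) + k * ((a ∘ suc) *S b) n               ≈⟨ R.distribˡ _ _ _ ⟨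
      k * (a 0 * b (suc n) + ((a ∘ suc) *S b) n)                   ≈⟨ *-congˡ (⊛-suc a b n) ⟨
      k * (a *S b) (suc n)                                         ∎

    assoc : ∀ a b c → (a *S b) *S c ≋ a *S (b *S c)
    assoc a b c zero = begin
      ((a *S b) *S c) 0         ≈⟨ R.trans (⊛-zero _ c) (R.*-congʳ (⊛-zero a b)) ⟩
      a 0 * b 0 * c 0           ≈⟨ R.*-assoc _ _ _ ⟩
      a 0 * (b 0 * c 0)         ≈⟨ R.trans (⊛-zero a _) (*-congˡ (⊛-zero b c)) ⟨
      (a *S (b *S c)) 0         ∎
    assoc a b c (suc n) = begin
      ((a *S b) *S c) (suc n)
        ≈⟨ ⊛-suc _ c n ⟩
      (a *S b) 0 * c (suc n) + (((a *S b) ∘ suc) *S c) n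
        ≈⟨ +-cong (R.*-congʳ (⊛-zero a b)) (*S-cong (⊛-suc a b) (λ _ → R.refl) n) ⟩
      a 0 * b 0 * c (suc n) + (((λ i → a 0 * b (suc i)) +S (a ∘ suc) *S b) *S c) n
        ≈⟨ +-congˡ (distribʳ c _ _ n) ⟩
      a 0 * b 0 * c (suc n) + (((λ i → a 0 * b (suc i)) *S c) n + (((a ∘ suc) *S b) *S c) n)
        ≈⟨ +-cong (R.*-assoc _ _ _) (+-cong (scale (a 0) (b ∘ suc) c n) (assoc (a ∘ suc) b c n)) ⟩
      a 0 * (b 0 * c (suc n)) + (a 0 * ((b ∘ suc) *S c) n + ((a ∘ suc) *S (b *S c)) n)
        ≈⟨ R.+-assoc _ _ _ ⟨
      a 0 * (b 0 * c (suc n)) + a 0 * ((b ∘ suc) *S c) n + ((a ∘ suc) *S (b *S c)) n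
        ≈⟨ +-congʳ (R.distribˡ _ _ _) ⟨
      a 0 * (b 0 * c (suc n) + ((b ∘ suc) *S c) n) + ((a ∘ suc) *S (b *S c)) n
        ≈⟨ +-congʳ (*-congˡ (⊛-suc b c n)) ⟨
      a 0 * (b *S c) (suc n) + ((a ∘ suc) *S (b *S c)) n
        ≈⟨ ⊛-suc a _ n ⟨
      (a *S (b *S c)) (suc n) ∎

    zeroˡ : ∀ a → 0S *S a ≋ 0S
    zeroˡ a zero    = R.trans (⊛-zero 0S a) (R.zeroˡ _)
    zeroˡ a (suc n) = R.trans (⊛-suc 0S a n) (R.trans (+-cong (R.zeroˡ _) (zeroˡ a n)) (R.+-identityˡ _))

    identityˡ : ∀ a → 1S *S a ≋ a
    identityˡ a zero    = R.trans (⊛-zero 1S a) (R.*-identityˡ _)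
    identityˡ a (suc n) = R.trans (⊛-suc 1S a n) (R.trans (+-cong (R.*-identityˡ _) (zeroˡ a n)) (R.+-identityʳ _))

  isEquivalence : IsEquivalence _≋_
  isEquivalence = record
    { refl = λ _ → R.refl ; sym = λ p n → R.sym (p n) ; trans = λ p q n → R.trans (p n) (q n) }

  seriesRing : CommutativeRing c ℓ
  seriesRing = record
    { Carrier = Series ; _≈_ = _≋_ ; _+_ = _+S_ ; _*_ = _*S_ ; -_ = -S_ ; 0# = 0S ; 1# = 1S
    ; isCommutativeRing = record
      { isRing = record
        { +-isAbelianGroup = record
          { isGroup = record
            { isMonoid = record
              { isSemigroup = record
                { isMagma = record { isEquivalence = isEquivalence ; ∙-cong = λ p q n → +-cong (p n) (q n) }
                ; assoc = λ a b c n → R.+-assoc _ _ _ }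
              ; identity = (λ a n → R.+-identityˡ _) , (λ a n → R.+-identityʳ _) }
            ; inverse = (λ a n → R.-‿inverseˡ _) , (λ a n → R.-‿inverseʳ _)
            ; ⁻¹-cong = λ p n → R.-‿cong (p n) }
          ; comm = λ a b n → R.+-comm _ _ }
        ; *-cong = *S-cong
        ; *-assoc = assoc
        ; *-identity = identityˡ , (λ a n → R.trans (comm a 1S n) (identityˡ a n))
        ; distrib = (λ a b c n → R.trans (comm a (b +S c) n) (R.trans (distribʳ a b c n) (+-cong (comm b a n) (comm c a n)))) , distribʳ }
      ; *-comm = comm } }

  -- The quotient by q^(N+1), presented on the same series with a coarser equality, so that infinite
  -- products can be compared with finite ones by ordinary ring reasoning.
  truncRing : ℕ → CommutativeRing c ℓ
  truncRing N = record
    { Carrier = Series ; _≈_ = _≋[ N ]_ ; _+_ = _+S_ ; _*_ = _*S_ ; -_ = -S_ ; 0# = 0S ; 1# = 1S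
    ; isCommutativeRing = record
      { isRing = record
        { +-isAbelianGroup = record
          { isGroup = record
            { isMonoid = record
              { isSemigroup = record
                { isMagma = record
                  { isEquivalence = record
                    { refl = λ _ _ → R.refl ; sym = λ p n l → R.sym (p n l) ; trans = λ p q n l → R.trans (p n l) (q n l) }
                  ; ∙-cong = λ p q n l → +-cong (p n l) (q n l) }
                ; assoc = λ a b c n _ → S.+-assoc a b c n }
              ; identity = (λ a n _ → S.+-identityˡ a n) , (λ a n _ → S.+-identityʳ a n) }
            ; inverse = (λ a n _ → S.-‿inverseˡ a n) , (λ a n _ → S.-‿inverseʳ a n)
            ; ⁻¹-cong = λ p n l → R.-‿cong (p n l) }
          ; comm = λ a b n _ → S.+-comm a b n }
        ; *-cong = *S-cong[] N
        ; *-assoc = λ a b c n _ → S.*-assoc a b c n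
        ; *-identity = (λ a n _ → S.*-identityˡ a n) , (λ a n _ → S.*-identityʳ a n)
        ; distrib = (λ a b c n _ → S.distribˡ a b c n) , (λ a b c n _ → S.distribʳ a b c n) }
      ; *-comm = λ a b n _ → S.*-comm a b n } }
    where module S = CommutativeRing seriesRing

open import Defs
open import Data.Bool using (Bool; true; false; if_then_else_)
open import Data.Fin as Fin using (Fin; zero; suc; #_)
import Data.Fin.Properties as Finₚ
open import Data.Integer using (∣_∣) renaming (_⊖_ to _⊟_)
open import Data.Integer.DivMod using (_%ℕ_; _/ℕ_; n%ℕd<d; a≡a%ℕn+[a/ℕn]*n)
open import Data.List using (List; []; _∷_; _++_; map; length; filter; lookup; cartesianProduct)
import Data.List.Properties as Listₚ
open import Data.List.Membership.Propositional using (_∈_)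
open import Data.List.Membership.Propositional.Properties
  using (∈-map⁺; ∈-map⁻; ∈-++⁺ˡ; ∈-++⁺ʳ; ∈-++⁻; ∈-filter⁺; ∈-filter⁻; ∈-cartesianProduct⁺; ∈-cartesianProduct⁻; ∈-lookup)
open import Data.List.Relation.Unary.All as All using (All; []; _∷_)
import Data.List.Relation.Unary.All.Properties as Allₚ
open import Data.List.Relation.Unary.AllPairs as AllPairs using (AllPairs; []; _∷_; allPairs?)
import Data.List.Relation.Unary.AllPairs.Properties as AllPairsₚ
open import Data.List.Relation.Unary.Any using (here; there; index; any?)
open import Data.List.Relation.Unary.Any.Properties using (lookup-index)
import Data.List.Relation.Unary.Linked as Linked
open import Data.List.Relation.Unary.Linked.Properties using (AllPairs⇒Linked; Linked⇒AllPairs)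
open import Data.List.Relation.Unary.Unique.Propositional using (Unique)
import Data.List.Relation.Unary.Unique.Propositional.Properties as Uniqueₚ
open import Data.Nat using (_≤?_)
open import Data.Nat.Coprimality using (1-coprimeTo) renaming (sym to coprime-sym)
import Data.Nat.Solver
open import Data.Product using (Σ; _×_; ∃; proj₁; proj₂; map₂)
open import Data.Product.Properties using (≡-dec)
open import Data.Product.Relation.Binary.Lex.Strict using (×-transitive; ×-irreflexive)
open import Data.Rational using (ℚ; 0ℚ; 1ℚ; ½; _+_; _*_; -_; _/_)
import Data.Rational.Properties as ℚₚ
import Data.Rational.Solver
open import Data.Sum using (_⊎_; inj₁; inj₂; [_,_]′)
import Data.Sum.Properties as ⊎ₚ
open import Data.Unit using (⊤; tt)
import Data.Unit.Properties as ⊤ₚ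
open import Data.Vec as Vec using (Vec; []; _∷_)
open import Data.Vec.Relation.Unary.All as VecAll using ([]; _∷_)
open import Function using (flip; _↔_; mk↔ₛ′)
open import Function.Construct.Composition using (_↔-∘_)
open import Level using (0ℓ)
open import Relation.Binary using (DecidableEquality; Rel; Transitive; Irreflexive; Irrelevant)
open import Relation.Binary.PropositionalEquality using (cong; cong₂; sym; trans; subst)
open import Relation.Nullary using (Dec; ¬_; contradiction)
open import Relation.Nullary.Decidable using (does; dec-true; dec-false; _×-dec_; from-yes)
import Relation.Unary as U
open import Algebra.Properties.CommutativeSemigroup (CommutativeMonoid.commutativeSemigroup ℚₚ.+-0-commutativeMonoid) using () renaming (x∙yz≈y∙xz to +-swapˡ)
open import Algebra.Properties.Group (CommutativeRing.+-group ℤₚ.+-*-commutativeRing) using (∙-cancelˡ; ∙-cancelʳ)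

module ℕSolver = Data.Nat.Solver.+-*-Solver
module ℚSolver = Data.Rational.Solver.+-*-Solver

-- Formal power series over ℚ

sumTo-suc : ∀ n f → sumTo (suc n) f ≡ f 0 + sumTo n (f ∘ suc)
sumTo-suc zero    f = refl
sumTo-suc (suc n) f = trans (cong (_+ f (suc (suc n))) (sumTo-suc n f)) (ℚₚ.+-assoc (f 0) _ _)

sumTo-cong : ∀ n {f g} → (∀ i → i ≤ n → f i ≡ g i) → sumTo n f ≡ sumTo n g
sumTo-cong zero    p = p 0 z≤n
sumTo-cong (suc n) p = cong₂ _+_ (sumTo-cong n (λ i i≤n → p i (ℕₚ.m≤n⇒m≤1+n i≤n))) (p (suc n) ℕₚ.≤-refl)

infixl 7 _·_
-- Opacity keeps the type checker from expanding coefficients of large products; `·-def` is the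
-- bridge back to the Cauchy sum.
opaque
  _·_ : PS → PS → PS
  _·_ = _⊗_

  ·-def : ∀ a b n → (a · b) n ≡ (a ⊗ b) n
  ·-def a b n = refl

·-zero : ∀ a b → (a · b) 0 ≡ a 0 * b 0
·-zero a b = ·-def a b 0

·-suc : ∀ a b n → (a · b) (suc n) ≡ a 0 * b (suc n) + ((a ∘ suc) · b) n
·-suc a b n = trans (·-def a b (suc n)) (trans (sumTo-suc n _) (cong (λ x → a 0 * b (suc n) + x) (sym (·-def (a ∘ suc) b n))))

open module PS-series = PowerSeries ℚₚ.+-*-commutativeRing _·_ ·-zero ·-suc public
  using (_≋_; _≋[_]_) renaming (seriesRing to PS-ring; truncRing to PS-truncRing)

module S = CommutativeRing PS-ring
module PSolver = IntegerSolver PS-ring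
module ≋-Reasoning where
  open import Relation.Binary.Reasoning.Setoid S.setoid public

one≋1 : one ≋ S.1#
one≋1 zero    = refl
one≋1 (suc _) = refl

const-· : ∀ c a → const c · a ≋ (λ n → c * a n)
const-· c a zero    = ·-zero (const c) a
const-· c a (suc n) = trans (·-suc (const c) a n) (trans (cong (λ x → c * a (suc n) + x) (S.zeroˡ a n)) (ℚₚ.+-identityʳ _))

const-* : ∀ c d → const c · const d ≋ const (c * d)
const-* c d zero    = ·-zero (const c) (const d)
const-* c d (suc n) = trans (const-· c (const d) (suc n)) (ℚₚ.*-zeroʳ c)

qpow-0 : qpow 0 ≋ S.1#
qpow-0 zero    = refl
qpow-0 (suc n) = refl

shift : PS → PS
shift a zero    = 0ℚ
shift a (suc n) = a n

qpow-suc-· : ∀ j a → qpow (suc j) · a ≋ shift (qpow j · a)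
qpow-suc-· j a zero    = trans (·-zero (qpow (suc j)) a) (ℚₚ.*-zeroˡ (a 0))
qpow-suc-· j a (suc n) = trans (·-suc (qpow (suc j)) a n) (trans (cong (_+ (qpow j · a) n) (ℚₚ.*-zeroˡ (a (suc n)))) (ℚₚ.+-identityˡ _))

qpow-·-low : ∀ {m n} a → n < m → (qpow m · a) n ≡ 0ℚ
qpow-·-low {suc m} {zero}  a _         = qpow-suc-· m a 0
qpow-·-low {suc m} {suc n} a (s≤s n<m) = trans (qpow-suc-· m a (suc n)) (qpow-·-low {m} a n<m)

qpow-+ : ∀ m n → qpow m · qpow n ≋ qpow (m ℕ.+ n)
qpow-+ zero n = S.trans (S.*-congʳ {qpow n} qpow-0) (S.*-identityˡ (qpow n))
qpow-+ (suc m) n i = trans (qpow-suc-· m (qpow n) i) (go i)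
  where
  go : ∀ i → shift (qpow m · qpow n) i ≡ qpow (suc m ℕ.+ n) i
  go zero    = refl
  go (suc i) = qpow-+ m n i

qpow-low : ∀ {m n} → n < m → qpow m n ≡ 0ℚ
qpow-low {m} {n} n<m = trans (sym (S.*-identityʳ (qpow m) n)) (qpow-·-low {m} S.1# n<m)

-- Stage n + 1 of `invApprox` copies all coefficients up to n from stage n, so an entry never
-- changes once computed.
inv-stable : ∀ a {i n} → i ≤ n → invApprox a n i ≡ inv a i
inv-stable a {i} {zero} z≤n = refl
inv-stable a {i} {suc n} i≤1+n with i ≤? n
... | yes i≤n rewrite dec-true (i ≤? n) i≤n = inv-stable a i≤n
... | no i≰n with refl ← ℕₚ.≤-antisym i≤1+n (ℕₚ.≰⇒> i≰n) = refl

inv-suc : ∀ a n → inv a (suc n) ≡ - ((a ∘ suc) · inv a) n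
inv-suc a n rewrite dec-false (suc n ≤? n) ℕₚ.1+n≰n =
  cong -_ (trans (sumTo-cong n (λ i _ → cong (a (suc i) *_) (inv-stable a (ℕₚ.m∸n≤m n i)))) (sym (·-def (a ∘ suc) (inv a) n)))

·-inverseʳ : ∀ a → a 0 ≡ 1ℚ → a · inv a ≋ S.1#
·-inverseʳ a a0 zero    = trans (·-zero a (inv a)) (cong (_* 1ℚ) a0)
·-inverseʳ a a0 (suc n) = begin
  (a · inv a) (suc n)                       ≡⟨ ·-suc a (inv a) n ⟩
  a 0 * inv a (suc n) + t                   ≡⟨ cong₂ (λ x y → x * y + t) a0 (inv-suc a n) ⟩
  1ℚ * - t + t                              ≡⟨ cong (_+ t) (ℚₚ.*-identityˡ (- t)) ⟩
  - t + t                                   ≡⟨ ℚₚ.+-inverseˡ t ⟩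
  0ℚ                                        ∎
  where
  open ≡.≡-Reasoning
  t = ((a ∘ suc) · inv a) n

open import Algebra.Properties.Semiring.Exp S.semiring using (_^_; ^-homo-*; ^-congˡ)

-- Finitely supported sums

private
  variable
    I J K : Set

module Pointed (_≟_ : DecidableEquality I) where
  δ : I → I → ℚ → ℚ
  δ i j c = if does (i ≟ j) then c else 0ℚ

  δ-yes : ∀ {i j} c → i ≡ j → δ i j c ≡ c
  δ-yes {i} {j} c i≡j = cong (if_then c else 0ℚ) (dec-true (i ≟ j) i≡j)

  δ-no : ∀ {i j} c → ¬ i ≡ j → δ i j c ≡ 0ℚ
  δ-no {i} {j} c i≢j = cong (if_then c else 0ℚ) (dec-false (i ≟ j) i≢j)

  ev : List (I × ℚ) → I → ℚ
  ev []            i = 0ℚ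
  ev ((j , c) ∷ l) i = δ i j c + ev l i

total : List (I × ℚ) → ℚ
total []            = 0ℚ
total ((_ , c) ∷ l) = c + total l

total-++ : ∀ (l l′ : List (I × ℚ)) → total (l ++ l′) ≡ total l + total l′
total-++ []            l′ = sym (ℚₚ.+-identityˡ _)
total-++ ((_ , c) ∷ l) l′ = trans (cong (c +_) (total-++ l l′)) (sym (ℚₚ.+-assoc c (total l) (total l′)))

module _ (_≟_ : DecidableEquality I) where
  open Pointed _≟_

  ev-++ : ∀ l l′ i → ev (l ++ l′) i ≡ ev l i + ev l′ i
  ev-++ []            l′ i = sym (ℚₚ.+-identityˡ _)
  ev-++ ((j , c) ∷ l) l′ i = trans (cong (δ i j c +_) (ev-++ l l′ i)) (sym (ℚₚ.+-assoc (δ i j c) (ev l i) (ev l′ i)))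

  remove : I → List (I × ℚ) → List (I × ℚ)
  remove j []            = []
  remove j ((i , c) ∷ l) with i ≟ j
  ... | yes _ = remove j l
  ... | no _  = (i , c) ∷ remove j l

  remove-length : ∀ j l → length (remove j l) ≤ length l
  remove-length j []            = z≤n
  remove-length j ((i , c) ∷ l) with i ≟ j
  ... | yes _ = ℕₚ.m≤n⇒m≤1+n (remove-length j l)
  ... | no _  = s≤s (remove-length j l)

  total-remove : ∀ j l → total l ≡ ev l j + total (remove j l)
  total-remove j []            = refl
  total-remove j ((i , c) ∷ l) with i ≟ j
  ... | yes refl = trans (cong (c +_) (total-remove j l))
                     (trans (sym (ℚₚ.+-assoc c (ev l j) _)) (cong (λ x → x + ev l j + total (remove j l)) (sym (δ-yes c refl))))
  ... | no i≢j   = trans (cong (c +_) (total-remove j l))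
                     (trans (+-swapˡ c (ev l j) _)
                       (cong (_+ (c + total (remove j l))) (sym (trans (cong (_+ ev l j) (δ-no c (i≢j ∘ sym))) (ℚₚ.+-identityˡ (ev l j))))))

  ev-remove-≡ : ∀ j l → ev (remove j l) j ≡ 0ℚ
  ev-remove-≡ j []            = refl
  ev-remove-≡ j ((i , c) ∷ l) with i ≟ j
  ... | yes _  = ev-remove-≡ j l
  ... | no i≢j = trans (cong (_+ ev (remove j l) j) (δ-no c (i≢j ∘ sym))) (trans (ℚₚ.+-identityˡ _) (ev-remove-≡ j l))

  ev-remove-≢ : ∀ {i j} l → ¬ i ≡ j → ev (remove j l) i ≡ ev l i
  ev-remove-≢ []            i≢j = refl
  ev-remove-≢ {i} {j} ((k , c) ∷ l) i≢j with k ≟ j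
  ... | yes refl = trans (ev-remove-≢ l i≢j) (sym (trans (cong (_+ ev l i) (δ-no c i≢j)) (ℚₚ.+-identityˡ _)))
  ... | no _     = cong (δ i k c +_) (ev-remove-≢ l i≢j)

  -- Removing every occurrence of the first index changes the total by the value there, which is 0.
  -- The bound n drives the recursion, because `remove` does not return a structural part of the
  -- list.
  total-null : ∀ n l → length l ≤ n → (∀ i → ev l i ≡ 0ℚ) → total l ≡ 0ℚ
  total-null n       []            _         _ = refl
  total-null (suc n) l@((j , c) ∷ l′) (s≤s len) p = begin
    total l                              ≡⟨ total-remove j l ⟩
    ev l j + total (remove j l)          ≡⟨ cong₂ _+_ (p j) (total-null n (remove j l) shorter null) ⟩
    0ℚ + 0ℚ                              ≡⟨⟩
    0ℚ                                   ∎
    where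
    open ≡.≡-Reasoning
    shorter : length (remove j l) ≤ n
    shorter with j ≟ j
    ... | yes _  = ℕₚ.≤-trans (remove-length j l′) len
    ... | no j≢j = contradiction refl j≢j
    null : ∀ i → ev (remove j l) i ≡ 0ℚ
    null i with i ≟ j
    ... | yes refl = ev-remove-≡ j l
    ... | no i≢j   = trans (ev-remove-≢ l i≢j) (p i)

  -- The list may repeat indices and carry zero weights; it represents the function `ev`. This
  -- freedom makes concatenation a valid addition of witnesses.
  record HasSum (f : I → ℚ) (s : ℚ) : Set where
    constructor hasSum
    field
      support : List (I × ℚ)
      ev-≡    : ∀ i → f i ≡ ev support i
      total-≡ : s ≡ total support

open HasSum

mapℚ : (ℚ → ℚ) → List (I × ℚ) → List (I × ℚ)
mapℚ g = map (λ (i , c) → i , g c)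

module _ {_≟_ : DecidableEquality I} where
  open Pointed _≟_

  HasSum-cong : ∀ {f g s t} → (∀ i → f i ≡ g i) → s ≡ t → HasSum _≟_ f s → HasSum _≟_ g t
  HasSum-cong p q (hasSum l e t) = hasSum l (λ i → trans (sym (p i)) (e i)) (trans (sym q) t)

  HasSum-0 : HasSum _≟_ (λ _ → 0ℚ) 0ℚ
  HasSum-0 = hasSum [] (λ _ → refl) refl

  HasSum-+ : ∀ {f g s t} → HasSum _≟_ f s → HasSum _≟_ g t → HasSum _≟_ (λ i → f i + g i) (s + t)
  HasSum-+ (hasSum l e t) (hasSum l′ e′ t′) = hasSum (l ++ l′)
    (λ i → trans (cong₂ _+_ (e i) (e′ i)) (sym (ev-++ _≟_ l l′ i))) (trans (cong₂ _+_ t t′) (sym (total-++ l l′)))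

  ev-scale : ∀ a l i → a * ev l i ≡ ev (mapℚ (a *_) l) i
  ev-scale a []            i = ℚₚ.*-zeroʳ a
  ev-scale a ((j , c) ∷ l) i = trans (ℚₚ.*-distribˡ-+ a (δ i j c) (ev l i)) (cong₂ _+_ δ-scale (ev-scale a l i))
    where
    δ-scale : a * δ i j c ≡ δ i j (a * c)
    δ-scale with does (i ≟ j)
    ... | true  = refl
    ... | false = ℚₚ.*-zeroʳ a

  total-scale : ∀ a (l : List (I × ℚ)) → a * total l ≡ total (mapℚ (a *_) l)
  total-scale a []            = ℚₚ.*-zeroʳ a
  total-scale a ((j , c) ∷ l) = trans (ℚₚ.*-distribˡ-+ a c (total l)) (cong (a * c +_) (total-scale a l))

  HasSum-* : ∀ a {f s} → HasSum _≟_ f s → HasSum _≟_ (λ i → a * f i) (a * s)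
  HasSum-* a (hasSum l e t) = hasSum (mapℚ (a *_) l)
    (λ i → trans (cong (a *_) (e i)) (ev-scale a l i)) (trans (cong (a *_) t) (total-scale a l))

  -- One list followed by the negative of the other represents the zero function, so `total-null`
  -- applies. All rearrangements of theta series rest on this: two evaluations of one family must
  -- agree.
  HasSum-unique : ∀ {f s t} → HasSum _≟_ f s → HasSum _≟_ f t → s ≡ t
  HasSum-unique {f} {s} {t} p q = ℚ-cancel (trans (total-≡ r) (total-null _≟_ _ (support r) ℕₚ.≤-refl null))
    where
    r = HasSum-+ p (HasSum-* (- 1ℚ) q)
    null : ∀ i → ev (support r) i ≡ 0ℚ
    null i = trans (sym (ev-≡ r i)) (solve 1 (λ x → x :+ con (- 1ℚ) :* x := con 0ℚ) refl (f i))
      where open ℚSolver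
    ℚ-cancel : s + - 1ℚ * t ≡ 0ℚ → s ≡ t
    ℚ-cancel e = trans (solve 2 (λ x y → x := (x :+ con (- 1ℚ) :* y) :+ y) refl s t) (trans (cong (_+ t) e) (ℚₚ.+-identityˡ t))
      where open ℚSolver

  HasSum-sumTo : ∀ n {h : ℕ → I → ℚ} {s} → (∀ k → k ≤ n → HasSum _≟_ (h k) (s k)) → HasSum _≟_ (λ i → sumTo n (λ k → h k i)) (sumTo n s)
  HasSum-sumTo zero    p = p 0 z≤n
  HasSum-sumTo (suc n) p = HasSum-+ (HasSum-sumTo n (λ k k≤n → p k (ℕₚ.m≤n⇒m≤1+n k≤n))) (p (suc n) ℕₚ.≤-refl)

module _ {_≟I_ : DecidableEquality I} {_≟J_ : DecidableEquality J} where
  private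
    module I = Pointed _≟I_
    module J = Pointed _≟J_

  push : (I → J) → List (I × ℚ) → List (J × ℚ)
  push e = map (λ (i , c) → e i , c)

  total-push : ∀ e (l : List (I × ℚ)) → total (push e l) ≡ total l
  total-push e []            = refl
  total-push e ((_ , c) ∷ l) = cong (c +_) (total-push e l)

  ev-push : ∀ {e} → (∀ {i i′} → e i ≡ e i′ → i ≡ i′) → ∀ l i → J.ev (push e l) (e i) ≡ I.ev l i
  ev-push {e} inj []            i = refl
  ev-push {e} inj ((j , c) ∷ l) i = cong₂ _+_ δ-push (ev-push inj l i)
    where
    δ-push : J.δ (e i) (e j) c ≡ I.δ i j c
    δ-push with i ≟I j
    ... | yes i≡j = J.δ-yes c (cong e i≡j)
    ... | no i≢j  = J.δ-no c (i≢j ∘ inj)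

  ev-push-∉ : ∀ {e k} → (∀ i → ¬ k ≡ e i) → ∀ l → J.ev (push e l) k ≡ 0ℚ
  ev-push-∉ k∉ []            = refl
  ev-push-∉ k∉ ((j , c) ∷ l) = trans (cong₂ _+_ (J.δ-no c (k∉ j)) (ev-push-∉ k∉ l)) refl

  HasSum-× : ∀ {f g s t} → HasSum _≟I_ f s → HasSum _≟J_ g t → HasSum (≡-dec _≟I_ _≟J_) (λ (i , j) → f i * g j) (s * t)
  HasSum-× {f} {g} {s} {t} (hasSum l e s≡) (hasSum l′ e′ t≡) = hasSum (prod l)
    (λ (i , j) → trans (cong₂ _*_ (e i) (e′ j)) (sym (ev-prod l i j)))
    (trans (cong₂ _*_ s≡ t≡) (sym (total-prod l)))
    where
    module IJ = Pointed (≡-dec _≟I_ _≟J_)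
    row : I × ℚ → List (J × ℚ) → List ((I × J) × ℚ)
    row (i , c) = map (λ (j , d) → (i , j) , c * d)
    prod : List (I × ℚ) → List ((I × J) × ℚ)
    prod []       = []
    prod (x ∷ l)  = row x l′ ++ prod l
    δ-prod : ∀ i j i₀ j₀ c d → IJ.δ (i , j) (i₀ , j₀) (c * d) ≡ I.δ i i₀ c * J.δ j j₀ d
    δ-prod i j i₀ j₀ c d = go (i ≟I i₀) (j ≟J j₀)
      where
      go : Dec (i ≡ i₀) → Dec (j ≡ j₀) → IJ.δ (i , j) (i₀ , j₀) (c * d) ≡ I.δ i i₀ c * J.δ j j₀ d
      go (yes p) (yes q) = trans (IJ.δ-yes (c * d) (cong₂ _,_ p q)) (sym (cong₂ _*_ (I.δ-yes c p) (J.δ-yes d q)))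
      go (yes p) (no j≢) = trans (IJ.δ-no (c * d) (j≢ ∘ cong proj₂)) (sym (trans (cong (I.δ i i₀ c *_) (J.δ-no d j≢)) (ℚₚ.*-zeroʳ (I.δ i i₀ c))))
      go (no i≢) _       = trans (IJ.δ-no (c * d) (i≢ ∘ cong proj₁)) (sym (trans (cong (_* J.δ j j₀ d) (I.δ-no c i≢)) (ℚₚ.*-zeroˡ (J.δ j j₀ d))))
    ev-row : ∀ i₀ c m i j → IJ.ev (row (i₀ , c) m) (i , j) ≡ I.δ i i₀ c * J.ev m j
    ev-row i₀ c []             i j = sym (ℚₚ.*-zeroʳ (I.δ i i₀ c))
    ev-row i₀ c ((j₀ , d) ∷ m) i j = trans (cong₂ _+_ (δ-prod i j i₀ j₀ c d) (ev-row i₀ c m i j)) (sym (ℚₚ.*-distribˡ-+ (I.δ i i₀ c) _ _))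
    ev-prod : ∀ l i j → IJ.ev (prod l) (i , j) ≡ I.ev l i * J.ev l′ j
    ev-prod []             i j = sym (ℚₚ.*-zeroˡ (J.ev l′ j))
    ev-prod ((i₀ , c) ∷ l) i j = trans (ev-++ (≡-dec _≟I_ _≟J_) (row (i₀ , c) l′) (prod l) (i , j))
      (trans (cong₂ _+_ (ev-row i₀ c l′ i j) (ev-prod l i j)) (sym (ℚₚ.*-distribʳ-+ (J.ev l′ j) (I.δ i i₀ c) (I.ev l i))))
    total-row : ∀ i₀ c m → total (row (i₀ , c) m) ≡ c * total m
    total-row i₀ c []             = sym (ℚₚ.*-zeroʳ c)
    total-row i₀ c ((j₀ , d) ∷ m) = trans (cong (c * d +_) (total-row i₀ c m)) (sym (ℚₚ.*-distribˡ-+ c d (total m)))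
    total-prod : ∀ l → total (prod l) ≡ total l * total l′
    total-prod []             = sym (ℚₚ.*-zeroˡ (total l′))
    total-prod ((i₀ , c) ∷ l) = trans (total-++ (row (i₀ , c) l′) (prod l))
      (trans (cong₂ _+_ (total-row i₀ c l′) (total-prod l)) (sym (ℚₚ.*-distribʳ-+ (total l′) c (total l))))

-- `cover` decides in which image a point lies, so a partition serves both to split sums and to
-- define functions on K by cases.
record Partition (e₁ : I → K) (e₂ : J → K) : Set where
  field
    injective₁ : ∀ {i i′} → e₁ i ≡ e₁ i′ → i ≡ i′
    injective₂ : ∀ {j j′} → e₂ j ≡ e₂ j′ → j ≡ j′
    disjoint   : ∀ i j → ¬ e₁ i ≡ e₂ j
    cover      : ∀ k → (∃ λ i → k ≡ e₁ i) ⊎ (∃ λ j → k ≡ e₂ j)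

module _ {_≟I_ : DecidableEquality I} {_≟J_ : DecidableEquality J} {_≟K_ : DecidableEquality K} where

  HasSum-split : ∀ {e₁ : I → K} {e₂ : J → K} → Partition e₁ e₂ → ∀ {f s t} →
                 HasSum _≟I_ (f ∘ e₁) s → HasSum _≟J_ (f ∘ e₂) t → HasSum _≟K_ f (s + t)
  HasSum-split {e₁} {e₂} P {f} (hasSum l e s≡) (hasSum l′ e′ t≡) = hasSum (l₁ ++ l₂)
    (λ k → trans (value k) (sym (ev-++ _≟K_ l₁ l₂ k)))
    (trans (cong₂ _+_ (trans s≡ (sym (total-push {_≟I_ = _≟I_} {_≟K_} e₁ l))) (trans t≡ (sym (total-push {_≟I_ = _≟J_} {_≟K_} e₂ l′)))) (sym (total-++ l₁ l₂)))
    where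
    open Partition P
    module K = Pointed _≟K_
    l₁ = push {_≟I_ = _≟I_} {_≟K_} e₁ l
    l₂ = push {_≟I_ = _≟J_} {_≟K_} e₂ l′
    value : ∀ k → f k ≡ K.ev l₁ k + K.ev l₂ k
    value k with cover k
    ... | inj₁ (i , refl) = trans (trans (e i) (sym (ℚₚ.+-identityʳ _)))
      (sym (cong₂ _+_ (ev-push {_≟I_ = _≟I_} {_≟K_} injective₁ l i) (ev-push-∉ {_≟I_ = _≟J_} {_≟K_} (disjoint i) l′)))
    ... | inj₂ (j , refl) = trans (trans (e′ j) (sym (ℚₚ.+-identityˡ _)))
      (sym (cong₂ _+_ (ev-push-∉ {_≟I_ = _≟I_} {_≟K_} (λ i → disjoint i j ∘ sym) l) (ev-push {_≟I_ = _≟J_} {_≟K_} injective₂ l′ j)))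

module _ {_≟I_ : DecidableEquality I} {_≟K_ : DecidableEquality K} where

  HasSum-reindex : (e : I → K) → (∀ {i i′} → e i ≡ e i′ → i ≡ i′) → (∀ k → ∃ λ i → k ≡ e i) → ∀ {f s} →
                   HasSum _≟I_ (f ∘ e) s → HasSum _≟K_ f s
  HasSum-reindex e inj onto {f} (hasSum l e≡ s≡) = hasSum (push {_≟I_ = _≟I_} {_≟K_} e l)
    (λ k → value k (onto k)) (trans s≡ (sym (total-push {_≟I_ = _≟I_} {_≟K_} e l)))
    where
    module K = Pointed _≟K_
    value : ∀ k → (∃ λ i → k ≡ e i) → f k ≡ K.ev (push {_≟I_ = _≟I_} {_≟K_} e l) k
    value _ (i , refl) = trans (e≡ i) (sym (ev-push {_≟I_ = _≟I_} {_≟K_} inj l i))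

-- q-adic summability: for each n the coefficients of q^n have finite support, which may grow with
-- n.
PSum : DecidableEquality I → (I → PS) → PS → Set
PSum _≟_ F s = ∀ n → HasSum _≟_ (λ i → F i n) (s n)

module _ {_≟_ : DecidableEquality I} where

  PSum-cong : ∀ {F G s t} → (∀ i → F i ≋ G i) → s ≋ t → PSum _≟_ F s → PSum _≟_ G t
  PSum-cong p q h n = HasSum-cong (λ i → p i n) (q n) (h n)

  PSum-unique : ∀ {F s t} → PSum _≟_ F s → PSum _≟_ F t → s ≋ t
  PSum-unique p q n = HasSum-unique (p n) (q n)

  PSum-· : ∀ a {F s} → PSum _≟_ F s → PSum _≟_ (λ i → a · F i) (a · s)
  PSum-· a {F} {s} h n = HasSum-cong (λ i → sym (·-def a (F i) n)) (sym (·-def a s n))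
    (HasSum-sumTo n (λ k _ → HasSum-* (a k) (h (n ∸ k))))

PSum-× : {_≟I_ : DecidableEquality I} {_≟J_ : DecidableEquality J} → ∀ {F G s t} →
         PSum _≟I_ F s → PSum _≟J_ G t → PSum (≡-dec _≟I_ _≟J_) (λ (i , j) → F i · G j) (s · t)
PSum-× {F = F} {G} {s} {t} p q n = HasSum-cong (λ (i , j) → sym (·-def (F i) (G j) n)) (sym (·-def s t n))
  (HasSum-sumTo n (λ k _ → HasSum-× (p k) (q (n ∸ k))))

module ℤSolver = IntegerSolver ℤₚ.+-*-commutativeRing

HasSum-⊤ : ∀ {f : ⊤ → ℚ} → HasSum ⊤ₚ._≟_ f (f tt)
HasSum-⊤ {f} = hasSum ((tt , f tt) ∷ []) (λ _ → sym (ℚₚ.+-identityʳ _)) (sym (ℚₚ.+-identityʳ _))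

ℕ-partition : Partition {⊤} {ℕ} {ℕ} (λ _ → zero) suc
ℕ-partition = record
  { injective₁ = λ _ → refl ; injective₂ = ℕₚ.suc-injective ; disjoint = λ _ _ ()
  ; cover = λ { zero → inj₁ (tt , refl) ; (suc n) → inj₂ (n , refl) } }

HasSum-ℕ : ∀ B {f} → (∀ i → B < i → f i ≡ 0ℚ) → HasSum ℕ._≟_ f (sumTo B f)
HasSum-ℕ zero {f} vanish = HasSum-cong (λ _ → refl) (ℚₚ.+-identityʳ (f 0))
  (HasSum-split {_≟J_ = ℕ._≟_} ℕ-partition HasSum-⊤ (HasSum-cong (λ i → sym (vanish (suc i) (s≤s z≤n))) refl HasSum-0))
HasSum-ℕ (suc B) {f} vanish = HasSum-cong (λ _ → refl) (sym (sumTo-suc B f))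
  (HasSum-split ℕ-partition HasSum-⊤ (HasSum-ℕ B (λ i B<i → vanish (suc i) (s≤s B<i))))

⊖-cover : ∀ N m → (∃ λ k → m ≡ k ⊟ N) ⊎ (∃ λ j → m ≡ -[1+ N ℕ.+ j ])
⊖-cover N (ℤ.+ n) = inj₁ (n ℕ.+ N , sym (trans (ℤₚ.⊖-≥ (ℕₚ.m≤n+m N n)) (cong ℤ.+_ (ℕₚ.m+n∸n≡m n N))))
⊖-cover N -[1+ n ] with suc n ℕ.≤? N
... | yes 1+n≤N = inj₁ (N ∸ suc n , sym (trans (ℤₚ.⊖-≤ (ℕₚ.m∸n≤m N (suc n))) (cong (λ x → ℤ.- ℤ.+ x) (ℕₚ.m∸[m∸n]≡n 1+n≤N))))
... | no 1+n≰N  = inj₂ (n ∸ N , cong -[1+_] (sym (ℕₚ.m+[n∸m]≡n (ℕₚ.≤-pred (ℕₚ.≰⇒> 1+n≰N)))))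

m⊖n+n : ∀ m n → (m ⊟ n) ℤ.+ ℤ.+ n ≡ ℤ.+ m
m⊖n+n m n = trans (cong (ℤ._+ ℤ.+ n) (sym (ℤₚ.m-n≡m⊖n m n)))
  (solve 2 (λ x y → (x :- y) :+ y := x) refl (ℤ.+ m) (ℤ.+ n))
  where open ℤSolver

⊖-injective : ∀ N {k k′} → k ⊟ N ≡ k′ ⊟ N → k ≡ k′
⊖-injective N {k} {k′} eq = ℤₚ.+-injective (trans (sym (m⊖n+n k N)) (trans (cong (ℤ._+ ℤ.+ N) eq) (m⊖n+n k′ N)))

-- Cuts ℤ at -N into m ≥ -N, numbered by k with m = k - N, and the tail m < -N. The upper part is
-- what a polynomial in z can hold after multiplication by z^N; N = 0 is the split by sign.
⊖-partition : ∀ N → Partition (_⊟ N) (λ j → -[1+ N ℕ.+ j ])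
⊖-partition N = record
  { injective₁ = ⊖-injective N
  ; injective₂ = λ eq → ℕₚ.+-cancelˡ-≡ N _ _ (ℤₚ.-[1+-injective eq)
  ; disjoint = λ k j eq → absurd (trans (sym (m⊖n+n k N)) (cong (ℤ._+ ℤ.+ N) eq)) (ℕₚ.m≤m+n N j)
  ; cover = ⊖-cover N }
  where
  absurd : ∀ {k l} → ℤ.+ k ≡ -[1+ l ] ℤ.+ ℤ.+ N → ¬ N ≤ l
  absurd {k} {l} eq N≤l with trans eq (ℤₚ.⊖-< (s≤s N≤l))
  ... | eq′ rewrite ℕₚ.+-∸-assoc 1 N≤l = contradiction eq′ λ ()

-- Theta functions

tri : ℕ → ℕ
tri zero    = 0
tri (suc n) = suc n ℕ.+ tri n

-- This is m(m+1)/2 for every integer m: the expression is invariant under m ↦ -1 - m, which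
-- exchanges the two clauses.
T : ℤ → ℕ
T (ℤ.+ n)  = tri n
T -[1+ n ] = tri n

W : ℕ → ℕ → ℤ → ℕ
W a b m = a ℕ.* T m ℕ.+ b ℕ.* T (ℤ.- m)

-- Exponents involve m(m+1)/2; doubling them makes their identities polynomial identities in ℤ.
record Twice (x : ℕ) (u : ℤ) : Set where
  constructor twice
  field doubled : ℤ.+ x ℤ.* ℤ.+ 2 ≡ u

Twice-id : ∀ x → Twice x (ℤ.+ x ℤ.* ℤ.+ 2)
Twice-id x = twice refl

Twice-resp : ∀ {x u v} → Twice x u → u ≡ v → Twice x v
Twice-resp (twice p) q = twice (trans p q)

Twice-+ : ∀ {x y u v} → Twice x u → Twice y v → Twice (x ℕ.+ y) (u ℤ.+ v)
Twice-+ {x} {y} (twice p) (twice q) = twice (trans (cong (ℤ._* ℤ.+ 2) (ℤₚ.pos-+ x y)) (trans (ℤₚ.*-distribʳ-+ (ℤ.+ 2) (ℤ.+ x) (ℤ.+ y)) (cong₂ ℤ._+_ p q)))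

Twice-* : ∀ {x u} a → Twice x u → Twice (a ℕ.* x) (ℤ.+ a ℤ.* u)
Twice-* {x} a (twice p) = twice (trans (cong (ℤ._* ℤ.+ 2) (ℤₚ.pos-* a x)) (trans (ℤₚ.*-assoc (ℤ.+ a) (ℤ.+ x) (ℤ.+ 2)) (cong (ℤ.+ a ℤ.*_) p)))

Twice-injective : ∀ {x y u v} → Twice x u → Twice y v → u ≡ v → x ≡ y
Twice-injective {x} {y} (twice p) (twice q) u≡v = ℤₚ.+-injective (ℤₚ.*-cancelʳ-≡ (ℤ.+ x) (ℤ.+ y) (ℤ.+ 2) (trans p (trans u≡v (sym q))))

Twice-tri : ∀ n → Twice (tri n) (ℤ.+ n ℤ.* ℤ.+ n ℤ.+ ℤ.+ n)
Twice-tri zero    = twice refl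
Twice-tri (suc n) = Twice-resp (Twice-+ (Twice-id (suc n)) (Twice-tri n))
  (trans (cong (λ x → x ℤ.* ℤ.+ 2 ℤ.+ (ℤ.+ n ℤ.* ℤ.+ n ℤ.+ ℤ.+ n)) (ℤₚ.pos-+ 1 n))
  (trans (solve 1 (λ x → (num 1 :+ x) :* num 2 :+ (x :* x :+ x) := (num 1 :+ x) :* (num 1 :+ x) :+ (num 1 :+ x)) refl (ℤ.+ n))
  (cong (λ x → x ℤ.* x ℤ.+ x) (sym (ℤₚ.pos-+ 1 n)))))
  where open ℤSolver

Twice-T : ∀ m → Twice (T m) (m ℤ.* m ℤ.+ m)
Twice-T (ℤ.+ n)  = Twice-tri n
Twice-T -[1+ n ] = Twice-resp (Twice-tri n) (trans
  (solve 1 (λ x → x :* x :+ x := (:- (num 1 :+ x)) :* (:- (num 1 :+ x)) :+ (:- (num 1 :+ x))) refl (ℤ.+ n))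
  (cong (λ x → (ℤ.- x) ℤ.* (ℤ.- x) ℤ.+ (ℤ.- x)) (sym (ℤₚ.pos-+ 1 n))))
  where open ℤSolver

infixl 8 _²
_² : ℤ → ℤ
m ² = m ℤ.* m

2W : ℕ → ℕ → ℤ → ℤ
2W a b m = ℤ.+ a ℤ.* (m ² ℤ.+ m) ℤ.+ ℤ.+ b ℤ.* (m ² ℤ.- m)

Twice-W : ∀ a b m → Twice (W a b m) (2W a b m)
Twice-W a b m = Twice-resp (Twice-+ (Twice-* a (Twice-T m)) (Twice-* b (Twice-T (ℤ.- m))))
  (solve 3 (λ a b m → a :* (m :* m :+ m) :+ b :* ((:- m) :* (:- m) :+ (:- m)) := a :* (m :* m :+ m) :+ b :* (m :* m :- m)) refl (ℤ.+ a) (ℤ.+ b) m)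
  where open ℤSolver

-- `2W` in the syntax of the solver, shaped so that its evaluation is `2W` by computation.
wt : ∀ {n} → ℕ → ℕ → ℤSolver.Polynomial n → ℤSolver.Polynomial n
wt a b m = con (ℤ.+ a) :* (m :* m :+ m) :+ con (ℤ.+ b) :* (m :* m :- m)
  where open ℤSolver

n≤tri : ∀ n → n ≤ tri n
n≤tri zero    = z≤n
n≤tri (suc n) = ℕₚ.m≤m+n (suc n) (tri n)

∣m∣≤1+T : ∀ m → ∣ m ∣ ≤ suc (T m)
∣m∣≤1+T (ℤ.+ n)  = ℕₚ.m≤n⇒m≤1+n (n≤tri n)
∣m∣≤1+T -[1+ n ] = s≤s (n≤tri n)

-- A linear bound is enough: only terms with |m| ≤ n + 1 can reach q^n, whence the cut-off in `θ`.
-- The 1 is there for m = -1, where `T` is 0.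
∣m∣≤1+W : ∀ a b m → ∣ m ∣ ≤ suc (W (suc a) b m)
∣m∣≤1+W a b m = ℕₚ.≤-trans (∣m∣≤1+T m) (s≤s (ℕₚ.≤-trans (ℕₚ.m≤m+n (T m) _) (ℕₚ.m≤m+n (suc a ℕ.* T m) _)))

-- When ε² = 1 this is ε^m also for negative m, without any inverse.
_^ᶻ_ : ℚ → ℤ → ℚ
ε ^ᶻ m = go ∣ m ∣
  where
  go : ℕ → ℚ
  go zero    = 1ℚ
  go (suc n) = ε * go n

term : ℚ → ℕ → ℕ → ℤ → PS
term ε a b m = const (ε ^ᶻ m) · qpow (W a b m)

term-low : ∀ ε a b m n → suc n < ∣ m ∣ → term ε (suc a) b m n ≡ 0ℚ
term-low ε a b m n 1+n<∣m∣ = trans (const-· (ε ^ᶻ m) (qpow (W (suc a) b m)) n)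
  (trans (cong (ε ^ᶻ m *_) (qpow-low (ℕₚ.≤-pred (ℕₚ.≤-trans 1+n<∣m∣ (∣m∣≤1+W a b m))))) (ℚₚ.*-zeroʳ (ε ^ᶻ m)))

-- Σ_m ε^m q^(a m(m+1)/2 + b m(m-1)/2), Ramanujan's f(ε q^a, ε q^b) when ε = ±1.
θ : ℚ → ℕ → ℕ → PS
θ ε a b n = sumTo (suc n) (λ i → term ε a b (ℤ.+ i) n) + sumTo (suc n) (λ i → term ε a b -[1+ i ] n)

PSum-θ : ∀ ε a b → PSum ℤ._≟_ (term ε (suc a) b) (θ ε (suc a) b)
PSum-θ ε a b n = HasSum-split (⊖-partition 0)
  (HasSum-ℕ (suc n) (λ i 1+n<i → term-low ε a b (ℤ.+ i) n 1+n<i))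
  (HasSum-ℕ (suc n) (λ i 1+n<i → term-low ε a b -[1+ i ] n (ℕₚ.m≤n⇒m≤1+n 1+n<i)))

Unit : PS → Set
Unit u = u 0 ≡ 1ℚ

Unit-· : ∀ {a b} → Unit a → Unit b → Unit (a · b)
Unit-· {a} {b} p q = trans (·-zero a b) (cong₂ _*_ p q)

unit-cancel : ∀ {u x y} → Unit u → u · x ≋ u · y → x ≋ y
unit-cancel {u} p = Cancel.cancelˡ PS-ring u (inv u) (·-inverseʳ u p)

prodTo : (ℕ → PS) → ℕ → PS
prodTo g zero    = S.1#
prodTo g (suc N) = prodTo g N · g N

Π : (ℕ → PS) → PS
Π g n = prodTo g n n

prodTo-cong : ∀ {g h} → (∀ v → g v ≋ h v) → ∀ N → prodTo g N ≋ prodTo h N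
prodTo-cong p zero    = S.refl
prodTo-cong p (suc N) = S.*-cong (prodTo-cong p N) (p N)

prodTo-· : ∀ g h N → prodTo (λ v → g v · h v) N ≋ prodTo g N · prodTo h N
prodTo-· g h zero    = S.sym (S.*-identityˡ S.1#)
prodTo-· g h (suc N) = S.trans (S.*-congʳ (prodTo-· g h N))
  (solve 4 (λ a b c d → (a :* b) :* (c :* d) := (a :* c) :* (b :* d)) S.refl (prodTo g N) (prodTo h N) (g N) (h N))
  where open PSolver

Unit-prodTo : ∀ {g} → (∀ v → Unit (g v)) → ∀ N → Unit (prodTo g N)
Unit-prodTo p zero    = refl
Unit-prodTo {g} p (suc N) = Unit-· {prodTo g N} {g N} (Unit-prodTo p N) (p N)

-- Factor v differs from 1 only from q^(v+1) on. Factors with v ≥ n then leave coefficient n alone,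
-- so the diagonal definition of `Π` gives the infinite product.
Tame : (ℕ → PS) → Set
Tame g = ∀ v → g v ≋[ v ] S.1#

prodTo-stable : ∀ {g} → Tame g → ∀ {M} d → prodTo g (d ℕ.+ M) ≋[ M ] prodTo g M
prodTo-stable tame zero    n n≤M = refl
prodTo-stable {g} tame {M} (suc d) = T.trans
  (T.*-cong (prodTo-stable tame d) (λ n n≤M → tame (d ℕ.+ M) n (ℕₚ.≤-trans n≤M (ℕₚ.m≤n+m M d))))
  (T.*-identityʳ (prodTo g M))
  where module T = CommutativeRing (PS-truncRing M)

Π-approx : ∀ {g} → Tame g → ∀ {M N} → M ≤ N → Π g ≋[ M ] prodTo g N
Π-approx {g} tame {M} {N} M≤N n n≤M = sym (trans
  (cong (λ k → prodTo g k n) (sym (ℕₚ.m∸n+n≡m (ℕₚ.≤-trans n≤M M≤N))))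
  (prodTo-stable tame {n} (N ∸ n) n ℕₚ.≤-refl))

-- The Jacobi triple product

module QBinomial (s : ℕ) where
  Q : ℕ → PS
  Q k = qpow (suc s ℕ.* k)

  qfactor : ℕ → PS
  qfactor v = S.1# S.- Q (suc v)

  qfac : ℕ → PS
  qfac = prodTo qfactor

  -- The Gaussian binomial coefficient of k + l over k in base q^(s+1), indexed symmetrically by its
  -- two parts.
  qbin : ℕ → ℕ → PS
  qbin zero    l       = S.1#
  qbin (suc k) zero    = S.1#
  qbin (suc k) (suc l) = qbin k (suc l) S.+ Q (suc k) · qbin (suc k) l

  Q-+ : ∀ k l → Q k · Q l ≋ Q (k ℕ.+ l)
  Q-+ k l = S.trans (qpow-+ (suc s ℕ.* k) (suc s ℕ.* l)) (S.reflexive (cong qpow (sym (ℕₚ.*-distribˡ-+ (suc s) k l))))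

  Q-low : ∀ k → Q (suc k) ≋[ k ] S.0#
  Q-low k n n≤k = qpow-low (ℕₚ.≤-trans (s≤s n≤k) (ℕₚ.m≤m+n (suc k) _))

  qfactor-tame : Tame qfactor
  qfactor-tame v n n≤v = trans (cong (λ x → S.1# n + - x) (Q-low v n n≤v)) (ℚₚ.+-identityʳ _)

  Unit-qfac : ∀ k → Unit (qfac k)
  Unit-qfac = Unit-prodTo (λ v → qfactor-tame v 0 z≤n)

  private
    Q-suc-suc : ∀ k l → S.1# S.- Q (suc k) · Q (suc l) ≋ qfactor (k ℕ.+ suc l)
    Q-suc-suc k l = S.+-congˡ {S.1#} (S.-‿cong (Q-+ (suc k) (suc l)))

  -- The factorial formula. With x and y the powers of the base belonging to k + 1 and l + 1, the
  -- induction step is (1 - x) + x (1 - y) = 1 - x y.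
  qbin-qfac : ∀ k l → qbin k l · qfac k · qfac l ≋ qfac (k ℕ.+ l)
  qbin-qfac-step₁ : ∀ k l → qbin k (suc l) · qfac k · qfac (suc l) ≋ qfac (k ℕ.+ suc l)
  qbin-qfac-step₂ : ∀ k l → qbin (suc k) l · qfac (suc k) · qfac l ≋ qfac (k ℕ.+ suc l)

  qbin-qfac zero    l    = S.trans (S.*-congʳ (S.*-identityˡ S.1#)) (S.*-identityˡ (qfac l))
  qbin-qfac (suc k) zero = S.trans (S.*-identityʳ _) (S.trans (S.*-identityˡ (qfac (suc k))) (S.reflexive (cong qfac (sym (ℕₚ.+-identityʳ (suc k))))))
  qbin-qfac (suc k) (suc l) = begin
    (B₁ S.+ q · B₂) · (F · (S.1# S.- q)) · (G · (S.1# S.- r))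
      ≈⟨ solve 6 (λ B₁ B₂ q r F G → (B₁ :+ q :* B₂) :* (F :* (𝟙 :- q)) :* (G :* (𝟙 :- r))
           := (B₁ :* F :* (G :* (𝟙 :- r))) :* (𝟙 :- q) :+ q :* (B₂ :* (F :* (𝟙 :- q)) :* G) :* (𝟙 :- r)) S.refl B₁ B₂ q r F G ⟩
    (B₁ · F · (G · (S.1# S.- r))) · (S.1# S.- q) S.+ q · (B₂ · (F · (S.1# S.- q)) · G) · (S.1# S.- r)
      ≈⟨ S.+-cong (S.*-congʳ (qbin-qfac-step₁ k l)) (S.*-congʳ (S.*-congˡ {q} (qbin-qfac-step₂ k l))) ⟩
    H · (S.1# S.- q) S.+ q · H · (S.1# S.- r)
      ≈⟨ solve 3 (λ q r H → H :* (𝟙 :- q) :+ q :* H :* (𝟙 :- r) := H :* (𝟙 :- q :* r)) S.refl q r H ⟩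
    H · (S.1# S.- q · r)
      ≈⟨ S.*-congˡ {H} (Q-suc-suc k l) ⟩
    qfac (suc k ℕ.+ suc l) ∎
    where
    open ≋-Reasoning
    open PSolver
    𝟙 : ∀ {n} → Polynomial n
    𝟙 = num 1
    B₁ = qbin k (suc l) ; B₂ = qbin (suc k) l ; q = Q (suc k) ; r = Q (suc l) ; F = qfac k ; G = qfac l
    H = qfac (k ℕ.+ suc l)
  qbin-qfac-step₁ k l = qbin-qfac k (suc l)
  qbin-qfac-step₂ k l = S.trans (qbin-qfac (suc k) l) (S.reflexive (cong qfac (sym (ℕₚ.+-suc k l))))

  -- The second Pascal rule; the first is the definition of `qbin`. It follows from the factorial
  -- formula, this time with y (1 - x) + (1 - y) = 1 - x y.
  qbin-pascal : ∀ k l → qbin (suc k) (suc l) ≋ Q (suc l) · qbin k (suc l) S.+ qbin (suc k) l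
  qbin-pascal k l = unit-cancel {qfac (suc k) · qfac (suc l)} (Unit-· {qfac (suc k)} {qfac (suc l)} (Unit-qfac (suc k)) (Unit-qfac (suc l))) (begin
    qfac (suc k) · qfac (suc l) · qbin (suc k) (suc l)
      ≈⟨ solve 3 (λ a b c → a :* b :* c := c :* a :* b) S.refl (qfac (suc k)) (qfac (suc l)) (qbin (suc k) (suc l)) ⟩
    qbin (suc k) (suc l) · qfac (suc k) · qfac (suc l)
      ≈⟨ qbin-qfac (suc k) (suc l) ⟩
    qfac (suc k ℕ.+ suc l)
      ≈⟨ S.*-congˡ {H} (Q-suc-suc k l) ⟨
    H · (S.1# S.- q · r)
      ≈⟨ solve 3 (λ q r H → r :* H :* (𝟙 :- q) :+ H :* (𝟙 :- r) := H :* (𝟙 :- q :* r)) S.refl q r H ⟨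
    r · H · (S.1# S.- q) S.+ H · (S.1# S.- r)
      ≈⟨ S.+-cong (S.*-congʳ (S.*-congˡ {r} (qbin-qfac-step₁ k l))) (S.*-congʳ (qbin-qfac-step₂ k l)) ⟨
    r · (B₁ · F · (G · (S.1# S.- r))) · (S.1# S.- q) S.+ (B₂ · (F · (S.1# S.- q)) · G) · (S.1# S.- r)
      ≈⟨ solve 6 (λ B₁ B₂ q r F G → r :* (B₁ :* F :* (G :* (𝟙 :- r))) :* (𝟙 :- q) :+ (B₂ :* (F :* (𝟙 :- q)) :* G) :* (𝟙 :- r)
           := (F :* (𝟙 :- q)) :* (G :* (𝟙 :- r)) :* (r :* B₁ :+ B₂)) S.refl B₁ B₂ q r F G ⟩
    qfac (suc k) · qfac (suc l) · (r · B₁ S.+ B₂) ∎)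
    where
    open ≋-Reasoning
    open PSolver
    𝟙 : ∀ {n} → Polynomial n
    𝟙 = num 1
    B₁ = qbin k (suc l) ; B₂ = qbin (suc k) l ; q = Q (suc k) ; r = Q (suc l) ; F = qfac k ; G = qfac l
    H = qfac (k ℕ.+ suc l)

  qfac-∞ : PS
  qfac-∞ = Π qfactor

  Unit-qfac-∞ : Unit qfac-∞
  Unit-qfac-∞ = refl

  -- All three q-factorials in `qbin-qfac` agree with `qfac-∞` modulo q^(M+1), and one copy of it
  -- cancels.
  qbin-limit : ∀ {M k l} → M ≤ k → M ≤ l → qbin k l · qfac-∞ ≋[ M ] S.1#
  qbin-limit {M} {k} {l} M≤k M≤l = Cancel.cancelˡ (PS-truncRing M) qfac-∞ (inv qfac-∞)
    (λ n _ → ·-inverseʳ qfac-∞ Unit-qfac-∞ n) (begin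
    qfac-∞ · (qbin k l · qfac-∞)    ≈⟨ T.*-comm qfac-∞ _ ⟩
    qbin k l · qfac-∞ · qfac-∞      ≈⟨ T.*-cong (T.*-congˡ {qbin k l} (Π-approx qfactor-tame M≤k)) (Π-approx qfactor-tame M≤l) ⟩
    qbin k l · qfac k · qfac l      ≈⟨ (λ n _ → qbin-qfac k l n) ⟩
    qfac (k ℕ.+ l)                  ≈⟨ Π-approx qfactor-tame (ℕₚ.≤-trans M≤k (ℕₚ.m≤m+n k l)) ⟨
    qfac-∞                          ≈⟨ T.*-identityʳ qfac-∞ ⟨
    qfac-∞ · S.1#                   ∎)
    where
    module T = CommutativeRing (PS-truncRing M)
    open import Relation.Binary.Reasoning.Setoid T.setoid

-- A list of pairs (u , v) stands for the polynomial ∏ (u + v z).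
coef : List (PS × PS) → ℕ → PS
coef []             zero    = S.1#
coef []             (suc k) = S.0#
coef ((u , v) ∷ fs) zero    = u · coef fs zero
coef ((u , v) ∷ fs) (suc k) = u · coef fs (suc k) S.+ v · coef fs k

evalAt : PS → List (PS × PS) → PS
evalAt z []             = S.1#
evalAt z ((u , v) ∷ fs) = (u S.+ v · z) · evalAt z fs

delay : (ℕ → PS) → ℕ → PS
delay F zero    = S.0#
delay F (suc k) = F k

PSum-delay : ∀ {F s} → PSum ℕ._≟_ F s → PSum ℕ._≟_ (delay F) s
PSum-delay {F} {s} h n = HasSum-cong (λ _ → refl) (ℚₚ.+-identityˡ (s n)) (HasSum-split ℕ-partition HasSum-⊤ (h n))

PSum-coef : ∀ z fs → PSum ℕ._≟_ (λ k → z ^ k · coef fs k) (evalAt z fs)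
PSum-coef z [] n = HasSum-cong (λ _ → refl) (trans (ℚₚ.+-identityʳ ((S.1# · S.1#) n)) (S.*-identityˡ S.1# n))
  (HasSum-split {_≟J_ = ℕ._≟_} ℕ-partition HasSum-⊤ (HasSum-cong (λ k → sym (S.zeroʳ (z ^ suc k) n)) refl HasSum-0))
PSum-coef z ((u , v) ∷ fs) = PSum-cong same
  (solve 4 (λ u v z e → u :* e :+ (v :* z) :* e := (u :+ v :* z) :* e) S.refl u v z (evalAt z fs))
  (λ n → HasSum-+ (PSum-· u (PSum-coef z fs) n) (PSum-delay (PSum-· (v · z) (PSum-coef z fs)) n))
  where
  open PSolver
  same : ∀ k → (λ n → (u · (z ^ k · coef fs k)) n + delay (λ k → v · z · (z ^ k · coef fs k)) k n) ≋ z ^ k · coef ((u , v) ∷ fs) k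
  same zero    = solve 2 (λ u c → u :* (num 1 :* c) :+ num 0 := num 1 :* (u :* c)) S.refl u (coef fs 0)
  same (suc k) = solve 6 (λ u v z p c d → u :* ((z :* p) :* c) :+ (v :* z) :* (p :* d) := (z :* p) :* (u :* c :+ v :* d)) S.refl
    u v z (z ^ k) (coef fs (suc k)) (coef fs k)

^ᶻ-+ : ∀ ε n → const (ε ^ᶻ (ℤ.+ n)) ≋ const ε ^ n
^ᶻ-+ ε zero zero    = refl
^ᶻ-+ ε zero (suc _) = refl
^ᶻ-+ ε (suc n) = S.trans (S.sym (const-* ε (ε ^ᶻ (ℤ.+ n)))) (S.*-congˡ {const ε} (^ᶻ-+ ε n))

-- As ε is its own inverse, ε^N can stand for the ε^(-N) that undoes the shift by z^N.
^ᶻ-⊟ : ∀ ε → ε * ε ≡ 1ℚ → ∀ k N → const (ε ^ᶻ (k ⊟ N)) ≋ const ε ^ N · const ε ^ k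
^ᶻ-⊟ ε ε² k zero = S.trans (^ᶻ-+ ε k) (S.sym (S.*-identityˡ _))
^ᶻ-⊟ ε ε² zero (suc N) = S.trans (^ᶻ-+ ε (suc N)) (S.sym (S.*-identityʳ _))
^ᶻ-⊟ ε ε² (suc k) (suc N) = S.trans (S.reflexive (cong (λ m → const (ε ^ᶻ m)) (ℤₚ.[1+m]⊖[1+n]≡m⊖n k N))) (S.trans (^ᶻ-⊟ ε ε² k N) (S.sym (begin
  const ε · const ε ^ N · (const ε · const ε ^ k)    ≈⟨ solve 3 (λ e p r → (e :* p) :* (e :* r) := (e :* e) :* (p :* r)) S.refl (const ε) (const ε ^ N) (const ε ^ k) ⟩
  const ε · const ε · (const ε ^ N · const ε ^ k)    ≈⟨ S.*-congʳ ε·ε ⟩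
  S.1# · (const ε ^ N · const ε ^ k)                 ≈⟨ S.*-identityˡ _ ⟩
  const ε ^ N · const ε ^ k                          ∎)))
  where
  open ≋-Reasoning
  open PSolver
  ε·ε : const ε · const ε ≋ S.1#
  ε·ε zero    = trans (const-* ε ε 0) ε²
  ε·ε (suc n) = const-* ε ε (suc n)

module TripleProduct (a′ b : ℕ) where
  private
    a : ℕ
    a = suc a′
  open QBinomial (a′ ℕ.+ b) public
  private
    step : ℕ
    step = suc (a′ ℕ.+ b)

  -- A factor q^e + z is z times 1 + z^(-1) q^e. The product of `factors i j` is therefore z^j times
  -- a partial product of the Laurent product, and stays a polynomial.
  factorsʸ : ℕ → List (PS × PS)
  factorsʸ zero    = []
  factorsʸ (suc j) = (qpow (b ℕ.+ step ℕ.* j) , S.1#) ∷ factorsʸ j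

  factors : ℕ → ℕ → List (PS × PS)
  factors zero    j = factorsʸ j
  factors (suc i) j = (S.1# , qpow (a ℕ.+ step ℕ.* i)) ∷ factors i j

  private
    w : ℤ → PS
    w m = qpow (W a b m)

    Twice-W⊟ : ∀ k j → Twice (W a b (k ⊟ j)) (2W a b (ℤ.+ k ℤ.- ℤ.+ j))
    Twice-W⊟ k j = Twice-resp (Twice-W a b (k ⊟ j))
      (cong (2W a b) (sym (ℤₚ.m-n≡m⊖n k j)))

    weightʸ : ∀ k j → (b ℕ.+ step ℕ.* j) ℕ.+ W a b (k ⊟ j) ≡ step ℕ.* k ℕ.+ W a b (k ⊟ suc j)
    weightʸ k j = Twice-injective
      (Twice-+ (Twice-+ (Twice-id b) (Twice-* step (Twice-id j))) (Twice-W⊟ k j))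
      (Twice-+ (Twice-* step (Twice-id k)) (Twice-W⊟ k (suc j)))
      (solve 4 (λ A B k j → (B :* 𝟚 :+ (A :+ B) :* (j :* 𝟚)) :+ (A :* ((k :- j) :* (k :- j) :+ (k :- j)) :+ B :* ((k :- j) :* (k :- j) :- (k :- j)))
        := (A :+ B) :* (k :* 𝟚) :+ (A :* ((k :- (𝟙 :+ j)) :* (k :- (𝟙 :+ j)) :+ (k :- (𝟙 :+ j))) :+ B :* ((k :- (𝟙 :+ j)) :* (k :- (𝟙 :+ j)) :- (k :- (𝟙 :+ j)))))
        refl (ℤ.+ a) (ℤ.+ b) (ℤ.+ k) (ℤ.+ j))
      where
      open ℤSolver
      𝟙 𝟚 : ∀ {n} → Polynomial n
      𝟙 = num 1
      𝟚 = num 2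

    weightˣ : ∀ i j k m → i ℕ.+ j ≡ k ℕ.+ m → (a ℕ.+ step ℕ.* i) ℕ.+ W a b (k ⊟ j) ≡ step ℕ.* m ℕ.+ W a b (suc k ⊟ j)
    weightˣ i j k m i+j≡k+m = Twice-injective
      (Twice-+ (Twice-+ (Twice-id a) (Twice-* step (Twice-resp (Twice-id i) (cong (ℤ._* ℤ.+ 2) i≡)))) (Twice-W⊟ k j))
      (Twice-+ (Twice-* step (Twice-id m)) (Twice-W⊟ (suc k) j))
      (solve 5 (λ A B k j m → (A :* 𝟚 :+ (A :+ B) :* (((k :+ m) :- j) :* 𝟚)) :+ (A :* ((k :- j) :* (k :- j) :+ (k :- j)) :+ B :* ((k :- j) :* (k :- j) :- (k :- j)))
        := (A :+ B) :* (m :* 𝟚) :+ (A :* (((𝟙 :+ k) :- j) :* ((𝟙 :+ k) :- j) :+ ((𝟙 :+ k) :- j)) :+ B :* (((𝟙 :+ k) :- j) :* ((𝟙 :+ k) :- j) :- ((𝟙 :+ k) :- j))))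
        refl (ℤ.+ a) (ℤ.+ b) (ℤ.+ k) (ℤ.+ j) (ℤ.+ m))
      where
      open ℤSolver
      𝟙 𝟚 : ∀ {n} → Polynomial n
      𝟙 = num 1
      𝟚 = num 2
      i≡ : ℤ.+ i ≡ (ℤ.+ k ℤ.+ ℤ.+ m) ℤ.- ℤ.+ j
      i≡ = trans (solve 2 (λ i j → i := (i :+ j) :- j) refl (ℤ.+ i) (ℤ.+ j)) (cong (λ x → ℤ.+ x ℤ.- ℤ.+ j) i+j≡k+m)

    stepʸ : ∀ k j → qpow (b ℕ.+ step ℕ.* j) · w (k ⊟ j) ≋ Q k · w (k ⊟ suc j)
    stepʸ k j = S.trans (qpow-+ (b ℕ.+ step ℕ.* j) (W a b (k ⊟ j))) (S.trans (S.reflexive (cong qpow (weightʸ k j))) (S.sym (qpow-+ (step ℕ.* k) (W a b (k ⊟ suc j)))))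

    stepˣ : ∀ i j k m → i ℕ.+ j ≡ k ℕ.+ m → qpow (a ℕ.+ step ℕ.* i) · w (k ⊟ j) ≋ Q m · w (suc k ⊟ j)
    stepˣ i j k m e = S.trans (qpow-+ (a ℕ.+ step ℕ.* i) (W a b (k ⊟ j))) (S.trans (S.reflexive (cong qpow (weightˣ i j k m e))) (S.sym (qpow-+ (step ℕ.* m) (W a b (suc k ⊟ j)))))

    Q-0 : Q 0 ≋ S.1#
    Q-0 = S.trans (S.reflexive (cong qpow (ℕₚ.*-zeroʳ step))) qpow-0

    w-shift : ∀ k j → w (suc k ⊟ suc j) ≋ w (k ⊟ j)
    w-shift k j = S.reflexive (cong w (ℤₚ.[1+m]⊖[1+n]≡m⊖n k j))

  coef-beyond : ∀ i j k → i ℕ.+ j < k → coef (factors i j) k ≋ S.0#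
  coef-beyond zero zero (suc k) _ = S.refl
  coef-beyond zero (suc j) (suc k) (s≤s lt) = S.trans
    (S.+-cong (S.*-congˡ {qpow (b ℕ.+ step ℕ.* j)} (coef-beyond zero j (suc k) (ℕₚ.m≤n⇒m≤1+n lt))) (S.*-congˡ {S.1#} (coef-beyond zero j k lt)))
    (solve 2 (λ x y → x :* num 0 :+ y :* num 0 := num 0) S.refl (qpow (b ℕ.+ step ℕ.* j)) S.1#)
    where open PSolver
  coef-beyond (suc i) j (suc k) (s≤s lt) = S.trans
    (S.+-cong (S.*-congˡ {S.1#} (coef-beyond i j (suc k) (ℕₚ.m≤n⇒m≤1+n lt))) (S.*-congˡ {qpow (a ℕ.+ step ℕ.* i)} (coef-beyond i j k lt)))
    (solve 2 (λ x y → y :* num 0 :+ x :* num 0 := num 0) S.refl (qpow (a ℕ.+ step ℕ.* i)) S.1#)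
    where open PSolver

  -- The finite form of Jacobi's triple product, by induction on the factors. A factor q^e + z calls
  -- for the Pascal rule defining `qbin`, a factor 1 + z q^e for `qbin-pascal`.
  coef-factors : ∀ i j k l → k ℕ.+ l ≡ i ℕ.+ j → coef (factors i j) k ≋ qbin k l · w (k ⊟ j)
  coef-factors zero zero zero l refl = S.sym (S.trans (S.*-congˡ {S.1#} (S.trans (S.reflexive (cong qpow (cong₂ ℕ._+_ (ℕₚ.*-zeroʳ a′) (ℕₚ.*-zeroʳ b)))) qpow-0)) (S.*-identityˡ S.1#))
  coef-factors zero (suc j) zero l refl = begin
    y · coef (factorsʸ j) 0            ≈⟨ S.*-congˡ {y} (coef-factors zero j zero j refl) ⟩
    y · (S.1# · w (0 ⊟ j))             ≈⟨ S.*-congˡ {y} (S.*-identityˡ (w (0 ⊟ j))) ⟩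
    y · w (0 ⊟ j)                      ≈⟨ stepʸ 0 j ⟩
    Q 0 · w (0 ⊟ suc j)                ≈⟨ S.*-congʳ Q-0 ⟩
    S.1# · w (0 ⊟ suc j)               ∎
    where
    open ≋-Reasoning
    y = qpow (b ℕ.+ step ℕ.* j)
  coef-factors zero (suc j) (suc k) zero k+0≡j = begin
    y · coef (factorsʸ j) (suc k) S.+ S.1# · coef (factorsʸ j) k
      ≈⟨ S.+-cong (S.*-congˡ {y} (coef-beyond zero j (suc k) (s≤s (ℕₚ.≤-reflexive (sym k≡j))))) (S.*-congˡ {S.1#} (coef-factors zero j k 0 (ℕₚ.suc-injective k+0≡j))) ⟩
    y · S.0# S.+ S.1# · (qbin k 0 · w (k ⊟ j))
      ≈⟨ solve 3 (λ y c w → y :* num 0 :+ num 1 :* (c :* w) := c :* w) S.refl y (qbin k 0) (w (k ⊟ j)) ⟩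
    qbin k 0 · w (k ⊟ j)
      ≈⟨ S.*-cong (qbin-0 k) (S.sym (w-shift k j)) ⟩
    S.1# · w (suc k ⊟ suc j) ∎
    where
    open ≋-Reasoning
    open PSolver
    y = qpow (b ℕ.+ step ℕ.* j)
    k≡j : k ≡ j
    k≡j = trans (sym (ℕₚ.+-identityʳ k)) (ℕₚ.suc-injective k+0≡j)
    qbin-0 : ∀ k → qbin k 0 ≋ S.1#
    qbin-0 zero    = S.refl
    qbin-0 (suc k) = S.refl
  coef-factors zero (suc j) (suc k) (suc l) eq = begin
    y · coef (factorsʸ j) (suc k) S.+ S.1# · coef (factorsʸ j) k
      ≈⟨ S.+-cong (S.*-congˡ {y} (coef-factors zero j (suc k) l (trans (sym (ℕₚ.+-suc k l)) (ℕₚ.suc-injective eq)))) (S.*-congˡ {S.1#} (coef-factors zero j k (suc l) (ℕₚ.suc-injective eq))) ⟩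
    y · (B₂ · w (suc k ⊟ j)) S.+ S.1# · (B₁ · w (k ⊟ j))
      ≈⟨ solve 5 (λ y B₂ v B₁ u → y :* (B₂ :* v) :+ num 1 :* (B₁ :* u) := B₂ :* (y :* v) :+ B₁ :* u) S.refl y B₂ (w (suc k ⊟ j)) B₁ (w (k ⊟ j)) ⟩
    B₂ · (y · w (suc k ⊟ j)) S.+ B₁ · w (k ⊟ j)
      ≈⟨ S.+-cong (S.*-congˡ {B₂} (stepʸ (suc k) j)) (S.*-congˡ {B₁} (S.sym (w-shift k j))) ⟩
    B₂ · (Q (suc k) · w (suc k ⊟ suc j)) S.+ B₁ · w (suc k ⊟ suc j)
      ≈⟨ solve 4 (λ B₂ q v B₁ → B₂ :* (q :* v) :+ B₁ :* v := (B₁ :+ q :* B₂) :* v) S.refl B₂ (Q (suc k)) (w (suc k ⊟ suc j)) B₁ ⟩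
    qbin (suc k) (suc l) · w (suc k ⊟ suc j) ∎
    where
    open ≋-Reasoning
    open PSolver
    y = qpow (b ℕ.+ step ℕ.* j) ; B₁ = qbin k (suc l) ; B₂ = qbin (suc k) l
  coef-factors (suc i) j zero l refl = S.trans (S.*-identityˡ _) (coef-factors i j zero (i ℕ.+ j) refl)
  coef-factors (suc i) j (suc k) zero eq = begin
    S.1# · coef (factors i j) (suc k) S.+ x · coef (factors i j) k
      ≈⟨ S.+-cong (S.*-congˡ {S.1#} (coef-beyond i j (suc k) (s≤s (ℕₚ.≤-reflexive (sym k≡i+j))))) (S.*-congˡ {x} (coef-factors i j k 0 (ℕₚ.suc-injective eq))) ⟩
    S.1# · S.0# S.+ x · (qbin k 0 · w (k ⊟ j))
      ≈⟨ solve 3 (λ x c w → num 1 :* num 0 :+ x :* (c :* w) := c :* (x :* w)) S.refl x (qbin k 0) (w (k ⊟ j)) ⟩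
    qbin k 0 · (x · w (k ⊟ j))
      ≈⟨ S.*-cong (qbin-0 k) (stepˣ i j k 0 (sym (ℕₚ.suc-injective eq))) ⟩
    S.1# · (Q 0 · w (suc k ⊟ j))
      ≈⟨ S.*-congˡ {S.1#} (S.trans (S.*-congʳ Q-0) (S.*-identityˡ (w (suc k ⊟ j)))) ⟩
    S.1# · w (suc k ⊟ j) ∎
    where
    open ≋-Reasoning
    open PSolver
    x = qpow (a ℕ.+ step ℕ.* i)
    k≡i+j : k ≡ i ℕ.+ j
    k≡i+j = trans (sym (ℕₚ.+-identityʳ k)) (ℕₚ.suc-injective eq)
    qbin-0 : ∀ k → qbin k 0 ≋ S.1#
    qbin-0 zero    = S.refl
    qbin-0 (suc k) = S.refl
  coef-factors (suc i) j (suc k) (suc l) eq = begin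
    S.1# · coef (factors i j) (suc k) S.+ x · coef (factors i j) k
      ≈⟨ S.+-cong (S.*-congˡ {S.1#} (coef-factors i j (suc k) l (trans (sym (ℕₚ.+-suc k l)) (ℕₚ.suc-injective eq)))) (S.*-congˡ {x} (coef-factors i j k (suc l) (ℕₚ.suc-injective eq))) ⟩
    S.1# · (B₂ · w (suc k ⊟ j)) S.+ x · (B₁ · w (k ⊟ j))
      ≈⟨ solve 5 (λ x B₂ v B₁ u → num 1 :* (B₂ :* v) :+ x :* (B₁ :* u) := B₂ :* v :+ B₁ :* (x :* u)) S.refl x B₂ (w (suc k ⊟ j)) B₁ (w (k ⊟ j)) ⟩
    B₂ · w (suc k ⊟ j) S.+ B₁ · (x · w (k ⊟ j))
      ≈⟨ S.+-congˡ {B₂ · w (suc k ⊟ j)} (S.*-congˡ {B₁} (stepˣ i j k (suc l) (sym (ℕₚ.suc-injective eq)))) ⟩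
    B₂ · w (suc k ⊟ j) S.+ B₁ · (Q (suc l) · w (suc k ⊟ j))
      ≈⟨ solve 4 (λ B₂ q v B₁ → B₂ :* v :+ B₁ :* (q :* v) := (q :* B₁ :+ B₂) :* v) S.refl B₂ (Q (suc l)) (w (suc k ⊟ j)) B₁ ⟩
    (Q (suc l) · B₁ S.+ B₂) · w (suc k ⊟ j)
      ≈⟨ S.*-congʳ (qbin-pascal k l) ⟨
    qbin (suc k) (suc l) · w (suc k ⊟ j) ∎
    where
    open ≋-Reasoning
    open PSolver
    x = qpow (a ℕ.+ step ℕ.* i) ; B₁ = qbin k (suc l) ; B₂ = qbin (suc k) l

-- Passage to the limit in the triple product

fac : ℚ → ℕ → PS
fac ε e = S.1# S.+ const ε · qpow e

const-sq : ∀ {ε} → ε * ε ≡ 1ℚ → const ε · const ε ≋ S.1#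
const-sq {ε} ε² zero    = trans (const-* ε ε 0) ε²
const-sq {ε} ε² (suc n) = const-* ε ε (suc n)

qpow-vanish : ∀ {M e} → M < e → qpow e ≋[ M ] S.0#
qpow-vanish M<e n n≤M = qpow-low (ℕₚ.≤-<-trans n≤M M<e)

Distant : ℕ → ℕ → ℕ → Set
Distant d k N = (d ℕ.+ k ≤ N) ⊎ (d ℕ.+ N ≤ k)

distant-abs : ∀ {d k N} → Distant d k N → d ≤ ∣ k ⊟ N ∣
distant-abs {d} {k} {N} (inj₁ d+k≤N) = ℕₚ.≤-trans (ℕₚ.m+n≤o⇒m≤o∸n d d+k≤N) (ℕₚ.≤-reflexive (sym (ℤₚ.∣⊖∣-≤ (ℕₚ.≤-trans (ℕₚ.m≤n+m k d) d+k≤N))))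
distant-abs {d} {k} {N} (inj₂ d+N≤k) = ℕₚ.≤-trans (ℕₚ.m+n≤o⇒m≤o∸n d d+N≤k)
  (ℕₚ.≤-reflexive (sym (trans (ℤₚ.∣m⊖n∣≡∣n⊖m∣ k N) (ℤₚ.∣⊖∣-≤ (ℕₚ.≤-trans (ℕₚ.m≤n+m N d) d+N≤k)))))

-- Three reasons why coefficient k is right modulo q^(M+1). In the centre `qbin` is close to its
-- limit; at the edge and outside, |k - N| ≥ M + 2 makes both sides vanish, where M + 2 instead of M
-- + 1 pays for the 1 in `∣m∣≤1+W`. The condition N ≥ 2M + 2 makes the cases exhaustive.
data Location (M N k : ℕ) : Set where
  central : ∀ l → k ℕ.+ l ≡ N ℕ.+ N → M ≤ k → M ≤ l → Location M N k
  edge    : ∀ l → k ℕ.+ l ≡ N ℕ.+ N → Distant (2 ℕ.+ M) k N → Location M N k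
  outside : N ℕ.+ N < k → Distant (2 ℕ.+ M) k N → Location M N k

locate : ∀ M N → 2 ℕ.+ (M ℕ.+ M) ≤ N → ∀ k → Location M N k
locate M N big k with k ℕ.≤? N ℕ.+ N
... | no k≰2N = outside (ℕₚ.≰⇒> k≰2N) (inj₂ (ℕₚ.≤-trans (ℕₚ.+-monoˡ-≤ N (ℕₚ.≤-trans (s≤s (s≤s (ℕₚ.m≤m+n M M))) big)) (ℕₚ.<⇒≤ (ℕₚ.≰⇒> k≰2N))))
... | yes k≤2N with M ℕ.≤? k | M ℕ.≤? (N ℕ.+ N ∸ k)
...   | yes M≤k | yes M≤l = central (N ℕ.+ N ∸ k) (ℕₚ.m+[n∸m]≡n k≤2N) M≤k M≤l
...   | no M≰k  | _       = edge (N ℕ.+ N ∸ k) (ℕₚ.m+[n∸m]≡n k≤2N) (inj₁ (ℕₚ.≤-trans (ℕₚ.+-monoʳ-≤ (2 ℕ.+ M) (ℕₚ.<⇒≤ (ℕₚ.≰⇒> M≰k))) big))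
...   | yes _   | no M≰l  = edge l (ℕₚ.m+[n∸m]≡n k≤2N) (inj₂ (ℕₚ.+-cancelʳ-≤ l (2 ℕ.+ M ℕ.+ N) k (begin
  2 ℕ.+ M ℕ.+ N ℕ.+ l        ≤⟨ ℕₚ.+-monoʳ-≤ (2 ℕ.+ M ℕ.+ N) (ℕₚ.<⇒≤ (ℕₚ.≰⇒> M≰l)) ⟩
  2 ℕ.+ M ℕ.+ N ℕ.+ M        ≡⟨ ℕₚ.+-assoc (2 ℕ.+ M) N M ⟩
  2 ℕ.+ M ℕ.+ (N ℕ.+ M)      ≡⟨ cong (2 ℕ.+ M ℕ.+_) (ℕₚ.+-comm N M) ⟩
  2 ℕ.+ M ℕ.+ (M ℕ.+ N)      ≡⟨ ℕₚ.+-assoc (2 ℕ.+ M) M N ⟨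
  2 ℕ.+ M ℕ.+ M ℕ.+ N        ≤⟨ ℕₚ.+-monoˡ-≤ N big ⟩
  N ℕ.+ N                    ≡⟨ ℕₚ.m+[n∸m]≡n k≤2N ⟨
  k ℕ.+ l                    ∎)))
  where
  open ℕₚ.≤-Reasoning
  l = N ℕ.+ N ∸ k

module _ (a′ b : ℕ) where
  open TripleProduct a′ b
  private
    a step : ℕ
    a = suc a′
    step = suc (a′ ℕ.+ b)

  distant-W : ∀ {M k N} → Distant (2 ℕ.+ M) k N → M < W a b (k ⊟ N)
  distant-W {M} {k} {N} d = ℕₚ.≤-pred (ℕₚ.≤-trans (distant-abs d) (∣m∣≤1+W a′ b (k ⊟ N)))

  coef-limit : ∀ M N → 2 ℕ.+ (M ℕ.+ M) ≤ N → ∀ k → qfac-∞ · coef (factors N N) k ≋[ M ] qpow (W a b (k ⊟ N))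
  coef-limit M N big k with locate M N big k
  ... | central l k+l≡2N M≤k M≤l = begin
    qfac-∞ · coef (factors N N) k         ≈⟨ T.*-congˡ {qfac-∞} (λ n _ → coef-factors N N k l k+l≡2N n) ⟩
    qfac-∞ · (qbin k l · w)               ≈⟨ (λ n _ → solve 3 (λ e b w → e :* (b :* w) := (b :* e) :* w) S.refl qfac-∞ (qbin k l) w n) ⟩
    qbin k l · qfac-∞ · w                 ≈⟨ T.*-congʳ {w} (qbin-limit M≤k M≤l) ⟩
    S.1# · w                              ≈⟨ T.*-identityˡ w ⟩
    w                                     ∎
    where
    open PSolver
    module T = CommutativeRing (PS-truncRing M)
    open import Relation.Binary.Reasoning.Setoid T.setoid
    w = qpow (W a b (k ⊟ N))
  ... | edge l k+l≡2N d = begin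
    qfac-∞ · coef (factors N N) k         ≈⟨ T.*-congˡ {qfac-∞} (λ n _ → coef-factors N N k l k+l≡2N n) ⟩
    qfac-∞ · (qbin k l · w)               ≈⟨ T.*-congˡ {qfac-∞} (T.*-congˡ {qbin k l} w≈0) ⟩
    qfac-∞ · (qbin k l · S.0#)            ≈⟨ (λ n _ → solve 2 (λ e b → e :* (b :* num 0) := num 0) S.refl qfac-∞ (qbin k l) n) ⟩
    S.0#                                  ≈⟨ w≈0 ⟨
    w                                     ∎
    where
    open PSolver
    module T = CommutativeRing (PS-truncRing M)
    open import Relation.Binary.Reasoning.Setoid T.setoid
    w = qpow (W a b (k ⊟ N))
    w≈0 : w ≋[ M ] S.0#
    w≈0 = qpow-vanish (distant-W {M} {k} {N} d)
  ... | outside 2N<k d = λ n n≤M → trans (S.*-congˡ {qfac-∞} (coef-beyond N N k 2N<k) n)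
    (trans (S.zeroʳ qfac-∞ n) (sym (qpow-vanish (distant-W {M} {k} {N} d) n n≤M)))

  module _ {ε : ℚ} (ε² : ε * ε ≡ 1ℚ) where
    private
      z = const ε
      X Y : ℕ → PS
      X v = fac ε (a ℕ.+ step ℕ.* v)
      Y v = fac ε (b ℕ.+ step ℕ.* v)

    -- Since z² = 1, z (q^e + z) = 1 + z q^e. The power z^j supplies one z for each factor of the
    -- second kind.
    evalAt-factors : ∀ i j → z ^ j · evalAt z (factors i j) ≋ prodTo X i · prodTo Y j
    evalAt-factors zero zero = S.refl
    evalAt-factors zero (suc j) = begin
      z · z ^ j · ((y S.+ S.1# · z) · e)
        ≈⟨ solve 4 (λ z p y e → (z :* p) :* ((y :+ num 1 :* z) :* e) := (p :* e) :* (z :* y :+ z :* z)) S.refl z (z ^ j) y e ⟩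
      z ^ j · e · (z · y S.+ z · z)
        ≈⟨ S.*-cong (evalAt-factors zero j) (S.+-congˡ {z · y} (const-sq ε²)) ⟩
      S.1# · prodTo Y j · (z · y S.+ S.1#)
        ≈⟨ solve 3 (λ z y P → (num 1 :* P) :* (z :* y :+ num 1) := num 1 :* (P :* (num 1 :+ z :* y))) S.refl z y (prodTo Y j) ⟩
      S.1# · (prodTo Y j · Y j) ∎
      where
      open ≋-Reasoning
      open PSolver
      y = qpow (b ℕ.+ step ℕ.* j)
      e = evalAt z (factorsʸ j)
    evalAt-factors (suc i) j = begin
      z ^ j · ((S.1# S.+ x · z) · e)
        ≈⟨ solve 4 (λ z p x e → p :* ((num 1 :+ x :* z) :* e) := (p :* e) :* (num 1 :+ z :* x)) S.refl z (z ^ j) x e ⟩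
      z ^ j · e · X i
        ≈⟨ S.*-congʳ (evalAt-factors i j) ⟩
      prodTo X i · prodTo Y j · X i
        ≈⟨ solve 3 (λ p q x → (p :* q) :* x := (p :* x) :* q) S.refl (prodTo X i) (prodTo Y j) (X i) ⟩
      prodTo X i · X i · prodTo Y j ∎
      where
      open ≋-Reasoning
      open PSolver
      x = qpow (a ℕ.+ step ℕ.* i)
      e = evalAt z (factors i j)

    -- The terms of the theta series are summed twice: directly, and after cutting ℤ at -N. The
    -- upper part is then the finite product evaluated at z = ε, and the tail vanishes modulo
    -- q^(M+1).
    jacobi-triple : ∀ {M N} → 2 ℕ.+ (M ℕ.+ M) ≤ N → θ ε a b ≋[ M ] qfac-∞ · (prodTo X N · prodTo Y N)
    jacobi-triple {M} {N} big n n≤M = trans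
      (HasSum-unique (PSum-θ ε a′ b n) (HasSum-split (⊖-partition N) (HasSum-cong same refl sumℕ) tail))
      (trans (ℚₚ.+-identityʳ _) (S.*-congˡ {qfac-∞} (evalAt-factors N N) n))
      where
      sumℕ : HasSum ℕ._≟_ (λ k → (qfac-∞ · (z ^ N · (z ^ k · coef (factors N N) k))) n) ((qfac-∞ · (z ^ N · evalAt z (factors N N))) n)
      sumℕ = PSum-· qfac-∞ (PSum-· (z ^ N) (PSum-coef z (factors N N))) n
      same : ∀ k → (qfac-∞ · (z ^ N · (z ^ k · coef (factors N N) k))) n ≡ term ε a b (k ⊟ N) n
      same k = T.trans
        (λ n _ → solve 4 (λ e p r c → e :* (p :* (r :* c)) := (p :* r) :* (e :* c)) S.refl qfac-∞ (z ^ N) (z ^ k) (coef (factors N N) k) n)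
        (T.*-cong (λ n _ → sym (^ᶻ-⊟ ε ε² k N n)) (coef-limit M N big k)) n n≤M
        where
        module T = CommutativeRing (PS-truncRing M)
        open PSolver
      tail : HasSum ℕ._≟_ (λ j → term ε a b -[1+ N ℕ.+ j ] n) 0ℚ
      tail = HasSum-cong (λ j → sym (term-low ε a′ b -[1+ N ℕ.+ j ] n (s≤s (begin
        suc n                ≤⟨ s≤s (ℕₚ.≤-trans n≤M (ℕₚ.m≤m+n M M)) ⟩
        suc (M ℕ.+ M)        ≤⟨ ℕₚ.<⇒≤ big ⟩
        N                    ≤⟨ ℕₚ.m≤m+n N j ⟩
        N ℕ.+ j              ∎)))) refl HasSum-0
        where open ℕₚ.≤-Reasoning

-- Infinite products

prodTo-swap : ∀ (g : ℕ → ℕ → PS) N d → prodTo (λ v → prodTo (g v) d) N ≋ prodTo (λ r → prodTo (λ v → g v r) N) d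
prodTo-swap g zero d = S.sym (ones d)
  where
  ones : ∀ d → prodTo (λ _ → S.1#) d ≋ S.1#
  ones zero    = S.refl
  ones (suc d) = S.trans (S.*-identityʳ _) (ones d)
prodTo-swap g (suc N) d = S.trans (S.*-congʳ (prodTo-swap g N d)) (S.sym (prodTo-· _ (g N) d))

prodTo-+ : ∀ g m d → prodTo g (d ℕ.+ m) ≋ prodTo g m · prodTo (λ r → g (r ℕ.+ m)) d
prodTo-+ g m zero    = S.sym (S.*-identityʳ (prodTo g m))
prodTo-+ g m (suc d) = S.trans (S.*-congʳ (prodTo-+ g m d)) (S.*-assoc (prodTo g m) _ (g (d ℕ.+ m)))

prodTo-blocks : ∀ g d N → prodTo (λ v → prodTo (λ r → g (r ℕ.+ v ℕ.* d)) d) N ≋ prodTo g (N ℕ.* d)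
prodTo-blocks g d zero    = S.refl
prodTo-blocks g d (suc N) = S.trans (S.*-congʳ (prodTo-blocks g d N)) (S.sym (prodTo-+ g (N ℕ.* d) d))

prodTo-cong[] : ∀ M {g h} → (∀ r → g r ≋[ M ] h r) → ∀ d → prodTo g d ≋[ M ] prodTo h d
prodTo-cong[] M p zero    = λ _ _ → refl
prodTo-cong[] M p (suc d) = T.*-cong (prodTo-cong[] M p d) (p d)
  where module T = CommutativeRing (PS-truncRing M)

limit : ∀ {a b : PS} → (∀ M → a ≋[ M ] b) → a ≋ b
limit p n = p n n ℕₚ.≤-refl

Π-cong : ∀ {g h} → (∀ v → g v ≋ h v) → Π g ≋ Π h
Π-cong p n = prodTo-cong p n n

Π-· : ∀ {g h} → Tame g → Tame h → Π (λ v → g v · h v) ≋ Π g · Π h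
Π-· {g} {h} tg th = limit λ M → let module T = CommutativeRing (PS-truncRing M) in
  T.trans (Π-approx tgh {M} ℕₚ.≤-refl) (T.trans (λ n _ → prodTo-· g h M n)
    (T.*-cong (T.sym (Π-approx tg {M} ℕₚ.≤-refl)) (T.sym (Π-approx th {M} ℕₚ.≤-refl))))
  where
  tgh : Tame (λ v → g v · h v)
  tgh v = T.trans (T.*-cong (tg v) (th v)) (T.*-identityʳ S.1#)
    where module T = CommutativeRing (PS-truncRing v)

-- Factors are grouped by their index modulo d + 1. Modulo q^(M+1) it suffices to regroup the first
-- M (d + 1) of them.
Π-dissect : ∀ {g} → Tame g → ∀ d → Π g ≋ prodTo (λ r → Π (λ v → g (r ℕ.+ v ℕ.* suc d))) (suc d)
Π-dissect {g} tame d = limit λ M → let module T = CommutativeRing (PS-truncRing M) in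
  T.trans (Π-approx tame (ℕₚ.m≤m*n M (suc d)))
  (T.trans (λ n _ → S.trans (S.sym (prodTo-blocks g (suc d) M)) (prodTo-swap (λ v r → g (r ℕ.+ v ℕ.* suc d)) M (suc d)) n)
  (prodTo-cong[] M (λ r → T.sym (Π-approx (tame-block r) {M} ℕₚ.≤-refl)) (suc d)))
  where
  tame-block : ∀ r → Tame (λ v → g (r ℕ.+ v ℕ.* suc d))
  tame-block r v n n≤v = tame (r ℕ.+ v ℕ.* suc d) n (ℕₚ.≤-trans n≤v (ℕₚ.≤-trans (ℕₚ.m≤m*n v (suc d)) (ℕₚ.m≤n+m _ r)))

-- (-ε q^c ; q^s)_∞
poch : ℚ → ℕ → ℕ → PS
poch ε c s = Π (λ v → fac ε (c ℕ.+ s ℕ.* v))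

fac-tame : ∀ ε c s → Tame (λ v → fac ε (suc c ℕ.+ suc s ℕ.* v))
fac-tame ε c s v n n≤v = trans (cong (S.1# n +_) (trans (const-· ε (qpow (suc c ℕ.+ suc s ℕ.* v)) n)
  (trans (cong (ε *_) (qpow-low (s≤s (ℕₚ.≤-trans n≤v (ℕₚ.≤-trans (ℕₚ.m≤m+n v (s ℕ.* v)) (ℕₚ.m≤n+m _ c)))))) (ℚₚ.*-zeroʳ ε)))) (ℚₚ.+-identityʳ _)

fac-cong : ∀ ε {e e′} → e ≡ e′ → fac ε e ≋ fac ε e′
fac-cong ε refl = S.refl

poch-dissect : ∀ ε c s d → poch ε (suc c) (suc s) ≋ prodTo (λ r → poch ε (suc c ℕ.+ suc s ℕ.* r) (suc s ℕ.* suc d)) (suc d)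
poch-dissect ε c s d = S.trans (Π-dissect (fac-tame ε c s) d) (prodTo-cong (λ r → Π-cong (λ v → fac-cong ε
  (solve 5 (λ c s r v d → c :+ s :* (r :+ v :* d) := c :+ s :* r :+ s :* d :* v) refl (suc c) (suc s) r v (suc d)))) (suc d))
  where open ℕSolver

const-neg1 : ∀ a → const (- 1ℚ) · a ≋ S.- a
const-neg1 a n = trans (const-· (- 1ℚ) a n) (solve 1 (λ x → con (- 1ℚ) :* x := :- x) refl (a n))
  where open ℚSolver

const-1 : ∀ a → const 1ℚ · a ≋ a
const-1 a n = trans (const-· 1ℚ a n) (ℚₚ.*-identityˡ (a n))

fac⁻ : ∀ e → fac (- 1ℚ) e ≋ S.1# S.- qpow e
fac⁻ e = S.+-congˡ {S.1#} (const-neg1 (qpow e))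

fac⁺ : ∀ e → fac 1ℚ e ≋ S.1# S.+ qpow e
fac⁺ e = S.+-congˡ {S.1#} (const-1 (qpow e))

fac-square : ∀ e → fac (- 1ℚ) e · fac 1ℚ e ≋ fac (- 1ℚ) (e ℕ.+ e)
fac-square e = begin
  fac (- 1ℚ) e · fac 1ℚ e            ≈⟨ S.*-cong (fac⁻ e) (fac⁺ e) ⟩
  (S.1# S.- q) · (S.1# S.+ q)        ≈⟨ solve 1 (λ q → (num 1 :- q) :* (num 1 :+ q) := num 1 :- q :* q) S.refl q ⟩
  S.1# S.- q · q                     ≈⟨ S.+-congˡ {S.1#} (S.-‿cong (qpow-+ e e)) ⟩
  S.1# S.- qpow (e ℕ.+ e)            ≈⟨ fac⁻ (e ℕ.+ e) ⟨
  fac (- 1ℚ) (e ℕ.+ e)               ∎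
  where
  open ≋-Reasoning
  open PSolver
  q = qpow e

poch-square : ∀ c s → poch (- 1ℚ) (suc c) (suc s) · poch 1ℚ (suc c) (suc s) ≋ poch (- 1ℚ) (suc c ℕ.+ suc c) (suc s ℕ.+ suc s)
poch-square c s = S.trans (S.sym (Π-· (fac-tame (- 1ℚ) c s) (fac-tame 1ℚ c s)))
  (Π-cong (λ v → S.trans (fac-square (suc c ℕ.+ suc s ℕ.* v)) (fac-cong (- 1ℚ)
    (solve 3 (λ c s v → (c :+ s :* v) :+ (c :+ s :* v) := c :+ c :+ (s :+ s) :* v) refl (suc c) (suc s) v))))
  where open ℕSolver

qPoch-poch : ∀ m → qPoch (suc m) ≋ poch (- 1ℚ) (suc m) (suc m)
qPoch-poch m n = go n n
  where
  go : ∀ N → finProd (suc m) N ≋ prodTo (λ v → fac (- 1ℚ) (suc m ℕ.+ suc m ℕ.* v)) N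
  go zero    = one≋1
  go (suc N) = S.trans (λ n → sym (·-def (finProd (suc m) N) (one ⊖ qpow (suc m ℕ.* suc N)) n))
    (S.*-cong (go N) (S.trans (λ n → cong (_+ - qpow (suc m ℕ.* suc N) n) (one≋1 n))
      (S.trans (S.sym (fac⁻ (suc m ℕ.* suc N))) (fac-cong (- 1ℚ) (ℕₚ.*-suc (suc m) N)))))

qfac-∞-poch : ∀ s → QBinomial.qfac-∞ s ≋ poch (- 1ℚ) (suc s) (suc s)
qfac-∞-poch s = Π-cong (λ v → S.trans (S.sym (fac⁻ (suc s ℕ.* suc v))) (fac-cong (- 1ℚ) (ℕₚ.*-suc (suc s) v)))

θ-product : ∀ {ε} → ε * ε ≡ 1ℚ → ∀ a b → let s = suc a ℕ.+ suc b in
  θ ε (suc a) (suc b) ≋ poch (- 1ℚ) s s · (poch ε (suc a) s · poch ε (suc b) s)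
θ-product {ε} ε² a b = limit λ M → let module T = CommutativeRing (PS-truncRing M) ; M≤ = ℕₚ.≤-trans (ℕₚ.m≤m+n M M) (ℕₚ.m≤n+m _ 2) in
  T.trans (jacobi-triple a (suc b) ε² {M} ℕₚ.≤-refl)
  (T.*-cong (λ n _ → qfac-∞-poch (a ℕ.+ suc b) n) (T.*-cong (T.sym (Π-approx (fac-tame ε a (a ℕ.+ suc b)) M≤)) (T.sym (Π-approx (fac-tame ε b (a ℕ.+ suc b)) M≤))))

-- For b = 0 the product begins with the factor 1 + q^0 = 2, which is not tame. It is split off, and
-- the remaining factors are those of the other product.
θ-product₀ : ∀ a → θ 1ℚ (suc a) 0 ≋ (S.1# S.+ S.1#) · (poch (- 1ℚ) (suc a) (suc a) · (poch 1ℚ (suc a) (suc a) · poch 1ℚ (suc a) (suc a)))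
θ-product₀ a = limit λ M → let module T = CommutativeRing (PS-truncRing M) ; L = 2 ℕ.+ (M ℕ.+ M) ; M≤ = ℕₚ.≤-trans (ℕₚ.m≤m+n M M) (ℕₚ.m≤n+m (M ℕ.+ M) 1)  in
  T.trans (jacobi-triple a 0 {1ℚ} refl {M} ℕₚ.≤-refl)
  (T.trans (T.*-cong {x = QBinomial.qfac-∞ (a ℕ.+ 0)} (λ n _ → S.trans (qfac-∞-poch (a ℕ.+ 0)) (S.reflexive (cong (λ t → poch (- 1ℚ) (suc t) (suc t)) (ℕₚ.+-identityʳ a))) n)
    (T.*-cong
      (T.trans (T.sym (Π-approx (fac-tame 1ℚ a (a ℕ.+ 0)) (ℕₚ.m≤n⇒m≤1+n M≤))) (λ n _ → S.reflexive (cong (λ t → poch 1ℚ (suc a) (suc t)) (ℕₚ.+-identityʳ a)) n))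
      (T.trans (λ n _ → prodTo-head (λ v → fac 1ℚ (suc (a ℕ.+ 0) ℕ.* v)) (suc (M ℕ.+ M)) n)
        (T.*-cong (λ n _ → first n)
          (T.trans (λ n _ → prodTo-cong (λ v → fac-cong 1ℚ (trans (ℕₚ.*-suc (suc (a ℕ.+ 0)) v) (cong (λ t → suc t ℕ.+ suc t ℕ.* v) (ℕₚ.+-identityʳ a)))) (suc (M ℕ.+ M)) n)
            (T.sym (Π-approx (fac-tame 1ℚ a a) M≤)))))))
    (λ n _ → solve 3 (λ e p t → e :* (p :* (t :* p)) := t :* (e :* (p :* p))) S.refl (poch (- 1ℚ) (suc a) (suc a)) (poch 1ℚ (suc a) (suc a)) (S.1# S.+ S.1#) n))
  where
  open PSolver
  prodTo-head : ∀ g N → prodTo g (suc N) ≋ g 0 · prodTo (g ∘ suc) N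
  prodTo-head g zero    = solve 1 (λ x → num 1 :* x := x :* num 1) S.refl (g 0)
  prodTo-head g (suc N) = S.trans (S.*-congʳ (prodTo-head g N)) (S.*-assoc (g 0) _ (g (suc N)))
  first : fac 1ℚ (suc (a ℕ.+ 0) ℕ.* 0) ≋ S.1# S.+ S.1#
  first = S.trans (fac⁺ _) (S.+-congˡ {S.1#} (S.trans (S.reflexive (cong qpow (ℕₚ.*-zeroʳ (suc (a ℕ.+ 0))))) qpow-0))

-- Products of two theta functions

halve-ℕ : ∀ n → (∃ λ k → n ≡ k ℕ.+ k) ⊎ (∃ λ k → n ≡ suc (k ℕ.+ k))
halve-ℕ zero    = inj₁ (0 , refl)
halve-ℕ (suc n) with halve-ℕ n
... | inj₁ (k , refl) = inj₂ (k , refl)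
... | inj₂ (k , refl) = inj₁ (suc k , cong suc (sym (ℕₚ.+-suc k k)))

-- Odd integers are written -(2s + 1): with this sign the exponents of the odd parts below are again
-- of the form `W` with natural coefficients, up to a constant.
halve : ∀ m → (∃ λ s → m ≡ s ℤ.+ s) ⊎ (∃ λ s → m ≡ ℤ.- (s ℤ.+ s ℤ.+ ℤ.+ 1))
halve (ℤ.+ n) with halve-ℕ n
... | inj₁ (k , refl) = inj₁ (ℤ.+ k , refl)
... | inj₂ (k , refl) = inj₂ (-[1+ k ] , refl)
halve -[1+ n ] with halve-ℕ n
... | inj₁ (k , refl) = inj₂ (ℤ.+ k , cong (λ x → ℤ.- (ℤ.+ x)) (ℕₚ.+-comm 1 (k ℕ.+ k)))
... | inj₂ (k , refl) = inj₁ (-[1+ k ] , refl)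

s+s≢1 : ∀ s → ¬ s ℤ.+ s ≡ ℤ.+ 1
s+s≢1 (ℤ.+ suc zero)    ()
s+s≢1 (ℤ.+ suc (suc k)) ()

double-injective : ∀ {s t} → s ℤ.+ s ≡ t ℤ.+ t → s ≡ t
double-injective {s} {t} eq = ℤₚ.*-cancelʳ-≡ s t (ℤ.+ 2) (trans (twofold s) (trans eq (sym (twofold t))))
  where
  open ℤSolver
  twofold : ∀ s → s ℤ.* ℤ.+ 2 ≡ s ℤ.+ s
  twofold s = solve 1 (λ s → s :* num 2 := s :+ s) refl s

-- The pairs (m , n) by parity of m + n: either m + n = 2s and m - n = 2t, or m + n = -(2s + 1) and
-- n - m = 2t + 1. In s and t the quadratic forms below become diagonal.
evens odds : ℤ × ℤ → ℤ × ℤ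
evens (s , t) = s ℤ.+ t , s ℤ.- t
odds  (s , t) = ℤ.- s ℤ.- t ℤ.- ℤ.+ 1 , t ℤ.- s

lattice-partition : Partition evens odds
lattice-partition = record
  { injective₁ = λ {(s , t)} {(s′ , t′)} eq → inj₁-lemma s t s′ t′ (cong proj₁ eq) (cong proj₂ eq)
  ; injective₂ = λ {(s , t)} {(s′ , t′)} eq → inj₂-lemma s t s′ t′ (cong proj₁ eq) (cong proj₂ eq)
  ; disjoint   = λ (s , t) (s′ , t′) eq → disjoint-lemma s t s′ t′ (cong proj₁ eq) (cong proj₂ eq)
  ; cover      = λ (m , n) → cover-lemma m n (halve (m ℤ.+ n)) }
  where
  open ℤSolver
  inj₁-lemma : ∀ s t s′ t′ → s ℤ.+ t ≡ s′ ℤ.+ t′ → s ℤ.- t ≡ s′ ℤ.- t′ → (s , t) ≡ (s′ , t′)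
  inj₁-lemma s t s′ t′ p q = cong₂ _,_
    (double-injective (trans (sum s t) (trans (cong₂ ℤ._+_ p q) (sym (sum s′ t′)))))
    (double-injective (trans (diff s t) (trans (cong₂ ℤ._-_ p q) (sym (diff s′ t′)))))
    where
    sum : ∀ s t → s ℤ.+ s ≡ (s ℤ.+ t) ℤ.+ (s ℤ.- t)
    sum s t = solve 2 (λ s t → s :+ s := (s :+ t) :+ (s :- t)) refl s t
    diff : ∀ s t → t ℤ.+ t ≡ (s ℤ.+ t) ℤ.- (s ℤ.- t)
    diff s t = solve 2 (λ s t → t :+ t := (s :+ t) :- (s :- t)) refl s t
  inj₂-lemma : ∀ s t s′ t′ → ℤ.- s ℤ.- t ℤ.- ℤ.+ 1 ≡ ℤ.- s′ ℤ.- t′ ℤ.- ℤ.+ 1 → t ℤ.- s ≡ t′ ℤ.- s′ → (s , t) ≡ (s′ , t′)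
  inj₂-lemma s t s′ t′ p q = cong₂ _,_
    (double-injective (trans (sum s t) (trans (cong₂ (λ x y → ℤ.- (x ℤ.+ y ℤ.+ ℤ.+ 1)) p q) (sym (sum s′ t′)))))
    (double-injective (trans (diff s t) (trans (cong₂ (λ x y → y ℤ.- x ℤ.- ℤ.+ 1) p q) (sym (diff s′ t′)))))
    where
    sum : ∀ s t → s ℤ.+ s ≡ ℤ.- ((ℤ.- s ℤ.- t ℤ.- ℤ.+ 1) ℤ.+ (t ℤ.- s) ℤ.+ ℤ.+ 1)
    sum s t = solve 2 (λ s t → s :+ s := :- ((:- s :- t :- num 1) :+ (t :- s) :+ num 1)) refl s t
    diff : ∀ s t → t ℤ.+ t ≡ (t ℤ.- s) ℤ.- (ℤ.- s ℤ.- t ℤ.- ℤ.+ 1) ℤ.- ℤ.+ 1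
    diff s t = solve 2 (λ s t → t :+ t := (t :- s) :- (:- s :- t :- num 1) :- num 1) refl s t
  disjoint-lemma : ∀ s t s′ t′ → s ℤ.+ t ≡ ℤ.- s′ ℤ.- t′ ℤ.- ℤ.+ 1 → ¬ s ℤ.- t ≡ t′ ℤ.- s′
  disjoint-lemma s t s′ t′ p q = s+s≢1 (ℤ.- s ℤ.- s′) (trans
    (solve 4 (λ s t s′ t′ → (:- s :- s′) :+ (:- s :- s′) := :- ((s :+ t) :+ (s :- t)) :- s′ :- s′) refl s t s′ t′)
    (trans (cong₂ (λ x y → ℤ.- (x ℤ.+ y) ℤ.- s′ ℤ.- s′) p q)
    (solve 2 (λ s′ t′ → :- ((:- s′ :- t′ :- num 1) :+ (t′ :- s′)) :- s′ :- s′ := num 1) refl s′ t′)))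
  cover-lemma : ∀ m n → (∃ λ s → m ℤ.+ n ≡ s ℤ.+ s) ⊎ (∃ λ s → m ℤ.+ n ≡ ℤ.- (s ℤ.+ s ℤ.+ ℤ.+ 1)) →
                (∃ λ i → (m , n) ≡ evens i) ⊎ (∃ λ j → (m , n) ≡ odds j)
  cover-lemma m n (inj₁ (s , eq)) = inj₁ ((s , m ℤ.- s) , cong₂ _,_
    (solve 2 (λ m s → m := s :+ (m :- s)) refl m s)
    (trans (solve 2 (λ m n → n := (m :+ n) :- m) refl m n) (trans (cong (ℤ._- m) eq) (solve 2 (λ m s → (s :+ s) :- m := s :- (m :- s)) refl m s))))
  cover-lemma m n (inj₂ (s , eq)) = inj₂ ((s , n ℤ.+ s) , cong₂ _,_
    (trans (solve 2 (λ m n → m := (m :+ n) :- n) refl m n) (trans (cong (ℤ._- n) eq)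
      (solve 2 (λ n s → (:- (s :+ s :+ num 1)) :- n := :- s :- (n :+ s) :- num 1) refl n s)))
    (solve 2 (λ n s → n := (n :+ s) :- s) refl n s))

module _ {ε : ℚ} (ε² : ε * ε ≡ 1ℚ) where
  private
    cancel² : ∀ x → x ≡ ε * (ε * x)
    cancel² x = sym (trans (sym (ℚₚ.*-assoc ε ε x)) (trans (cong (_* x) ε²) (ℚₚ.*-identityˡ x)))

  ^ᶻ-suc : ∀ m → ε ^ᶻ (ℤ.+ 1 ℤ.+ m) ≡ ε * ε ^ᶻ m
  ^ᶻ-suc (ℤ.+ n)        = refl
  ^ᶻ-suc -[1+ zero ]    = cancel² 1ℚ
  ^ᶻ-suc -[1+ suc n ]   = cancel² (ε ^ᶻ -[1+ n ])

  ^ᶻ-pred : ∀ m → ε ^ᶻ (-[1+ 0 ] ℤ.+ m) ≡ ε * ε ^ᶻ m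
  ^ᶻ-pred m = trans (cancel² _) (cong (ε *_) (trans (sym (^ᶻ-suc (-[1+ 0 ] ℤ.+ m)))
    (cong (ε ^ᶻ_) (solve 1 (λ m → num 1 :+ (con -[1+ 0 ] :+ m) := m) refl m))))
    where open ℤSolver

  ^ᶻ-homo : ∀ m n → ε ^ᶻ (m ℤ.+ n) ≡ ε ^ᶻ m * ε ^ᶻ n
  ^ᶻ-homo (ℤ.+ zero) n = trans (cong (ε ^ᶻ_) (ℤₚ.+-identityˡ n)) (sym (ℚₚ.*-identityˡ _))
  ^ᶻ-homo (ℤ.+ suc k) n = trans (cong (ε ^ᶻ_) (ℤₚ.+-assoc (ℤ.+ 1) (ℤ.+ k) n)) (trans (^ᶻ-suc (ℤ.+ k ℤ.+ n))
    (trans (cong (ε *_) (^ᶻ-homo (ℤ.+ k) n)) (sym (ℚₚ.*-assoc ε (ε ^ᶻ (ℤ.+ k)) (ε ^ᶻ n)))))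
  ^ᶻ-homo -[1+ zero ] n = trans (^ᶻ-pred n) (cong (_* ε ^ᶻ n) (sym (ℚₚ.*-identityʳ ε)))
  ^ᶻ-homo -[1+ suc k ] n = trans (cong (ε ^ᶻ_) (ℤₚ.+-assoc -[1+ 0 ] -[1+ k ] n)) (trans (^ᶻ-pred (-[1+ k ] ℤ.+ n))
    (trans (cong (ε *_) (^ᶻ-homo -[1+ k ] n)) (sym (ℚₚ.*-assoc ε (ε ^ᶻ -[1+ k ]) (ε ^ᶻ n)))))

  ^ᶻ-sq : ∀ m → ε ^ᶻ (m ℤ.+ m) ≡ 1ℚ
  ^ᶻ-sq m = trans (^ᶻ-homo m m) (go ∣ m ∣)
    where
    go : ∀ n → ε ^ᶻ (ℤ.+ n) * ε ^ᶻ (ℤ.+ n) ≡ 1ℚ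
    go zero    = refl
    go (suc n) = trans (solve 2 (λ e x → (e :* x) :* (e :* x) := (e :* e) :* (x :* x)) refl ε (ε ^ᶻ (ℤ.+ n)))
      (trans (cong₂ _*_ ε² (go n)) refl)
      where open ℚSolver

  sign-evens : ∀ s t → ε ^ᶻ (s ℤ.+ t) * ε ^ᶻ (s ℤ.- t) ≡ 1ℚ
  sign-evens s t = trans (sym (^ᶻ-homo (s ℤ.+ t) (s ℤ.- t))) (trans (cong (ε ^ᶻ_) (solve 2 (λ s t → (s :+ t) :+ (s :- t) := s :+ s) refl s t)) (^ᶻ-sq s))
    where open ℤSolver

  sign-odds : ∀ s t → ε ^ᶻ (ℤ.- s ℤ.- t ℤ.- ℤ.+ 1) * ε ^ᶻ (t ℤ.- s) ≡ ε
  sign-odds s t = trans (sym (^ᶻ-homo (ℤ.- s ℤ.- t ℤ.- ℤ.+ 1) (t ℤ.- s)))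
    (trans (cong (ε ^ᶻ_) (solve 2 (λ s t → (:- s :- t :- num 1) :+ (t :- s) := con -[1+ 0 ] :+ (:- s :+ :- s)) refl s t))
    (trans (^ᶻ-pred (ℤ.- s ℤ.+ ℤ.- s)) (trans (cong (ε *_) (^ᶻ-sq (ℤ.- s))) (ℚₚ.*-identityʳ ε))))
    where open ℤSolver

1^ᶻ : ∀ m → 1ℚ ^ᶻ m ≡ 1ℚ
1^ᶻ m = go ∣ m ∣
  where
  go : ∀ n → 1ℚ ^ᶻ (ℤ.+ n) ≡ 1ℚ
  go zero    = refl
  go (suc n) = trans (ℚₚ.*-identityˡ _) (go n)

term-1 : ∀ a b m → term 1ℚ a b m ≋ qpow (W a b m)
term-1 a b m n = trans (const-· (1ℚ ^ᶻ m) (qpow (W a b m)) n) (trans (cong (_* qpow (W a b m) n) (1^ᶻ m)) (ℚₚ.*-identityˡ _))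

-- The double series Σ ε^(m+n) q^(…) is split according to the parity of m + n.
θ-split : ∀ {ε} → ε * ε ≡ 1ℚ → ∀ a b c d a₀ b₀ c₀ d₀ e a₁ b₁ c₁ d₁ →
  (∀ s t → 2W (suc a) b (s ℤ.+ t) ℤ.+ 2W (suc c) d (s ℤ.- t) ≡ 2W (suc a₀) b₀ s ℤ.+ 2W (suc c₀) d₀ t) →
  (∀ s t → 2W (suc a) b (ℤ.- s ℤ.- t ℤ.- ℤ.+ 1) ℤ.+ 2W (suc c) d (t ℤ.- s) ≡ ℤ.+ e ℤ.* ℤ.+ 2 ℤ.+ (2W (suc a₁) b₁ s ℤ.+ 2W (suc c₁) d₁ t)) →
  θ ε (suc a) b · θ ε (suc c) d ≋
    θ 1ℚ (suc a₀) b₀ · θ 1ℚ (suc c₀) d₀ S.+ const ε · qpow e · (θ 1ℚ (suc a₁) b₁ · θ 1ℚ (suc c₁) d₁)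
θ-split {ε} ε² a b c d a₀ b₀ c₀ d₀ e a₁ b₁ c₁ d₁ even odd = PSum-unique
  (PSum-× (PSum-θ ε a b) (PSum-θ ε c d))
  (λ n → HasSum-split lattice-partition
    (PSum-cong {_≟_ = ≡-dec ℤ._≟_ ℤ._≟_} (λ (s , t) → S.sym (even-term s t)) S.refl (PSum-× (PSum-θ 1ℚ a₀ b₀) (PSum-θ 1ℚ c₀ d₀)) n)
    (PSum-cong {_≟_ = ≡-dec ℤ._≟_ ℤ._≟_} (λ (s , t) → S.sym (odd-term s t)) S.refl
      (PSum-· (const ε · qpow e) (PSum-× (PSum-θ 1ℚ a₁ b₁) (PSum-θ 1ℚ c₁ d₁))) n))
  where
  open ≋-Reasoning
  open PSolver
  product : ∀ x y m n → (const x · qpow m) · (const y · qpow n) ≋ const (x * y) · qpow (m ℕ.+ n)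
  product x y m n = S.trans (solve 4 (λ x y m n → (x :* m) :* (y :* n) := (x :* y) :* (m :* n)) S.refl (const x) (const y) (qpow m) (qpow n))
    (S.*-cong (const-* x y) (qpow-+ m n))
  even-term : ∀ s t → term ε (suc a) b (s ℤ.+ t) · term ε (suc c) d (s ℤ.- t) ≋ term 1ℚ (suc a₀) b₀ s · term 1ℚ (suc c₀) d₀ t
  even-term s t = begin
    term ε (suc a) b (s ℤ.+ t) · term ε (suc c) d (s ℤ.- t)
      ≈⟨ product (ε ^ᶻ (s ℤ.+ t)) (ε ^ᶻ (s ℤ.- t)) (W (suc a) b (s ℤ.+ t)) (W (suc c) d (s ℤ.- t)) ⟩
    const (ε ^ᶻ (s ℤ.+ t) * ε ^ᶻ (s ℤ.- t)) · qpow (W (suc a) b (s ℤ.+ t) ℕ.+ W (suc c) d (s ℤ.- t))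
      ≈⟨ S.*-cong (S.reflexive (cong const (sign-evens ε² s t))) (S.reflexive (cong qpow (Twice-injective
          (Twice-+ (Twice-W (suc a) b (s ℤ.+ t)) (Twice-W (suc c) d (s ℤ.- t))) (Twice-+ (Twice-W (suc a₀) b₀ s) (Twice-W (suc c₀) d₀ t)) (even s t)))) ⟩
    const 1ℚ · qpow (W (suc a₀) b₀ s ℕ.+ W (suc c₀) d₀ t)
      ≈⟨ S.trans (const-1 _) (S.sym (qpow-+ (W (suc a₀) b₀ s) (W (suc c₀) d₀ t))) ⟩
    qpow (W (suc a₀) b₀ s) · qpow (W (suc c₀) d₀ t)
      ≈⟨ S.*-cong (term-1 (suc a₀) b₀ s) (term-1 (suc c₀) d₀ t) ⟨
    term 1ℚ (suc a₀) b₀ s · term 1ℚ (suc c₀) d₀ t ∎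
  odd-term : ∀ s t → term ε (suc a) b (ℤ.- s ℤ.- t ℤ.- ℤ.+ 1) · term ε (suc c) d (t ℤ.- s) ≋ const ε · qpow e · (term 1ℚ (suc a₁) b₁ s · term 1ℚ (suc c₁) d₁ t)
  odd-term s t = begin
    term ε (suc a) b (ℤ.- s ℤ.- t ℤ.- ℤ.+ 1) · term ε (suc c) d (t ℤ.- s)
      ≈⟨ product (ε ^ᶻ (ℤ.- s ℤ.- t ℤ.- ℤ.+ 1)) (ε ^ᶻ (t ℤ.- s)) (W (suc a) b (ℤ.- s ℤ.- t ℤ.- ℤ.+ 1)) (W (suc c) d (t ℤ.- s)) ⟩
    const (ε ^ᶻ (ℤ.- s ℤ.- t ℤ.- ℤ.+ 1) * ε ^ᶻ (t ℤ.- s)) · qpow (W (suc a) b (ℤ.- s ℤ.- t ℤ.- ℤ.+ 1) ℕ.+ W (suc c) d (t ℤ.- s))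
      ≈⟨ S.*-cong (S.reflexive (cong const (sign-odds ε² s t))) (S.reflexive (cong qpow (Twice-injective
          (Twice-+ (Twice-W (suc a) b (ℤ.- s ℤ.- t ℤ.- ℤ.+ 1)) (Twice-W (suc c) d (t ℤ.- s)))
          (Twice-+ (Twice-id e) (Twice-+ (Twice-W (suc a₁) b₁ s) (Twice-W (suc c₁) d₁ t))) (odd s t)))) ⟩
    const ε · qpow (e ℕ.+ (u ℕ.+ v))
      ≈⟨ S.*-congˡ {const ε} (S.trans (S.sym (qpow-+ e (u ℕ.+ v))) (S.*-congˡ {qpow e} (S.sym (qpow-+ u v)))) ⟩
    const ε · (qpow e · (qpow u · qpow v))
      ≈⟨ S.*-assoc (const ε) (qpow e) _ ⟨
    const ε · qpow e · (qpow u · qpow v)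
      ≈⟨ S.*-congˡ {const ε · qpow e} (S.*-cong (term-1 (suc a₁) b₁ s) (term-1 (suc c₁) d₁ t)) ⟨
    const ε · qpow e · (term 1ℚ (suc a₁) b₁ s · term 1ℚ (suc c₁) d₁ t) ∎
    where
    u = W (suc a₁) b₁ s ; v = W (suc c₁) d₁ t

private
  -- The f(q^a, q^b) with a + b = 12 and a, b even that arise by splitting base q^6. In Ramanujan's
  -- notation X is φ(q^6) and Y is 2ψ(q^12).
  X = θ 1ℚ 6 6 ; Y = θ 1ℚ 12 0 ; U = θ 1ℚ 8 4 ; V = θ 1ℚ 10 2

module _ where
  private
    open ℤSolver
    odd₁ odd₂ : ∀ {n} → Polynomial n → Polynomial n → Polynomial n
    odd₁ s t = :- s :- t :- num 1
    odd₂ s t = t :- s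

  -- Only the odd part carries the sign ε, so one computation serves both ε = 1 and ε = -1. This
  -- pairing is what permits the later elimination of X, Y, U and V.
  θε51² : ∀ {ε} → ε * ε ≡ 1ℚ → θ ε 5 1 · θ ε 5 1 ≋ V · X S.+ const ε · qpow 1 · (U · Y)
  θε51² ε² = θ-split ε² 4 1 4 1 9 2 5 6 1 7 4 11 0
    (solve 2 (λ s t → wt 5 1 (s :+ t) :+ wt 5 1 (s :- t) := wt 10 2 s :+ wt 6 6 t) refl)
    (solve 2 (λ s t → wt 5 1 (odd₁ s t) :+ wt 5 1 (odd₂ s t) := num 1 :* num 2 :+ (wt 8 4 s :+ wt 12 0 t)) refl)

  θε42² : ∀ {ε} → ε * ε ≡ 1ℚ → θ ε 4 2 · θ ε 4 2 ≋ U · X S.+ const ε · qpow 2 · (V · Y)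
  θε42² ε² = θ-split ε² 3 2 3 2 7 4 5 6 2 9 2 11 0
    (solve 2 (λ s t → wt 4 2 (s :+ t) :+ wt 4 2 (s :- t) := wt 8 4 s :+ wt 6 6 t) refl)
    (solve 2 (λ s t → wt 4 2 (odd₁ s t) :+ wt 4 2 (odd₂ s t) := num 2 :* num 2 :+ (wt 10 2 s :+ wt 12 0 t)) refl)

  θε33² : ∀ {ε} → ε * ε ≡ 1ℚ → θ ε 3 3 · θ ε 3 3 ≋ X · X S.+ const ε · qpow 3 · (Y · Y)
  θε33² ε² = θ-split ε² 2 3 2 3 5 6 5 6 3 11 0 11 0
    (solve 2 (λ s t → wt 3 3 (s :+ t) :+ wt 3 3 (s :- t) := wt 6 6 s :+ wt 6 6 t) refl)
    (solve 2 (λ s t → wt 3 3 (odd₁ s t) :+ wt 3 3 (odd₂ s t) := num 3 :* num 2 :+ (wt 12 0 s :+ wt 12 0 t)) refl)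

  θε51θε33 : ∀ {ε} → ε * ε ≡ 1ℚ → θ ε 5 1 · θ ε 3 3 ≋ U · U S.+ const ε · qpow 1 · (V · V)
  θε51θε33 ε² = θ-split ε² 4 1 2 3 7 4 7 4 1 9 2 9 2
    (solve 2 (λ s t → wt 5 1 (s :+ t) :+ wt 3 3 (s :- t) := wt 8 4 s :+ wt 8 4 t) refl)
    (solve 2 (λ s t → wt 5 1 (odd₁ s t) :+ wt 3 3 (odd₂ s t) := num 1 :* num 2 :+ (wt 10 2 s :+ wt 10 2 t)) refl)

  θ60² : θ 1ℚ 6 0 · θ 1ℚ 6 0 ≋ Y · X S.+ const 1ℚ · qpow 0 · (X · Y)
  θ60² = θ-split {1ℚ} refl 5 0 5 0 11 0 5 6 0 5 6 11 0
    (solve 2 (λ s t → wt 6 0 (s :+ t) :+ wt 6 0 (s :- t) := wt 12 0 s :+ wt 6 6 t) refl)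
    (solve 2 (λ s t → wt 6 0 (odd₁ s t) :+ wt 6 0 (odd₂ s t) := num 0 :* num 2 :+ (wt 6 6 s :+ wt 12 0 t)) refl)

  θ60θ42 : θ 1ℚ 6 0 · θ 1ℚ 4 2 ≋ V · U S.+ const 1ℚ · qpow 0 · (U · V)
  θ60θ42 = θ-split {1ℚ} refl 5 0 3 2 9 2 7 4 0 7 4 9 2
    (solve 2 (λ s t → wt 6 0 (s :+ t) :+ wt 4 2 (s :- t) := wt 10 2 s :+ wt 8 4 t) refl)
    (solve 2 (λ s t → wt 6 0 (odd₁ s t) :+ wt 4 2 (odd₂ s t) := num 0 :* num 2 :+ (wt 8 4 s :+ wt 10 2 t)) refl)

-- Monomials in invertible series

Unit-resp : ∀ {a b} → a ≋ b → Unit a → Unit b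
Unit-resp p u = trans (sym (p 0)) u

Unit-inv : ∀ {a} → Unit (inv a)
Unit-inv = refl

Unit-^ : ∀ {a} n → Unit a → Unit (a ^ n)
Unit-^ zero    u = refl
Unit-^ {a} (suc n) u = Unit-· {a} {a ^ n} u (Unit-^ n u)

zpow : PS → ℤ → PS
zpow g (ℤ.+ n)  = g ^ n
zpow g -[1+ n ] = inv g ^ suc n

Unit-zpow : ∀ {g} e → Unit g → Unit (zpow g e)
Unit-zpow (ℤ.+ n)  u = Unit-^ n u
Unit-zpow {g} -[1+ n ] u = Unit-^ (suc n) (Unit-inv {g})

zpow-⊟ : ∀ {g} → Unit g → ∀ m n → zpow g (m ⊟ n) ≋ g ^ m · inv g ^ n
zpow-⊟ {g} u m zero = S.sym (S.*-identityʳ (g ^ m))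
zpow-⊟ {g} u zero (suc n) = S.sym (S.*-identityˡ (inv g ^ suc n))
zpow-⊟ {g} u (suc m) (suc n) = S.trans (S.reflexive (cong (zpow g) (ℤₚ.[1+m]⊖[1+n]≡m⊖n m n))) (S.trans (zpow-⊟ u m n) (S.sym (begin
  g · g ^ m · (inv g · inv g ^ n)    ≈⟨ solve 4 (λ a b c d → (a :* b) :* (c :* d) := (a :* c) :* (b :* d)) S.refl g (g ^ m) (inv g) (inv g ^ n) ⟩
  g · inv g · (g ^ m · inv g ^ n)    ≈⟨ S.*-congʳ (·-inverseʳ g u) ⟩
  S.1# · (g ^ m · inv g ^ n)         ≈⟨ S.*-identityˡ _ ⟩
  g ^ m · inv g ^ n                  ∎)))
  where
  open ≋-Reasoning
  open PSolver

zpow-+ : ∀ {g} → Unit g → ∀ d e → zpow g d · zpow g e ≋ zpow g (d ℤ.+ e)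
zpow-+ {g} u (ℤ.+ m) (ℤ.+ n)  = S.sym (^-homo-* g m n)
zpow-+ {g} u (ℤ.+ m) -[1+ n ] = S.sym (zpow-⊟ u m (suc n))
zpow-+ {g} u -[1+ m ] (ℤ.+ n) = S.trans (S.*-comm (inv g ^ suc m) (g ^ n)) (S.sym (zpow-⊟ u n (suc m)))
zpow-+ {g} u -[1+ m ] -[1+ n ] = S.trans (S.sym (^-homo-* (inv g) (suc m) (suc n))) (S.reflexive (cong (λ k → inv g ^ suc k) (ℕₚ.+-suc m n)))

opaque
  -- With closed exponent vectors, equality of two eta quotients is settled by computing with
  -- integers. Opacity prevents the products themselves from being compared.
  mono : ∀ {n} → Vec PS n → Vec ℤ n → PS
  mono []       []       = S.1#
  mono (g ∷ gs) (e ∷ es) = zpow g e · mono gs es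

  Unit-mono : ∀ {n} {gs : Vec PS n} → VecAll.All Unit gs → ∀ es → Unit (mono gs es)
  Unit-mono []       []       = refl
  Unit-mono {gs = g ∷ gs} (u ∷ us) (e ∷ es) = Unit-· {zpow g e} {mono gs es} (Unit-zpow {g} e u) (Unit-mono us es)

  mono-+ : ∀ {n} {gs : Vec PS n} → VecAll.All Unit gs → ∀ ds es → mono gs ds · mono gs es ≋ mono gs (Vec.zipWith ℤ._+_ ds es)
  mono-+ []       []       []       = S.*-identityˡ S.1#
  mono-+ {gs = g ∷ gs} (u ∷ us) (d ∷ ds) (e ∷ es) = S.trans
    (solve 4 (λ a b c d → (a :* b) :* (c :* d) := (a :* c) :* (b :* d)) S.refl (zpow g d) (mono gs ds) (zpow g e) (mono gs es))
    (S.*-cong (zpow-+ u d e) (mono-+ us ds es))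
    where open PSolver

  mono-0 : ∀ {n} (gs : Vec PS n) → mono gs (Vec.replicate n (ℤ.+ 0)) ≋ S.1#
  mono-0 []       = S.refl
  mono-0 (g ∷ gs) = S.trans (S.*-identityˡ _) (mono-0 gs)

  mono-single : ∀ {n} (g : PS) (gs : Vec PS n) → mono (g ∷ gs) (ℤ.+ 1 ∷ Vec.replicate n (ℤ.+ 0)) ≋ g
  mono-single g gs = S.trans (S.*-cong (S.*-identityʳ g) (mono-0 gs)) (S.*-identityʳ g)

  mono-skip : ∀ {n} (g : PS) (gs : Vec PS n) es → mono (g ∷ gs) (ℤ.+ 0 ∷ es) ≋ mono gs es
  mono-skip g gs es = S.*-identityˡ _

pow-^ : ∀ a n → pow a n ≋ a ^ n
pow-^ a zero    = one≋1
pow-^ a (suc n) = S.trans (λ i → sym (·-def a (pow a n) i)) (S.*-congˡ {a} (pow-^ a n))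

module Monomials {n} {gs : Vec PS n} (us : VecAll.All Unit gs) where
  infix 4 _≈m_
  _≈m_ : PS → Vec ℤ n → Set
  a ≈m es = a ≋ mono gs es

  scale : ℕ → Vec ℤ n → Vec ℤ n
  scale zero    es = Vec.replicate n (ℤ.+ 0)
  scale (suc k) es = Vec.zipWith ℤ._+_ es (scale k es)

  infixl 7 _·m_
  _·m_ : ∀ {a b d e} → a ≈m d → b ≈m e → a · b ≈m Vec.zipWith ℤ._+_ d e
  _·m_ {d = d} {e} p q = S.trans (S.*-cong p q) (mono-+ us d e)

  ^m : ∀ {a e} k → a ≈m e → a ^ k ≈m scale k e
  ^m zero    p = S.sym (mono-0 gs)
  ^m {a} {e} (suc k) p = _·m_ {a} {a ^ k} {e} {scale k e} p (^m {a} {e} k p)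

  invm : ∀ {a e} → a ≈m e → inv a ≈m Vec.map ℤ.-_ e
  invm {a} {e} p = unit-cancel {a} (Unit-resp (S.sym p) (Unit-mono us e)) (begin
    a · inv a                              ≈⟨ ·-inverseʳ a (Unit-resp (S.sym p) (Unit-mono us e)) ⟩
    S.1#                                   ≈⟨ mono-0 gs ⟨
    mono gs (Vec.replicate n (ℤ.+ 0))          ≈⟨ S.reflexive (cong (mono gs) (inverse e)) ⟨
    mono gs (Vec.zipWith ℤ._+_ e (Vec.map ℤ.-_ e)) ≈⟨ mono-+ us e (Vec.map ℤ.-_ e) ⟨
    mono gs e · mono gs (Vec.map ℤ.-_ e)       ≈⟨ S.*-congʳ p ⟨
    a · mono gs (Vec.map ℤ.-_ e)               ∎)
    where
    open ≋-Reasoning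
    inverse : ∀ {n} (e : Vec ℤ n) → Vec.zipWith ℤ._+_ e (Vec.map ℤ.-_ e) ≡ Vec.replicate n (ℤ.+ 0)
    inverse []       = refl
    inverse (x ∷ xs) = cong₂ _∷_ (ℤₚ.+-inverseʳ x) (inverse xs)

-- Eta quotients of level 12

module _ where
  open PSolver

  private
    P⁻ P⁺ : ℕ → ℕ → PS
    P⁻ = poch (- 1ℚ)
    P⁺ = poch 1ℚ

  -- The factors (q^c;q^6)_∞ paired as c, 6 - c, with (-q^c;q^6)_∞ marked by a plus. By the triple
  -- product, the theta functions of base q^6 are monomials in them, up to a factor 2.
  α α⁺ β β⁺ γ γ⁺ δ δ⁺ : PS
  α = P⁻ 1 6 · P⁻ 5 6
  α⁺ = P⁺ 1 6 · P⁺ 5 6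
  β = P⁻ 2 6 · P⁻ 4 6
  β⁺ = P⁺ 2 6 · P⁺ 4 6
  γ = P⁻ 3 6
  γ⁺ = P⁺ 3 6
  δ = P⁻ 6 6
  δ⁺ = P⁺ 6 6

  generators : Vec PS 6
  generators = α ∷ α⁺ ∷ β ∷ γ ∷ γ⁺ ∷ δ ∷ []

  generator-units : VecAll.All Unit generators
  generator-units = Unit-· {P⁻ 1 6} {P⁻ 5 6} refl refl ∷ Unit-· {P⁺ 1 6} {P⁺ 5 6} refl refl ∷ Unit-· {P⁻ 2 6} {P⁻ 4 6} refl refl ∷ refl ∷ refl ∷ refl ∷ []

  open Monomials generator-units public

  -- Exponents of α, α⁺, β, γ, γ⁺, δ; those of β⁺ and δ⁺ are eliminated by Euler's identities below.
  Exponent : Set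
  Exponent = Vec ℤ 6

  ⟨_,_,_,_,_,_⟩ : ℤ → ℤ → ℤ → ℤ → ℤ → ℤ → Exponent
  ⟨ a , b , c , d , e , f ⟩ = a ∷ b ∷ c ∷ d ∷ e ∷ f ∷ []

  0ᵉ : ℤ
  0ᵉ = ℤ.+ 0

  α-m : α ≈m ⟨ ℤ.+ 1 , 0ᵉ , 0ᵉ , 0ᵉ , 0ᵉ , 0ᵉ ⟩
  α-m = S.sym (mono-single α _)
  α⁺-m : α⁺ ≈m ⟨ 0ᵉ , ℤ.+ 1 , 0ᵉ , 0ᵉ , 0ᵉ , 0ᵉ ⟩
  α⁺-m = S.sym (S.trans (mono-skip α _ _) (mono-single α⁺ _))
  β-m : β ≈m ⟨ 0ᵉ , 0ᵉ , ℤ.+ 1 , 0ᵉ , 0ᵉ , 0ᵉ ⟩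
  β-m = S.sym (S.trans (mono-skip α _ _) (S.trans (mono-skip α⁺ _ _) (mono-single β _)))
  γ-m : γ ≈m ⟨ 0ᵉ , 0ᵉ , 0ᵉ , ℤ.+ 1 , 0ᵉ , 0ᵉ ⟩
  γ-m = S.sym (S.trans (mono-skip α _ _) (S.trans (mono-skip α⁺ _ _) (S.trans (mono-skip β _ _) (mono-single γ _))))
  γ⁺-m : γ⁺ ≈m ⟨ 0ᵉ , 0ᵉ , 0ᵉ , 0ᵉ , ℤ.+ 1 , 0ᵉ ⟩
  γ⁺-m = S.sym (S.trans (mono-skip α _ _) (S.trans (mono-skip α⁺ _ _) (S.trans (mono-skip β _ _) (S.trans (mono-skip γ _ _) (mono-single γ⁺ _)))))
  δ-m : δ ≈m ⟨ 0ᵉ , 0ᵉ , 0ᵉ , 0ᵉ , 0ᵉ , ℤ.+ 1 ⟩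
  δ-m = S.sym (S.trans (mono-skip α _ _) (S.trans (mono-skip α⁺ _ _) (S.trans (mono-skip β _ _) (S.trans (mono-skip γ _ _) (S.trans (mono-skip γ⁺ _ _) (mono-single δ _))))))

  private
    halved : ∀ {a b c} → a ≋ S.1# · b · c → a ≋ b · c
    halved {b = b} {c} e = S.trans e (S.*-congʳ (S.*-identityˡ b))
    trisected : ∀ {a b c d} → a ≋ S.1# · b · c · d → a ≋ b · c · d
    trisected {b = b} {c} {d} e = S.trans e (S.*-congʳ (S.*-congʳ (S.*-identityˡ b)))

    P⁻-12 : P⁻ 1 2 ≋ P⁻ 1 6 · P⁻ 3 6 · P⁻ 5 6
    P⁻-12 = trisected (poch-dissect (- 1ℚ) 0 1 2)
    P⁺-12 : P⁺ 1 2 ≋ P⁺ 1 6 · P⁺ 3 6 · P⁺ 5 6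
    P⁺-12 = trisected (poch-dissect 1ℚ 0 1 2)
    P⁻-22 : P⁻ 2 2 ≋ P⁻ 2 6 · P⁻ 4 6 · P⁻ 6 6
    P⁻-22 = trisected (poch-dissect (- 1ℚ) 1 1 2)
    P⁺-22 : P⁺ 2 2 ≋ P⁺ 2 6 · P⁺ 4 6 · P⁺ 6 6
    P⁺-22 = trisected (poch-dissect 1ℚ 1 1 2)
    P⁻-44 : P⁻ 4 4 ≋ P⁻ 2 2 · P⁺ 2 2
    P⁻-44 = S.sym (poch-square 1 1)
    P⁻-1212 : P⁻ 12 12 ≋ δ · δ⁺
    P⁻-1212 = S.sym (poch-square 5 5)

    fixpoint : ∀ {u x} → Unit u → u ≋ u · x → x ≋ S.1#
    fixpoint {u} {x} unit e = unit-cancel {u} unit (S.trans (S.sym e) (S.sym (S.*-identityʳ u)))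

  -- Euler: (q^3;q^6)_∞ (-q^3;q^3)_∞ = 1; then the same with q in place of q^3, after dividing by it.
  euler₃ : γ · γ⁺ · δ⁺ ≋ S.1#
  euler₃ = fixpoint {δ} refl (begin
    P⁻ 6 6                      ≈⟨ halved (poch-dissect (- 1ℚ) 5 5 1) ⟩
    P⁻ 6 12 · P⁻ 12 12           ≈⟨ S.*-cong (S.sym (poch-square 2 5)) P⁻-1212 ⟩
    γ · γ⁺ · (δ · δ⁺)          ≈⟨ solve 4 (λ c d e f → (c :* d) :* (e :* f) := e :* (c :* d :* f)) S.refl γ γ⁺ δ δ⁺ ⟩
    δ · (γ · γ⁺ · δ⁺)          ∎)
    where open ≋-Reasoning

  euler₁ : α · α⁺ · β⁺ ≋ S.1#
  euler₁ = begin
    α · α⁺ · β⁺                       ≈⟨ S.*-identityʳ _ ⟨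
    α · α⁺ · β⁺ · S.1#                ≈⟨ S.*-congˡ {α · α⁺ · β⁺} euler₃ ⟨
    α · α⁺ · β⁺ · (γ · γ⁺ · δ⁺)       ≈⟨ fixpoint {P⁻ 2 2} refl (begin
      P⁻ 2 2                           ≈⟨ halved (poch-dissect (- 1ℚ) 1 1 1) ⟩
      P⁻ 2 4 · P⁻ 4 4                   ≈⟨ S.*-cong (S.trans (S.sym (poch-square 0 1)) (S.*-cong P⁻-12 P⁺-12)) (S.trans P⁻-44 (S.*-congˡ {P⁻ 2 2} P⁺-22)) ⟩
      P⁻ 1 6 · P⁻ 3 6 · P⁻ 5 6 · (P⁺ 1 6 · P⁺ 3 6 · P⁺ 5 6) · (P⁻ 2 2 · (P⁺ 2 6 · P⁺ 4 6 · P⁺ 6 6))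
        ≈⟨ solve 10 (λ n1 n3 n5 p1 p3 p5 e p2 p4 p6 → n1 :* n3 :* n5 :* (p1 :* p3 :* p5) :* (e :* (p2 :* p4 :* p6))
             := e :* ((n1 :* n5) :* (p1 :* p5) :* (p2 :* p4) :* (n3 :* p3 :* p6))) S.refl
             (P⁻ 1 6) (P⁻ 3 6) (P⁻ 5 6) (P⁺ 1 6) (P⁺ 3 6) (P⁺ 5 6) (P⁻ 2 2) (P⁺ 2 6) (P⁺ 4 6) (P⁺ 6 6) ⟩
      P⁻ 2 2 · (α · α⁺ · β⁺ · (γ · γ⁺ · δ⁺)) ∎) ⟩
    S.1# ∎
    where open ≋-Reasoning

  private
    inverse-m : ∀ {u x e} → u ≈m e → u · x ≋ S.1# → x ≈m Vec.map ℤ.-_ e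
    inverse-m {u} {x} {e} um ux≋1 = S.trans (unit-cancel {u} unit (S.trans ux≋1 (S.sym (·-inverseʳ u unit)))) (invm {u} {e} um)
      where
      unit : Unit u
      unit = Unit-resp (S.sym um) (Unit-mono generator-units e)

  β⁺-m : β⁺ ≈m ⟨ -[1+ 0 ] , -[1+ 0 ] , 0ᵉ , 0ᵉ , 0ᵉ , 0ᵉ ⟩
  β⁺-m = inverse-m {α · α⁺} (α-m ·m α⁺-m) euler₁
  δ⁺-m : δ⁺ ≈m ⟨ 0ᵉ , 0ᵉ , 0ᵉ , -[1+ 0 ] , -[1+ 0 ] , 0ᵉ ⟩
  δ⁺-m = inverse-m {γ · γ⁺} (γ-m ·m γ⁺-m) euler₃

  E1-m : qPoch 1 ≈m ⟨ ℤ.+ 1 , 0ᵉ , ℤ.+ 1 , ℤ.+ 1 , 0ᵉ , ℤ.+ 1 ⟩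
  E1-m = S.trans (qPoch-poch 0) (S.trans (poch-dissect (- 1ℚ) 0 0 5) (S.trans
    (solve 6 (λ a b c d e f → num 1 :* a :* b :* c :* d :* e :* f := (a :* e) :* (b :* d) :* c :* f) S.refl (P⁻ 1 6) (P⁻ 2 6) (P⁻ 3 6) (P⁻ 4 6) (P⁻ 5 6) (P⁻ 6 6))
    (α-m ·m β-m ·m γ-m ·m δ-m)))
  E2-m : qPoch 2 ≈m ⟨ 0ᵉ , 0ᵉ , ℤ.+ 1 , 0ᵉ , 0ᵉ , ℤ.+ 1 ⟩
  E2-m = S.trans (qPoch-poch 1) (S.trans P⁻-22 (β-m ·m δ-m))
  E3-m : qPoch 3 ≈m ⟨ 0ᵉ , 0ᵉ , 0ᵉ , ℤ.+ 1 , 0ᵉ , ℤ.+ 1 ⟩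
  E3-m = S.trans (qPoch-poch 2) (S.trans (halved (poch-dissect (- 1ℚ) 2 2 1)) (γ-m ·m δ-m))
  P⁺-22-m : P⁺ 2 2 ≈m ⟨ -[1+ 0 ] , -[1+ 0 ] , 0ᵉ , -[1+ 0 ] , -[1+ 0 ] , 0ᵉ ⟩
  P⁺-22-m = S.trans P⁺-22 (β⁺-m ·m δ⁺-m)
  E4-m : qPoch 4 ≈m ⟨ -[1+ 0 ] , -[1+ 0 ] , ℤ.+ 1 , -[1+ 0 ] , -[1+ 0 ] , ℤ.+ 1 ⟩
  E4-m = S.trans (qPoch-poch 3) (S.trans P⁻-44 (S.trans P⁻-22 (β-m ·m δ-m) ·m P⁺-22-m))
  E6-m : qPoch 6 ≈m ⟨ 0ᵉ , 0ᵉ , 0ᵉ , 0ᵉ , 0ᵉ , ℤ.+ 1 ⟩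
  E6-m = S.trans (qPoch-poch 5) δ-m
  E12-m : qPoch 12 ≈m ⟨ 0ᵉ , 0ᵉ , 0ᵉ , -[1+ 0 ] , -[1+ 0 ] , ℤ.+ 1 ⟩
  E12-m = S.trans (qPoch-poch 11) (S.trans P⁻-1212 (δ-m ·m δ⁺-m))

  private
    rotate : ∀ a b c → a · (b · c) ≋ c · b · a
    rotate a b c = solve 3 (λ a b c → a :* (b :* c) := c :* b :* a) S.refl a b c

  -- The digit is the smaller exponent b in f(-q^a, -q^b) for A and f(q^a, q^b) for B, with a + b =
  -- 6. `φ` is Ramanujan's φ(q), but `ψ` is f(q^2, 1), that is 2ψ(q^2).
  A1 A2 A3 B0 B1 B2 B3 φ ψ : PS
  A1 = θ (- 1ℚ) 5 1
  A2 = θ (- 1ℚ) 4 2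
  A3 = θ (- 1ℚ) 3 3
  B0 = θ 1ℚ 6 0
  B1 = θ 1ℚ 5 1
  B2 = θ 1ℚ 4 2
  B3 = θ 1ℚ 3 3
  φ = θ 1ℚ 1 1
  ψ = θ 1ℚ 2 0

  A1-m : A1 ≈m ⟨ ℤ.+ 1 , 0ᵉ , 0ᵉ , 0ᵉ , 0ᵉ , ℤ.+ 1 ⟩
  A1-m = S.trans (θ-product {ε = - 1ℚ} refl 4 0) (S.trans (rotate (P⁻ 6 6) (P⁻ 5 6) (P⁻ 1 6)) (α-m ·m δ-m))
  A2-m : A2 ≈m ⟨ 0ᵉ , 0ᵉ , ℤ.+ 1 , 0ᵉ , 0ᵉ , ℤ.+ 1 ⟩
  A2-m = S.trans (θ-product {ε = - 1ℚ} refl 3 1) (S.trans (rotate (P⁻ 6 6) (P⁻ 4 6) (P⁻ 2 6)) (β-m ·m δ-m))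
  A3-m : A3 ≈m ⟨ 0ᵉ , 0ᵉ , 0ᵉ , ℤ.+ 2 , 0ᵉ , ℤ.+ 1 ⟩
  A3-m = S.trans (θ-product {ε = - 1ℚ} refl 2 2) (S.trans (rotate (P⁻ 6 6) (P⁻ 3 6) (P⁻ 3 6)) (γ-m ·m γ-m ·m δ-m))
  B1-m : B1 ≈m ⟨ 0ᵉ , ℤ.+ 1 , 0ᵉ , 0ᵉ , 0ᵉ , ℤ.+ 1 ⟩
  B1-m = S.trans (θ-product {ε = 1ℚ} refl 4 0) (S.trans (rotate (P⁻ 6 6) (P⁺ 5 6) (P⁺ 1 6)) (α⁺-m ·m δ-m))
  B2-m : B2 ≈m ⟨ -[1+ 0 ] , -[1+ 0 ] , 0ᵉ , 0ᵉ , 0ᵉ , ℤ.+ 1 ⟩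
  B2-m = S.trans (θ-product {ε = 1ℚ} refl 3 1) (S.trans (rotate (P⁻ 6 6) (P⁺ 4 6) (P⁺ 2 6)) (β⁺-m ·m δ-m))
  B3-m : B3 ≈m ⟨ 0ᵉ , 0ᵉ , 0ᵉ , 0ᵉ , ℤ.+ 2 , ℤ.+ 1 ⟩
  B3-m = S.trans (θ-product {ε = 1ℚ} refl 2 2) (S.trans (rotate (P⁻ 6 6) (P⁺ 3 6) (P⁺ 3 6)) (γ⁺-m ·m γ⁺-m ·m δ-m))
  φ-m : φ ≈m ⟨ 0ᵉ , ℤ.+ 2 , ℤ.+ 1 , 0ᵉ , ℤ.+ 2 , ℤ.+ 1 ⟩
  φ-m = S.trans (θ-product {ε = 1ℚ} refl 0 0) (S.trans (S.*-cong P⁻-22 (S.*-cong P⁺-12 P⁺-12))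
    (S.trans (solve 5 (λ e b a c d → e :* b :* ((a :* c :* d) :* (a :* c :* d)) := e :* b :* (a :* d) :* (a :* d) :* c :* c) S.refl β δ (P⁺ 1 6) (P⁺ 3 6) (P⁺ 5 6))
    (β-m ·m δ-m ·m α⁺-m ·m α⁺-m ·m γ⁺-m ·m γ⁺-m)))

  -- `B0` and `ψ` have constant term 2 and so cannot be monomials in series with constant term 1;
  -- these are their halves, Ramanujan's ψ(q^6) and ψ(q^2).
  b0 ψ₀ : PS
  b0 = δ · (δ⁺ · δ⁺)
  ψ₀ = P⁻ 2 2 · (P⁺ 2 2 · P⁺ 2 2)

  B0-double : B0 ≋ (S.1# S.+ S.1#) · b0
  B0-double = θ-product₀ 5
  ψ-double : ψ ≋ (S.1# S.+ S.1#) · ψ₀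
  ψ-double = θ-product₀ 1

  b0-m : b0 ≈m ⟨ 0ᵉ , 0ᵉ , 0ᵉ , -[1+ 1 ] , -[1+ 1 ] , ℤ.+ 1 ⟩
  b0-m = δ-m ·m (δ⁺-m ·m δ⁺-m)
  ψ₀-m : ψ₀ ≈m ⟨ -[1+ 1 ] , -[1+ 1 ] , ℤ.+ 1 , -[1+ 1 ] , -[1+ 1 ] , ℤ.+ 1 ⟩
  ψ₀-m = S.trans P⁻-22 (β-m ·m δ-m) ·m (P⁺-22-m ·m P⁺-22-m)

  q : PS
  q = qpow 1

  q² : qpow 2 ≋ q · q
  q² = S.sym (qpow-+ 1 1)

  q³ : qpow 3 ≋ q · q · q
  q³ = S.sym (S.trans (S.*-congʳ (qpow-+ 1 1)) (qpow-+ 2 1))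

  ⟦_⟧ : Exponent → PS
  ⟦ e ⟧ = mono generators e

  -- Quartic relations between theta functions of base q^6

  private
    minus : ∀ {a} b c d {e} → a ≋ b S.+ const (- 1ℚ) · c · d → c ≋ e → a ≋ b S.- e · d
    minus b c d h c≋e = S.trans h (S.+-congˡ {b} (S.trans (S.*-assoc (const (- 1ℚ)) c d) (S.trans (const-neg1 (c · d)) (S.-‿cong (S.*-congʳ c≋e)))))

    plus : ∀ {a} b c d {e} → a ≋ b S.+ const 1ℚ · c · d → c ≋ e → a ≋ b S.+ e · d
    plus b c d h c≋e = S.trans h (S.+-congˡ {b} (S.*-congʳ (S.trans (const-1 c) c≋e)))

    A1² : A1 · A1 ≋ V · X S.- q · (U · Y)
    A1² = minus (V · X) (q) (U · Y) (θε51² {ε = - 1ℚ} refl) S.refl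
    B1² : B1 · B1 ≋ V · X S.+ q · (U · Y)
    B1² = plus (V · X) (q) (U · Y) (θε51² {ε = 1ℚ} refl) S.refl
    A2² : A2 · A2 ≋ U · X S.- q · q · (V · Y)
    A2² = minus (U · X) (qpow 2) (V · Y) (θε42² {ε = - 1ℚ} refl) q²
    B2² : B2 · B2 ≋ U · X S.+ q · q · (V · Y)
    B2² = plus (U · X) (qpow 2) (V · Y) (θε42² {ε = 1ℚ} refl) q²
    A3² : A3 · A3 ≋ X · X S.- q · q · q · (Y · Y)
    A3² = minus (X · X) (qpow 3) (Y · Y) (θε33² {ε = - 1ℚ} refl) q³
    A1A3 : A1 · A3 ≋ U · U S.- q · (V · V)
    A1A3 = minus (U · U) (q) (V · V) (θε51θε33 {ε = - 1ℚ} refl) S.refl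
    B1B3 : B1 · B3 ≋ U · U S.+ q · (V · V)
    B1B3 = plus (U · U) (q) (V · V) (θε51θε33 {ε = 1ℚ} refl) S.refl

    halve-series : ∀ {a b} → (S.1# S.+ S.1#) · a ≋ (S.1# S.+ S.1#) · b → a ≋ b
    halve-series {a} {b} = Cancel.cancelˡ PS-ring (S.1# S.+ S.1#) (const ½) inverse
      where
      inverse : (S.1# S.+ S.1#) · const ½ ≋ S.1#
      inverse = S.trans (S.*-comm (S.1# S.+ S.1#) (const ½)) (S.trans (const-· ½ (S.1# S.+ S.1#)) λ { zero → refl ; (suc _) → refl })

    b0² : (S.1# S.+ S.1#) · (b0 · b0) ≋ X · Y
    b0² = halve-series (begin
      (S.1# S.+ S.1#) · ((S.1# S.+ S.1#) · (b0 · b0))     ≈⟨ solve 1 (λ b → 𝟚 :* (𝟚 :* (b :* b)) := (𝟚 :* b) :* (𝟚 :* b)) S.refl b0 ⟩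
      (S.1# S.+ S.1#) · b0 · ((S.1# S.+ S.1#) · b0)       ≈⟨ S.*-cong B0-double B0-double ⟨
      B0 · B0                                             ≈⟨ plus (Y · X) (qpow 0) (X · Y) θ60² qpow-0 ⟩
      Y · X S.+ S.1# · (X · Y)                            ≈⟨ solve 2 (λ X Y → Y :* X :+ num 1 :* (X :* Y) := 𝟚 :* (X :* Y)) S.refl X Y ⟩
      (S.1# S.+ S.1#) · (X · Y)                           ∎)
      where
      open ≋-Reasoning
      𝟚 : ∀ {n} → Polynomial n
      𝟚 = num 1 :+ num 1

    b0B2 : b0 · B2 ≋ U · V
    b0B2 = halve-series (begin
      (S.1# S.+ S.1#) · (b0 · B2)          ≈⟨ S.*-assoc (S.1# S.+ S.1#) b0 B2 ⟨
      (S.1# S.+ S.1#) · b0 · B2            ≈⟨ S.*-congʳ B0-double ⟨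
      B0 · B2                              ≈⟨ plus (V · U) (qpow 0) (U · V) θ60θ42 qpow-0 ⟩
      V · U S.+ S.1# · (U · V)             ≈⟨ solve 2 (λ U V → V :* U :+ num 1 :* (U :* V) := (num 1 :+ num 1) :* (U :* V)) S.refl U V ⟩
      (S.1# S.+ S.1#) · (U · V)            ∎)
      where open ≋-Reasoning

    2# 4# 8# : PS
    2# = S.1# S.+ S.1#
    4# = 2# S.+ 2#
    8# = 4# S.+ 4#
    ② ④ ⑧ : ∀ {n} → Polynomial n
    ② = num 1 :+ num 1
    ④ = ② :+ ②
    ⑧ = ④ :+ ④

    -- X, Y, U and V are eliminated: B1² A2² and A1² B2² differ only in the signs of their cross
    -- terms, whose sum is 2q X Y (U² - q V²), and both X Y and U² - q V² are products of theta
    -- functions of base q^6. The subscripts of the four relations hint at the multiples of `p` that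
    -- they produce.
    relation₄ : B1 · B1 · (A2 · A2) ≋ A1 · A1 · (B2 · B2) S.+ 4# · q · (b0 · b0 · (A1 · A3))
    relation₄ = begin
      B1 · B1 · (A2 · A2)
        ≈⟨ S.*-cong B1² A2² ⟩
      (V · X S.+ q · (U · Y)) · (U · X S.- q · q · (V · Y))
        ≈⟨ solve 5 (λ X Y U V q → (V :* X :+ q :* (U :* Y)) :* (U :* X :- q :* q :* (V :* Y)) :=
             (V :* X :- q :* (U :* Y)) :* (U :* X :+ q :* q :* (V :* Y)) :+ ② :* q :* ((X :* Y) :* (U :* U :- q :* (V :* V)))) S.refl X Y U V q ⟩
      (V · X S.- q · (U · Y)) · (U · X S.+ q · q · (V · Y)) S.+ 2# · q · (X · Y · (U · U S.- q · (V · V)))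
        ≈⟨ S.+-cong (S.*-cong A1² B2²) (S.*-congˡ {2# · q} (S.*-cong b0² A1A3)) ⟨
      A1 · A1 · (B2 · B2) S.+ 2# · q · (2# · (b0 · b0) · (A1 · A3))
        ≈⟨ solve 4 (λ r q b a → r :+ ② :* q :* (② :* b :* a) := r :+ ④ :* q :* (b :* a)) S.refl (A1 · A1 · (B2 · B2)) q (b0 · b0) (A1 · A3) ⟩
      A1 · A1 · (B2 · B2) S.+ 4# · q · (b0 · b0 · (A1 · A3)) ∎
      where open ≋-Reasoning

    relation₁ : A2 · A2 · (B2 · B2) S.+ q · (A1 · A1 · (B1 · B1)) ≋ A3 · A3 · (B1 · B3)
    relation₁ = begin
      A2 · A2 · (B2 · B2) S.+ q · (A1 · A1 · (B1 · B1))
        ≈⟨ S.+-cong (S.*-cong A2² B2²) (S.*-congˡ {q} (S.*-cong A1² B1²)) ⟩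
      (U · X S.- q · q · (V · Y)) · (U · X S.+ q · q · (V · Y)) S.+ q · ((V · X S.- q · (U · Y)) · (V · X S.+ q · (U · Y)))
        ≈⟨ solve 5 (λ X Y U V q → (U :* X :- q :* q :* (V :* Y)) :* (U :* X :+ q :* q :* (V :* Y)) :+ q :* ((V :* X :- q :* (U :* Y)) :* (V :* X :+ q :* (U :* Y))) :=
             (X :* X :- q :* q :* q :* (Y :* Y)) :* (U :* U :+ q :* (V :* V))) S.refl X Y U V q ⟩
      (X · X S.- q · q · q · (Y · Y)) · (U · U S.+ q · (V · V))
        ≈⟨ S.*-cong A3² B1B3 ⟨
      A3 · A3 · (B1 · B3) ∎
      where open ≋-Reasoning

    relation₂ : A1 · A1 · (B1 · B3) S.+ B1 · B1 · (A1 · A3) ≋ 2# · (b0 · B2 · (A2 · A2))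
    relation₂ = begin
      A1 · A1 · (B1 · B3) S.+ B1 · B1 · (A1 · A3)
        ≈⟨ S.+-cong (S.*-cong A1² B1B3) (S.*-cong B1² A1A3) ⟩
      (V · X S.- q · (U · Y)) · (U · U S.+ q · (V · V)) S.+ (V · X S.+ q · (U · Y)) · (U · U S.- q · (V · V))
        ≈⟨ solve 5 (λ X Y U V q → (V :* X :- q :* (U :* Y)) :* (U :* U :+ q :* (V :* V)) :+ (V :* X :+ q :* (U :* Y)) :* (U :* U :- q :* (V :* V)) :=
             ② :* ((U :* V) :* (U :* X :- q :* q :* (V :* Y)))) S.refl X Y U V q ⟩
      2# · (U · V · (U · X S.- q · q · (V · Y)))
        ≈⟨ S.*-congˡ {2#} (S.*-cong b0B2 A2²) ⟨
      2# · (b0 · B2 · (A2 · A2)) ∎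
      where open ≋-Reasoning

    relation₋ : B1 · B1 · (B1 · B1) ≋ A1 · A1 · (A1 · A1) S.+ 8# · q · (b0 · b0 · (b0 · B2))
    relation₋ = begin
      B1 · B1 · (B1 · B1)
        ≈⟨ S.*-cong B1² B1² ⟩
      (V · X S.+ q · (U · Y)) · (V · X S.+ q · (U · Y))
        ≈⟨ solve 5 (λ X Y U V q → (V :* X :+ q :* (U :* Y)) :* (V :* X :+ q :* (U :* Y)) :=
             (V :* X :- q :* (U :* Y)) :* (V :* X :- q :* (U :* Y)) :+ ④ :* q :* ((X :* Y) :* (U :* V))) S.refl X Y U V q ⟩
      (V · X S.- q · (U · Y)) · (V · X S.- q · (U · Y)) S.+ 4# · q · (X · Y · (U · V))
        ≈⟨ S.+-cong (S.*-cong A1² A1²) (S.*-congˡ {4# · q} (S.*-cong b0² b0B2)) ⟨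
      A1 · A1 · (A1 · A1) S.+ 4# · q · (2# · (b0 · b0) · (b0 · B2))
        ≈⟨ solve 4 (λ r q b a → r :+ ④ :* q :* (② :* b :* a) := r :+ ⑧ :* q :* (b :* a)) S.refl (A1 · A1 · (A1 · A1)) q (b0 · b0) (b0 · B2) ⟩
      A1 · A1 · (A1 · A1) S.+ 8# · q · (b0 · b0 · (b0 · B2)) ∎
      where open ≋-Reasoning

  infixl 7 _⊞_
  _⊞_ : Exponent → Exponent → Exponent
  _⊞_ = Vec.zipWith ℤ._+_

  -- p = q E₂³ E₃³ E₁₂⁶ / (E₁ E₄² E₆⁹), where Eₘ = (q^m;q^m)_∞, is a Hauptmodul of Γ₀(12).
  p-e 1+p-e 1+2p-e 1+4p-e 1-2p-e : Exponent
  p-e    = ⟨ ℤ.+ 1 , ℤ.+ 2 , ℤ.+ 0 , -[1+ 1 ] , -[1+ 3 ] , ℤ.+ 0 ⟩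
  1+p-e  = ⟨ -[1+ 2 ] , -[1+ 1 ] , ℤ.+ 2 , -[1+ 1 ] , -[1+ 3 ] , ℤ.+ 0 ⟩
  1+2p-e = ⟨ -[1+ 0 ] , ℤ.+ 1 , ℤ.+ 0 , ℤ.+ 2 , -[1+ 1 ] , ℤ.+ 0 ⟩
  1+4p-e = ⟨ ℤ.+ 0 , ℤ.+ 4 , ℤ.+ 2 , ℤ.+ 0 , ℤ.+ 0 , ℤ.+ 0 ⟩
  1-2p-e = ⟨ ℤ.+ 3 , ℤ.+ 1 , ℤ.+ 2 , ℤ.+ 2 , -[1+ 1 ] , ℤ.+ 0 ⟩

  p : PS
  p = q · ⟦ p-e ⟧

  private
    -- Multiplying relation₄, relation₁, … by the monomial z₄, z₁, … makes it linear in p and the monomials below.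
    z₄ z₁ z₂ z₋ : Exponent
    z₄ = ⟨ ℤ.+ 0 , ℤ.+ 2 , ℤ.+ 0 , ℤ.+ 0 , ℤ.+ 0 , -[1+ 3 ] ⟩
    z₁ = ⟨ -[1+ 0 ] , ℤ.+ 0 , ℤ.+ 0 , -[1+ 1 ] , -[1+ 3 ] , -[1+ 3 ] ⟩
    z₂ = ⟨ -[1+ 1 ] , -[1+ 0 ] , ℤ.+ 0 , ℤ.+ 0 , -[1+ 1 ] , -[1+ 3 ] ⟩
    z₋ = ⟨ -[1+ 0 ] , ℤ.+ 1 , ℤ.+ 2 , ℤ.+ 2 , -[1+ 1 ] , -[1+ 3 ] ⟩

    1-m : ⟦ Vec.replicate 6 (ℤ.+ 0) ⟧ ≋ S.1#
    1-m = mono-0 generators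

  1+4p : ⟦ 1+4p-e ⟧ ≋ S.1# S.+ 4# · p
  1+4p = begin
    ⟦ 1+4p-e ⟧
      ≈⟨ S.sym (S.refl {⟦ z₄ ⟧} ·m ((B1-m ·m B1-m) ·m (A2-m ·m A2-m))) ⟩
    ⟦ z₄ ⟧ · (B1 · B1 · (A2 · A2))
      ≈⟨ S.*-congˡ {⟦ z₄ ⟧} relation₄ ⟩
    ⟦ z₄ ⟧ · (A1 · A1 · (B2 · B2) S.+ 4# · q · (b0 · b0 · (A1 · A3)))
      ≈⟨ solve 5 (λ z a f q b → z :* (a :+ f :* q :* b) := z :* a :+ f :* (q :* (z :* b))) S.refl ⟦ z₄ ⟧ (A1 · A1 · (B2 · B2)) 4# q (b0 · b0 · (A1 · A3)) ⟩
    ⟦ z₄ ⟧ · (A1 · A1 · (B2 · B2)) S.+ 4# · (q · (⟦ z₄ ⟧ · (b0 · b0 · (A1 · A3))))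
      -- `z₄` is the inverse of A1² B2², so that this term becomes 1; likewise `z₂` below inverts
      -- A1² B1 B3.
      ≈⟨ S.+-cong (S.trans (S.refl {⟦ z₄ ⟧} ·m ((A1-m ·m A1-m) ·m (B2-m ·m B2-m))) 1-m)
          (S.*-congˡ {4#} (S.*-congˡ {q} (S.refl {⟦ z₄ ⟧} ·m ((b0-m ·m b0-m) ·m (A1-m ·m A3-m))))) ⟩
    S.1# S.+ 4# · p ∎
    where open ≋-Reasoning

  private
    -- Neither this relation nor `2+2p` alone identifies the two monomials. Calling them a and b,
    -- the equations a + p = b and 1 + b = 2a together force a = 1 + p and b = 1 + 2p.
    1+p+p : ⟦ 1+p-e ⟧ S.+ p ≋ ⟦ 1+2p-e ⟧
    1+p+p = begin
      ⟦ 1+p-e ⟧ S.+ p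
        ≈⟨ S.+-cong (S.refl {⟦ z₁ ⟧} ·m ((A2-m ·m A2-m) ·m (B2-m ·m B2-m))) (S.*-congˡ {q} (S.refl {⟦ z₁ ⟧} ·m ((A1-m ·m A1-m) ·m (B1-m ·m B1-m)))) ⟨
      ⟦ z₁ ⟧ · (A2 · A2 · (B2 · B2)) S.+ q · (⟦ z₁ ⟧ · (A1 · A1 · (B1 · B1)))
        ≈⟨ solve 4 (λ z a q b → z :* a :+ q :* (z :* b) := z :* (a :+ q :* b)) S.refl ⟦ z₁ ⟧ (A2 · A2 · (B2 · B2)) q (A1 · A1 · (B1 · B1)) ⟩
      ⟦ z₁ ⟧ · (A2 · A2 · (B2 · B2) S.+ q · (A1 · A1 · (B1 · B1)))
        ≈⟨ S.*-congˡ {⟦ z₁ ⟧} relation₁ ⟩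
      ⟦ z₁ ⟧ · (A3 · A3 · (B1 · B3))
        ≈⟨ S.refl {⟦ z₁ ⟧} ·m ((A3-m ·m A3-m) ·m (B1-m ·m B3-m)) ⟩
      ⟦ 1+2p-e ⟧ ∎
      where open ≋-Reasoning

    2+2p : S.1# S.+ ⟦ 1+2p-e ⟧ ≋ 2# · ⟦ 1+p-e ⟧
    2+2p = begin
      S.1# S.+ ⟦ 1+2p-e ⟧
        ≈⟨ S.+-cong (S.sym (S.trans (S.refl {⟦ z₂ ⟧} ·m ((A1-m ·m A1-m) ·m (B1-m ·m B3-m))) 1-m)) (S.sym (S.refl {⟦ z₂ ⟧} ·m ((B1-m ·m B1-m) ·m (A1-m ·m A3-m)))) ⟩
      ⟦ z₂ ⟧ · (A1 · A1 · (B1 · B3)) S.+ ⟦ z₂ ⟧ · (B1 · B1 · (A1 · A3))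
        ≈⟨ S.distribˡ ⟦ z₂ ⟧ _ _ ⟨
      ⟦ z₂ ⟧ · (A1 · A1 · (B1 · B3) S.+ B1 · B1 · (A1 · A3))
        ≈⟨ S.*-congˡ {⟦ z₂ ⟧} relation₂ ⟩
      ⟦ z₂ ⟧ · (2# · (b0 · B2 · (A2 · A2)))
        ≈⟨ solve 3 (λ z t a → z :* (t :* a) := t :* (z :* a)) S.refl ⟦ z₂ ⟧ 2# (b0 · B2 · (A2 · A2)) ⟩
      2# · (⟦ z₂ ⟧ · (b0 · B2 · (A2 · A2)))
        ≈⟨ S.*-congˡ {2#} (S.refl {⟦ z₂ ⟧} ·m ((b0-m ·m B2-m) ·m (A2-m ·m A2-m))) ⟩
      2# · ⟦ 1+p-e ⟧ ∎
      where open ≋-Reasoning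

  1+p : ⟦ 1+p-e ⟧ ≋ S.1# S.+ p
  1+p = begin
    a                                  ≈⟨ solve 2 (λ a p → a := ② :* a :- (a :+ p) :+ p) S.refl a p ⟩
    2# · a S.- (a S.+ p) S.+ p         ≈⟨ S.+-congʳ {p} (S.+-cong (S.sym 2+2p) (S.-‿cong 1+p+p)) ⟩
    S.1# S.+ ⟦ 1+2p-e ⟧ S.- ⟦ 1+2p-e ⟧ S.+ p  ≈⟨ solve 2 (λ b p → num 1 :+ b :- b :+ p := num 1 :+ p) S.refl ⟦ 1+2p-e ⟧ p ⟩
    S.1# S.+ p                         ∎
    where
    open ≋-Reasoning
    a = ⟦ 1+p-e ⟧

  1+2p : ⟦ 1+2p-e ⟧ ≋ S.1# S.+ 2# · p
  1+2p = S.trans (S.sym 1+p+p) (S.trans (S.+-congʳ {p} 1+p) (solve 1 (λ p → num 1 :+ p :+ p := num 1 :+ ② :* p) S.refl p))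

  -- `relation₋` expresses (1 + 4p)(1 + 2p) as the monomial sought plus 8p (1 + p), and (1 + 4p)(1 +
  -- 2p) - 8p (1 + p) = 1 - 2p.
  1-2p : ⟦ 1-2p-e ⟧ ≋ S.1# S.- 2# · p
  1-2p = begin
    m
      ≈⟨ solve 3 (λ m p a → m := (m :+ ⑧ :* (p :* a)) :- ⑧ :* (p :* a)) S.refl m p ⟦ 1+p-e ⟧ ⟩
    m S.+ 8# · (p · ⟦ 1+p-e ⟧) S.- 8# · (p · ⟦ 1+p-e ⟧)
      ≈⟨ S.+-congʳ {S.- (8# · (p · ⟦ 1+p-e ⟧))} product ⟨
    ⟦ 1+4p-e ⟧ · ⟦ 1+2p-e ⟧ S.- 8# · (p · ⟦ 1+p-e ⟧)
      ≈⟨ S.+-cong (S.*-cong 1+4p 1+2p) (S.-‿cong (S.*-congˡ {8#} (S.*-congˡ {p} 1+p))) ⟩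
    (S.1# S.+ 4# · p) · (S.1# S.+ 2# · p) S.- 8# · (p · (S.1# S.+ p))
      ≈⟨ solve 1 (λ p → (num 1 :+ ④ :* p) :* (num 1 :+ ② :* p) :- ⑧ :* (p :* (num 1 :+ p)) := num 1 :- ② :* p) S.refl p ⟩
    S.1# S.- 2# · p ∎
    where
    open ≋-Reasoning
    m = ⟦ 1-2p-e ⟧
    product : ⟦ 1+4p-e ⟧ · ⟦ 1+2p-e ⟧ ≋ m S.+ 8# · (p · ⟦ 1+p-e ⟧)
    product = begin
      ⟦ 1+4p-e ⟧ · ⟦ 1+2p-e ⟧
        ≈⟨ S.trans (S.refl {⟦ 1+4p-e ⟧} ·m S.refl {⟦ 1+2p-e ⟧}) (S.sym (S.refl {⟦ z₋ ⟧} ·m ((B1-m ·m B1-m) ·m (B1-m ·m B1-m)))) ⟩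
      ⟦ z₋ ⟧ · (B1 · B1 · (B1 · B1))
        ≈⟨ S.*-congˡ {⟦ z₋ ⟧} relation₋ ⟩
      ⟦ z₋ ⟧ · (A1 · A1 · (A1 · A1) S.+ 8# · q · (b0 · b0 · (b0 · B2)))
        ≈⟨ solve 5 (λ z a f q b → z :* (a :+ f :* q :* b) := z :* a :+ f :* (q :* (z :* b))) S.refl ⟦ z₋ ⟧ (A1 · A1 · (A1 · A1)) 8# q (b0 · b0 · (b0 · B2)) ⟩
      ⟦ z₋ ⟧ · (A1 · A1 · (A1 · A1)) S.+ 8# · (q · (⟦ z₋ ⟧ · (b0 · b0 · (b0 · B2))))
        ≈⟨ S.+-cong (S.refl {⟦ z₋ ⟧} ·m ((A1-m ·m A1-m) ·m (A1-m ·m A1-m)))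
            (S.*-congˡ {8#} (S.*-congˡ {q} (S.refl {⟦ z₋ ⟧} ·m ((b0-m ·m b0-m) ·m (b0-m ·m B2-m))))) ⟩
      m S.+ 8# · (q · ⟦ p-e ⊞ 1+p-e ⟧)
        ≈⟨ S.+-congˡ {m} (S.*-congˡ {8#} (S.trans (S.*-congˡ {q} (S.sym (S.refl {⟦ p-e ⟧} ·m S.refl {⟦ 1+p-e ⟧}))) (S.sym (S.*-assoc q ⟦ p-e ⟧ ⟦ 1+p-e ⟧)))) ⟩
      m S.+ 8# · (p · ⟦ 1+p-e ⟧) ∎

  -- Both sides of the theorem as polynomials in p

  private
    powm : ∀ {a e} n → a ≈m e → pow a n ≈m scale n e
    powm {a} {e} n a≈e = S.trans (pow-^ a n) (^m {a} {e} n a≈e)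

    -- The common factor k³ / (E₁⁶ φ) of all terms, with k = φ(q^3)³ / φ.
    C₀-e : Exponent
    C₀-e = ⟨ -[1+ 5 ] , -[1+ 7 ] , -[1+ 9 ] , -[1+ 5 ] , ℤ.+ 10 , -[1+ 0 ] ⟩

    C₀ κ : PS
    C₀ = ⟦ C₀-e ⟧
    κ = const (ℤ.+ 1 / 9)

    lit : ℕ → PS
    lit k = fromℤ (ℤ.+ k)

    -- The solver has integer coefficients only. All rational coefficients are brought to the
    -- denominator 9, and `κ` = 1/9 remains an indeterminate.
    ninth : ∀ k {c} → (∀ n → (ℤ.+ 1 / 9) * lit k n ≡ const c n) → const c ≋ κ · lit k
    ninth k h = S.sym (S.trans (const-· (ℤ.+ 1 / 9) (lit k)) h)

    c4/9 : const (ℤ.+ 4 / 9) ≋ κ · lit 4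
    c4/9 = ninth 4 λ { zero → refl ; (suc _) → refl }
    c1/3 : const (ℤ.+ 1 / 3) ≋ κ · lit 3
    c1/3 = ninth 3 λ { zero → refl ; (suc _) → refl }
    c8/9 : const (ℤ.+ 8 / 9) ≋ κ · lit 8
    c8/9 = ninth 8 λ { zero → refl ; (suc _) → refl }
    c36 : const (ℤ.+ 36 / 1) ≋ κ · lit 324
    c36 = ninth 324 λ { zero → refl ; (suc _) → refl }
    c27 : const (ℤ.+ 27 / 1) ≋ κ · lit 243
    c27 = ninth 243 λ { zero → refl ; (suc _) → refl }
    c72 : const (ℤ.+ 72 / 1) ≋ κ · lit 648
    c72 = ninth 648 λ { zero → refl ; (suc _) → refl }
    κ9 : κ · lit 9 ≋ S.1#
    κ9 = S.trans (const-· (ℤ.+ 1 / 9) (lit 9)) λ { zero → refl ; (suc _) → refl }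

    r₁ r₂ r₄ r₋ : PS
    r₁ = S.1# S.+ p
    r₂ = S.1# S.+ lit 2 · p
    r₄ = S.1# S.+ lit 4 · p
    r₋ = S.1# S.- lit 2 · p

    1+p′ : ⟦ 1+p-e ⟧ ≋ r₁
    1+p′ = 1+p
    1+2p′ : ⟦ 1+2p-e ⟧ ≋ r₂
    1+2p′ = 1+2p
    1-2p′ : ⟦ 1-2p-e ⟧ ≋ r₋
    1-2p′ = 1-2p
    1+4p′ : ⟦ 1+4p-e ⟧ ≋ r₄
    -- `4#` is (1 + 1) + (1 + 1) while `lit 4` adds its ones one at a time, so the two must be
    -- reconciled; `lit 2` and `2#` coincide by computation.
    1+4p′ = S.trans 1+4p (solve 1 (λ p → num 1 :+ (num 1 :+ num 1 :+ (num 1 :+ num 1)) :* p := num 1 :+ num 4 :* p) S.refl p)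


    -- This and the next five quotients, divided by `C₀`, are monomials in `p` and its four
    -- companions. The power of `p` equals the explicit power of q; the other exponents are
    -- confirmed by comparing vectors.
    term₁ : pow (qPoch 1) 5 · pow (qPoch 4) 2 · inv (pow (qPoch 2) 5 · pow (qPoch 3) 3) ≋ C₀ · (r₋ ^ 4 · r₄ · r₁)
    term₁ = S.trans (powm 5 E1-m ·m powm 2 E4-m ·m invm {pow (qPoch 2) 5 · pow (qPoch 3) 3} (powm 5 E2-m ·m powm 3 E3-m))
      (S.trans (S.sym (S.refl {C₀} ·m (^m {⟦ 1-2p-e ⟧} 4 S.refl ·m S.refl {⟦ 1+4p-e ⟧} ·m S.refl {⟦ 1+p-e ⟧})))
        (S.*-congˡ {C₀} (S.*-cong (S.*-cong (^-congˡ 4 1-2p′) 1+4p′) 1+p′)))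

    term₂ : pow (qPoch 2) 4 · pow (qPoch 4) 2 · inv (pow (qPoch 1) 4 · pow (qPoch 6) 3) ≋ C₀ · (r₋ ^ 2 · r₄ ^ 2 · r₁ ^ 2)
    term₂ = S.trans (powm 4 E2-m ·m powm 2 E4-m ·m invm {pow (qPoch 1) 4 · pow (qPoch 6) 3} (powm 4 E1-m ·m powm 3 E6-m))
      (S.trans (S.sym (S.refl {C₀} ·m (^m {⟦ 1-2p-e ⟧} 2 S.refl ·m ^m {⟦ 1+4p-e ⟧} 2 S.refl ·m ^m {⟦ 1+p-e ⟧} 2 S.refl)))
        (S.*-congˡ {C₀} (S.*-cong (S.*-cong (^-congˡ 2 1-2p′) (^-congˡ 2 1+4p′)) (^-congˡ 2 1+p′))))

    term₃ : pow (qPoch 4) 11 · inv (pow (qPoch 1) 4 · pow (qPoch 2) 5 · pow (qPoch 12) 3) ≋ C₀ · (r₋ · r₄ · r₁ ^ 4)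
    term₃ = S.trans (powm 11 E4-m ·m invm {pow (qPoch 1) 4 · pow (qPoch 2) 5 · pow (qPoch 12) 3} (powm 4 E1-m ·m powm 5 E2-m ·m powm 3 E12-m))
      (S.trans (S.sym (S.refl {C₀} ·m (S.refl {⟦ 1-2p-e ⟧} ·m S.refl {⟦ 1+4p-e ⟧} ·m ^m {⟦ 1+p-e ⟧} 4 S.refl)))
        (S.*-congˡ {C₀} (S.*-cong (S.*-cong 1-2p′ 1+4p′) (^-congˡ 4 1+p′))))

    term₄ : q · (pow (qPoch 4) 2 · pow (qPoch 3) 9 · inv (pow (qPoch 1) 7 · pow (qPoch 2) 5)) ≋ C₀ · (p · r₂ ^ 4)
    term₄ = begin
      q · (pow (qPoch 4) 2 · pow (qPoch 3) 9 · inv (pow (qPoch 1) 7 · pow (qPoch 2) 5))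
        ≈⟨ S.*-congˡ {q} (S.trans (powm 2 E4-m ·m powm 9 E3-m ·m invm {pow (qPoch 1) 7 · pow (qPoch 2) 5} (powm 7 E1-m ·m powm 5 E2-m))
             (S.sym (S.refl {C₀} ·m (S.refl {⟦ p-e ⟧} ·m ^m {⟦ 1+2p-e ⟧} 4 S.refl)))) ⟩
      q · (C₀ · (⟦ p-e ⟧ · ⟦ 1+2p-e ⟧ ^ 4))
        ≈⟨ solve 4 (λ q C₀ m r → q :* (C₀ :* (m :* r)) := C₀ :* ((q :* m) :* r)) S.refl q C₀ ⟦ p-e ⟧ (⟦ 1+2p-e ⟧ ^ 4) ⟩
      C₀ · (p · ⟦ 1+2p-e ⟧ ^ 4)
        ≈⟨ S.*-congˡ {C₀} (S.*-congˡ {p} (^-congˡ 4 1+2p′)) ⟩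
      C₀ · (p · r₂ ^ 4) ∎
      where open ≋-Reasoning

    term₅ : qpow 2 · (pow (qPoch 4) 2 · pow (qPoch 6) 9 · inv (pow (qPoch 1) 4 · pow (qPoch 2) 8)) ≋ C₀ · (p ^ 2 · r₂ ^ 2)
    term₅ = begin
      qpow 2 · (pow (qPoch 4) 2 · pow (qPoch 6) 9 · inv (pow (qPoch 1) 4 · pow (qPoch 2) 8))
        ≈⟨ S.*-cong q² (S.trans (powm 2 E4-m ·m powm 9 E6-m ·m invm {pow (qPoch 1) 4 · pow (qPoch 2) 8} (powm 4 E1-m ·m powm 8 E2-m))
             (S.sym (S.refl {C₀} ·m (^m {⟦ p-e ⟧} 2 S.refl ·m ^m {⟦ 1+2p-e ⟧} 2 S.refl)))) ⟩
      q · q · (C₀ · (⟦ p-e ⟧ ^ 2 · ⟦ 1+2p-e ⟧ ^ 2))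
        ≈⟨ solve 4 (λ q C₀ m r → q :* q :* (C₀ :* (m :^ 2 :* r)) := C₀ :* ((q :* m) :^ 2 :* r)) S.refl q C₀ ⟦ p-e ⟧ (⟦ 1+2p-e ⟧ ^ 2) ⟩
      C₀ · (p ^ 2 · ⟦ 1+2p-e ⟧ ^ 2)
        ≈⟨ S.*-congˡ {C₀} (S.*-congˡ {p ^ 2} (^-congˡ 2 1+2p′)) ⟩
      C₀ · (p ^ 2 · r₂ ^ 2) ∎
      where open ≋-Reasoning

    term₆ : qpow 4 · (pow (qPoch 12) 9 · inv (pow (qPoch 1) 4 · pow (qPoch 2) 5 · qPoch 4)) ≋ C₀ · (p ^ 4 · r₂)
    term₆ = begin
      qpow 4 · (pow (qPoch 12) 9 · inv (pow (qPoch 1) 4 · pow (qPoch 2) 5 · qPoch 4))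
        ≈⟨ S.*-cong (S.trans (S.sym (qpow-+ 2 2)) (S.*-cong q² q²)) (S.trans (powm 9 E12-m ·m invm {pow (qPoch 1) 4 · pow (qPoch 2) 5 · qPoch 4} (powm 4 E1-m ·m powm 5 E2-m ·m E4-m))
             (S.sym (S.refl {C₀} ·m (^m {⟦ p-e ⟧} 4 S.refl ·m S.refl {⟦ 1+2p-e ⟧})))) ⟩
      q · q · (q · q) · (C₀ · (⟦ p-e ⟧ ^ 4 · ⟦ 1+2p-e ⟧))
        ≈⟨ solve 4 (λ q C₀ m r → q :* q :* (q :* q) :* (C₀ :* (m :^ 4 :* r)) := C₀ :* ((q :* m) :^ 4 :* r)) S.refl q C₀ ⟦ p-e ⟧ ⟦ 1+2p-e ⟧ ⟩
      C₀ · (p ^ 4 · ⟦ 1+2p-e ⟧)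
        ≈⟨ S.*-congˡ {C₀} (S.*-congˡ {p ^ 4} 1+2p′) ⟩
      C₀ · (p ^ 4 · r₂) ∎
      where open ≋-Reasoning

  -- a₂ is the theta series of A₂, q^(1/3) c₂ that of its nontrivial cosets, and a₅ that of A₅ ⊃ A₂ ⊕ A₂ ⊕ ⟨6⟩.
  a₂ c₂ a₅ : PS
  a₂ = φ · B3 S.+ q · (ψ · B0)
  c₂ = φ · B1 S.+ ψ · B2
  a₅ = B3 · (a₂ · a₂) S.+ q · (B1 · (c₂ · c₂)) S.+ q · (B1 · (c₂ · c₂))

  etaQuotients : PS
  etaQuotients =
    const (ℤ.+ 4 / 9) · pow (qPoch 1) 5 · pow (qPoch 4) 2 · inv (pow (qPoch 2) 5 · pow (qPoch 3) 3)
    S.- const (ℤ.+ 1 / 3) · pow (qPoch 2) 4 · pow (qPoch 4) 2 · inv (pow (qPoch 1) 4 · pow (qPoch 6) 3)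
    S.+ const (ℤ.+ 8 / 9) · pow (qPoch 4) 11 · inv (pow (qPoch 1) 4 · pow (qPoch 2) 5 · pow (qPoch 12) 3)
    S.+ const (ℤ.+ 36 / 1) · qpow 1 · pow (qPoch 4) 2 · pow (qPoch 3) 9 · inv (pow (qPoch 1) 7 · pow (qPoch 2) 5)
    S.+ const (ℤ.+ 27 / 1) · qpow 2 · pow (qPoch 4) 2 · pow (qPoch 6) 9 · inv (pow (qPoch 1) 4 · pow (qPoch 2) 8)
    S.+ const (ℤ.+ 72 / 1) · qpow 4 · pow (qPoch 12) 9 · inv (pow (qPoch 1) 4 · pow (qPoch 2) 5 · qPoch 4)

  private
    -- x = φ B1 / (1 + 4p)
    E1⁻⁶-e x-e : Exponent
    E1⁻⁶-e = ⟨ -[1+ 5 ] , ℤ.+ 0 , -[1+ 5 ] , -[1+ 5 ] , ℤ.+ 0 , -[1+ 5 ] ⟩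
    x-e = ⟨ ℤ.+ 0 , -[1+ 0 ] , -[1+ 0 ] , ℤ.+ 0 , ℤ.+ 2 , ℤ.+ 2 ⟩
    k-e : Exponent
    k-e = ⟨ ℤ.+ 0 , -[1+ 1 ] , -[1+ 0 ] , ℤ.+ 0 , ℤ.+ 4 , ℤ.+ 2 ⟩

    E1⁻⁶-m : inv (qPoch 1) ^ 6 ≈m E1⁻⁶-e
    E1⁻⁶-m = ^m 6 (invm {qPoch 1} E1-m)

    a₂-p : a₂ ≋ ⟦ k-e ⟧ · (r₄ S.+ lit 4 · p · r₁)
    a₂-p = begin
      φ · B3 S.+ q · (ψ · B0)
        ≈⟨ S.+-congˡ {φ · B3} (S.*-congˡ {q} (S.*-cong ψ-double B0-double)) ⟩
      φ · B3 S.+ q · ((S.1# S.+ S.1#) · ψ₀ · ((S.1# S.+ S.1#) · b0))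
        ≈⟨ solve 4 (λ a q b c → a :+ q :* (② :* b :* (② :* c)) := a :+ num 4 :* q :* (b :* c)) S.refl (φ · B3) q ψ₀ b0 ⟩
      φ · B3 S.+ lit 4 · q · (ψ₀ · b0)
        ≈⟨ S.+-cong (S.trans (φ-m ·m B3-m) (S.sym (S.refl {⟦ k-e ⟧} ·m S.refl {⟦ 1+4p-e ⟧})))
            (S.*-congˡ {lit 4 · q} (S.trans (ψ₀-m ·m b0-m) (S.sym (S.refl {⟦ k-e ⟧} ·m (S.refl {⟦ p-e ⟧} ·m S.refl {⟦ 1+p-e ⟧}))))) ⟩
      ⟦ k-e ⟧ · ⟦ 1+4p-e ⟧ S.+ lit 4 · q · (⟦ k-e ⟧ · (⟦ p-e ⟧ · ⟦ 1+p-e ⟧))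
        ≈⟨ solve 5 (λ k a q m b → k :* a :+ num 4 :* q :* (k :* (m :* b)) := k :* (a :+ num 4 :* (q :* m) :* b)) S.refl ⟦ k-e ⟧ ⟦ 1+4p-e ⟧ q ⟦ p-e ⟧ ⟦ 1+p-e ⟧ ⟩
      ⟦ k-e ⟧ · (⟦ 1+4p-e ⟧ S.+ lit 4 · p · ⟦ 1+p-e ⟧)
        ≈⟨ S.*-congˡ {⟦ k-e ⟧} (S.+-cong 1+4p′ (S.*-congˡ {lit 4 · p} 1+p′)) ⟩
      ⟦ k-e ⟧ · (r₄ S.+ lit 4 · p · r₁) ∎
      where
      open ≋-Reasoning

    -- As r₄ + 2 r₁ = 3 (1 + 2p), `c₂` is 3 (q^3;q^3)_∞³ / (q;q)_∞, the cubic theta function c of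
    -- the Borweins up to a power of q.
    c₂-p : c₂ ≋ ⟦ x-e ⟧ · (r₄ S.+ lit 2 · r₁)
    c₂-p = begin
      φ · B1 S.+ ψ · B2
        ≈⟨ S.+-congˡ {φ · B1} (S.trans (S.*-congʳ ψ-double) (S.*-assoc (lit 2) ψ₀ B2)) ⟩
      φ · B1 S.+ lit 2 · (ψ₀ · B2)
        ≈⟨ S.+-cong (S.trans (φ-m ·m B1-m) (S.sym (S.refl {⟦ x-e ⟧} ·m S.refl {⟦ 1+4p-e ⟧})))
            (S.*-congˡ {lit 2} (S.trans (ψ₀-m ·m B2-m) (S.sym (S.refl {⟦ x-e ⟧} ·m S.refl {⟦ 1+p-e ⟧})))) ⟩
      ⟦ x-e ⟧ · ⟦ 1+4p-e ⟧ S.+ lit 2 · (⟦ x-e ⟧ · ⟦ 1+p-e ⟧)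
        ≈⟨ solve 3 (λ k a b → k :* a :+ num 2 :* (k :* b) := k :* (a :+ num 2 :* b)) S.refl ⟦ x-e ⟧ ⟦ 1+4p-e ⟧ ⟦ 1+p-e ⟧ ⟩
      ⟦ x-e ⟧ · (⟦ 1+4p-e ⟧ S.+ lit 2 · ⟦ 1+p-e ⟧)
        ≈⟨ S.*-congˡ {⟦ x-e ⟧} (S.+-cong 1+4p′ (S.*-congˡ {lit 2} 1+p′)) ⟩
      ⟦ x-e ⟧ · (r₄ S.+ lit 2 · r₁) ∎
      where open ≋-Reasoning

    a₅-p : inv (qPoch 1) ^ 6 · a₅ ≋ C₀ · (r₄ · (r₄ S.+ lit 4 · p · r₁) ^ 2 S.+ lit 2 · p · r₄ · r₂ · (r₄ S.+ lit 2 · r₁) ^ 2)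
    a₅-p = begin
      E₁⁻⁶ · a₅
        ≈⟨ S.*-congˡ {E₁⁻⁶} (S.+-cong (S.+-cong (S.*-congˡ {B3} (S.*-cong a₂-p a₂-p)) second) second) ⟩
      E₁⁻⁶ · (B3 · (k · s · (k · s)) S.+ q · (B1 · (x · t · (x · t))) S.+ q · (B1 · (x · t · (x · t))))
        ≈⟨ solve 8 (λ E₁⁻⁶ B3 k s q B1 x t → E₁⁻⁶ :* (B3 :* (k :* s :* (k :* s)) :+ q :* (B1 :* (x :* t :* (x :* t))) :+ q :* (B1 :* (x :* t :* (x :* t))))
             := (E₁⁻⁶ :* B3 :* k :* k) :* s :^ 2 :+ num 2 :* (q :* (E₁⁻⁶ :* B1 :* x :* x)) :* t :^ 2) S.refl E₁⁻⁶ B3 k s q B1 x t ⟩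
      E₁⁻⁶ · B3 · k · k · s ^ 2 S.+ lit 2 · (q · (E₁⁻⁶ · B1 · x · x)) · t ^ 2
        ≈⟨ S.+-cong (S.*-congʳ (S.trans (E1⁻⁶-m ·m B3-m ·m S.refl {k} ·m S.refl {k}) (S.sym (S.refl {C₀} ·m S.refl {⟦ 1+4p-e ⟧}))))
            (S.*-congʳ (S.*-congˡ {lit 2} (S.*-congˡ {q} (S.trans (E1⁻⁶-m ·m B1-m ·m S.refl {x} ·m S.refl {x}) (S.sym (S.refl {C₀} ·m S.refl {⟦ p-e ⟧} ·m S.refl {⟦ 1+4p-e ⟧} ·m S.refl {⟦ 1+2p-e ⟧})))))) ⟩
      C₀ · ⟦ 1+4p-e ⟧ · s ^ 2 S.+ lit 2 · (q · (C₀ · ⟦ p-e ⟧ · ⟦ 1+4p-e ⟧ · ⟦ 1+2p-e ⟧)) · t ^ 2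
        ≈⟨ S.+-cong (S.*-congʳ (S.*-congˡ {C₀} 1+4p′)) (S.*-congʳ (S.*-congˡ {lit 2} (S.*-congˡ {q} (S.*-cong (S.*-congˡ {C₀ · ⟦ p-e ⟧} 1+4p′) 1+2p′)))) ⟩
      C₀ · r₄ · s ^ 2 S.+ lit 2 · (q · (C₀ · ⟦ p-e ⟧ · r₄ · r₂)) · t ^ 2
        ≈⟨ solve 7 (λ C₀ r₄ s q m r₂ t → C₀ :* r₄ :* s :^ 2 :+ num 2 :* (q :* (C₀ :* m :* r₄ :* r₂)) :* t :^ 2 := C₀ :* (r₄ :* s :^ 2 :+ num 2 :* (q :* m) :* r₄ :* r₂ :* t :^ 2)) S.refl C₀ r₄ s q ⟦ p-e ⟧ r₂ t ⟩
      C₀ · (r₄ · s ^ 2 S.+ lit 2 · p · r₄ · r₂ · t ^ 2) ∎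
      where
      open ≋-Reasoning
      E₁⁻⁶ = inv (qPoch 1) ^ 6 ; k = ⟦ k-e ⟧ ; x = ⟦ x-e ⟧
      s = r₄ S.+ lit 4 · p · r₁ ; t = r₄ S.+ lit 2 · r₁
      second : q · (B1 · (c₂ · c₂)) ≋ q · (B1 · (x · t · (x · t)))
      second = S.*-congˡ {q} (S.*-congˡ {B1} (S.*-cong c₂-p c₂-p))

  etaQuotients-a₅ : etaQuotients ≋ inv (qPoch 1) ^ 6 · a₅
  etaQuotients-a₅ = begin
    etaQuotients
      ≈⟨ S.+-cong (S.+-cong (S.+-cong (S.+-cong (S.+-cong
           (three (const (ℤ.+ 4 / 9)) _ _ _ c4/9 term₁) (S.-‿cong (three (const (ℤ.+ 1 / 3)) _ _ _ c1/3 term₂)))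
           (two (const (ℤ.+ 8 / 9)) _ _ c8/9 term₃)) (four (const (ℤ.+ 36 / 1)) q _ _ _ c36 term₄))
           (four (const (ℤ.+ 27 / 1)) (qpow 2) _ _ _ c27 term₅)) (three′ (const (ℤ.+ 72 / 1)) (qpow 4) _ _ c72 term₆) ⟩
    κ · lit 4 · (C₀ · (r₋ ^ 4 · r₄ · r₁)) S.- κ · lit 3 · (C₀ · (r₋ ^ 2 · r₄ ^ 2 · r₁ ^ 2)) S.+ κ · lit 8 · (C₀ · (r₋ · r₄ · r₁ ^ 4))
      S.+ κ · lit 324 · (C₀ · (p · r₂ ^ 4)) S.+ κ · lit 243 · (C₀ · (p ^ 2 · r₂ ^ 2)) S.+ κ · lit 648 · (C₀ · (p ^ 4 · r₂))
      -- The first three terms have degree 6 in p while the right side has degree 5: their leading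
      -- coefficients 256 - 192 - 64 cancel.
      ≈⟨ solve 3 (λ κ C₀ p → let r₁ = num 1 :+ p ; r₂ = num 1 :+ num 2 :* p ; r₄ = num 1 :+ num 4 :* p ; r₋ = num 1 :- num 2 :* p in
           κ :* num 4 :* (C₀ :* (r₋ :^ 4 :* r₄ :* r₁)) :- κ :* num 3 :* (C₀ :* (r₋ :^ 2 :* r₄ :^ 2 :* r₁ :^ 2)) :+ κ :* num 8 :* (C₀ :* (r₋ :* r₄ :* r₁ :^ 4))
             :+ κ :* num 324 :* (C₀ :* (p :* r₂ :^ 4)) :+ κ :* num 243 :* (C₀ :* (p :^ 2 :* r₂ :^ 2)) :+ κ :* num 648 :* (C₀ :* (p :^ 4 :* r₂))
           := κ :* num 9 :* (C₀ :* (r₄ :* (r₄ :+ num 4 :* p :* r₁) :^ 2 :+ num 2 :* p :* r₄ :* r₂ :* (r₄ :+ num 2 :* r₁) :^ 2))) S.refl κ C₀ p ⟩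
    κ · lit 9 · (C₀ · (r₄ · (r₄ S.+ lit 4 · p · r₁) ^ 2 S.+ lit 2 · p · r₄ · r₂ · (r₄ S.+ lit 2 · r₁) ^ 2))
      ≈⟨ S.*-cong κ9 (S.sym a₅-p) ⟩
    S.1# · (inv (qPoch 1) ^ 6 · a₅)
      ≈⟨ S.*-identityˡ _ ⟩
    inv (qPoch 1) ^ 6 · a₅ ∎
    where
    open ≋-Reasoning
    two : ∀ c x y {d z} → c ≋ d → x · y ≋ z → c · x · y ≋ d · z
    two c x y p q = S.trans (S.*-assoc c x y) (S.*-cong p q)
    three : ∀ c x y z {d w} → c ≋ d → x · y · z ≋ w → c · x · y · z ≋ d · w
    three c x y z p q = S.trans (solve 4 (λ c x y z → c :* x :* y :* z := c :* (x :* y :* z)) S.refl c x y z) (S.*-cong p q)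
    three′ : ∀ c x y z {d w} → c ≋ d → x · (y · z) ≋ w → c · x · y · z ≋ d · w
    three′ c x y z p q = S.trans (solve 4 (λ c x y z → c :* x :* y :* z := c :* (x :* (y :* z))) S.refl c x y z) (S.*-cong p q)
    four : ∀ c x y z u {d w} → c ≋ d → x · (y · z · u) ≋ w → c · x · y · z · u ≋ d · w
    four c x y z u p q = S.trans (solve 5 (λ c x y z u → c :* x :* y :* z :* u := c :* (x :* (y :* z :* u))) S.refl c x y z u) (S.*-cong p q)

-- The theta series of A₅

⊎-partition : Partition {I} {I ⊎ J} {J} inj₁ inj₂
⊎-partition = record
  { injective₁ = ⊎ₚ.inj₁-injective ; injective₂ = ⊎ₚ.inj₂-injective ; disjoint = λ _ _ ()
  ; cover = λ { (inj₁ i) → inj₁ (i , refl) ; (inj₂ j) → inj₂ (j , refl) } }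

-- Functions on ℤ given by residue classes are defined through `cover`; the two equations below
-- evaluate them on a class without unfolding the decision.
module Glue {I J K : Set} {e₁ : I → K} {e₂ : J → K} (P : Partition e₁ e₂) where
  open Partition P

  glue : (I → PS) → (J → PS) → K → PS
  glue f g k with cover k
  ... | inj₁ (i , _) = f i
  ... | inj₂ (j , _) = g j

  glue₁ : ∀ f g i → glue f g (e₁ i) ≡ f i
  glue₁ f g i with cover (e₁ i)
  ... | inj₁ (i′ , eq) = cong f (sym (injective₁ eq))
  ... | inj₂ (j , eq)  = contradiction eq (disjoint i j)

  glue₂ : ∀ f g j → glue f g (e₂ j) ≡ g j
  glue₂ f g j with cover (e₂ j)
  ... | inj₁ (i , eq)  = contradiction (sym eq) (disjoint i j)
  ... | inj₂ (j′ , eq) = cong g (sym (injective₂ eq))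

parity-partition : Partition {ℤ} {ℤ} {ℤ} (λ s → s ℤ.+ s) (λ s → ℤ.- (s ℤ.+ s ℤ.+ ℤ.+ 1))
parity-partition = record
  { injective₁ = double-injective
  ; injective₂ = λ {s} {t} eq → double-injective (∙-cancelʳ (ℤ.+ 1) (s ℤ.+ s) (t ℤ.+ t) (ℤₚ.neg-injective eq))
  ; disjoint   = λ s t eq → s+s≢1 (ℤ.- s ℤ.- t) (trans (solve 2 (λ s t → (:- s :- t) :+ (:- s :- t) := :- (s :+ s) :- t :- t) refl s t)
      (trans (cong (λ x → ℤ.- x ℤ.- t ℤ.- t) eq) (solve 1 (λ t → :- (:- (t :+ t :+ num 1)) :- t :- t := num 1) refl t)))
  ; cover      = halve }
  where open ℤSolver

-- The residues 0, 1 and 2 modulo 3. The signs and offsets give both nonzero classes the same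
-- exponent W 1 2 j in J(z)³, and negation exchanges e₊ (1 + r) with e₋ r.
e₀ e₊ e₋ : ℤ → ℤ
e₀ j = ℤ.+ 3 ℤ.* j
e₊ j = ℤ.+ 3 ℤ.* j ℤ.- ℤ.+ 2
e₋ j = ℤ.- (ℤ.+ 3 ℤ.* j) ℤ.- ℤ.+ 1

module _ where
  private
    open ℤSolver

    3x≢1 : ∀ x → ¬ ℤ.+ 3 ℤ.* x ≡ ℤ.+ 1
    3x≢1 (ℤ.+ suc zero) ()
    3x≢1 (ℤ.+ suc (suc x)) ()
    3x≢2 : ∀ x → ¬ ℤ.+ 3 ℤ.* x ≡ ℤ.+ 2
    3x≢2 (ℤ.+ suc zero) ()
    3x≢2 (ℤ.+ suc (suc x)) eq = ℕₚ.m+1+n≢0 x (ℕₚ.suc-injective (ℕₚ.suc-injective (ℤₚ.+-injective eq)))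

    triple-injective : ∀ {i j} → ℤ.+ 3 ℤ.* i ≡ ℤ.+ 3 ℤ.* j → i ≡ j
    triple-injective {i} {j} = ℤₚ.*-cancelˡ-≡ (ℤ.+ 3) i j

  mod3-partition : Partition {ℤ} {ℤ} {ℤ ⊎ ℤ} e₀ [ e₊ , e₋ ]′
  mod3-partition = record
    { injective₁ = triple-injective
    ; injective₂ = λ {x} {y} → injective x y
    ; disjoint   = disjoint
    ; cover      = λ κ → cover κ (κ %ℕ 3) (n%ℕd<d κ 3) (a≡a%ℕn+[a/ℕn]*n κ 3) }
    where
    e₊≢e₋ : ∀ i j → ¬ e₊ i ≡ e₋ j
    e₊≢e₋ i j eq = 3x≢1 (i ℤ.+ j) (trans (solve 2 (λ i j → num 3 :* (i :+ j) := (num 3 :* i :- num 2) :+ num 2 :+ num 3 :* j) refl i j)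
      (trans (cong (λ x → x ℤ.+ ℤ.+ 2 ℤ.+ ℤ.+ 3 ℤ.* j) eq) (solve 1 (λ j → (:- (num 3 :* j) :- num 1) :+ num 2 :+ num 3 :* j := num 1) refl j)))
    injective : ∀ x y → [ e₊ , e₋ ]′ x ≡ [ e₊ , e₋ ]′ y → x ≡ y
    injective (inj₁ i) (inj₁ j) eq = cong inj₁ (triple-injective (∙-cancelʳ (ℤ.- ℤ.+ 2) (ℤ.+ 3 ℤ.* i) (ℤ.+ 3 ℤ.* j) eq))
    injective (inj₂ i) (inj₂ j) eq = cong inj₂ (triple-injective (ℤₚ.neg-injective (∙-cancelʳ (ℤ.- ℤ.+ 1) (ℤ.- (ℤ.+ 3 ℤ.* i)) (ℤ.- (ℤ.+ 3 ℤ.* j)) eq)))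
    injective (inj₁ i) (inj₂ j) eq = contradiction eq (e₊≢e₋ i j)
    injective (inj₂ i) (inj₁ j) eq = contradiction (sym eq) (e₊≢e₋ j i)
    disjoint : ∀ i x → ¬ e₀ i ≡ [ e₊ , e₋ ]′ x
    disjoint i (inj₁ j) eq = 3x≢2 (j ℤ.- i) (trans (solve 2 (λ i j → num 3 :* (j :- i) := num 3 :* j :- num 3 :* i) refl i j)
      (trans (cong (λ x → ℤ.+ 3 ℤ.* j ℤ.- x) eq) (solve 1 (λ j → num 3 :* j :- (num 3 :* j :- num 2) := num 2) refl j)))
    disjoint i (inj₂ j) eq = 3x≢1 (ℤ.- i ℤ.- j) (trans (solve 2 (λ i j → num 3 :* (:- i :- j) := :- (num 3 :* i) :- num 3 :* j) refl i j)
      (trans (cong (λ x → ℤ.- x ℤ.- ℤ.+ 3 ℤ.* j) eq) (solve 1 (λ j → :- (:- (num 3 :* j) :- num 1) :- num 3 :* j := num 1) refl j)))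
    cover : ∀ κ r → r < 3 → κ ≡ ℤ.+ r ℤ.+ (κ /ℕ 3) ℤ.* ℤ.+ 3 → (∃ λ i → κ ≡ e₀ i) ⊎ (∃ λ x → κ ≡ [ e₊ , e₋ ]′ x)
    cover κ 0 _ eq = inj₁ (κ /ℕ 3 , trans eq (solve 1 (λ d → num 0 :+ d :* num 3 := num 3 :* d) refl (κ /ℕ 3)))
    cover κ 1 _ eq = inj₂ (inj₁ (κ /ℕ 3 ℤ.+ ℤ.+ 1) , trans eq (solve 1 (λ d → num 1 :+ d :* num 3 := num 3 :* (d :+ num 1) :- num 2) refl (κ /ℕ 3)))
    cover κ 2 _ eq = inj₂ (inj₂ (ℤ.- (κ /ℕ 3) ℤ.- ℤ.+ 1) , trans eq (solve 1 (λ d → num 2 :+ d :* num 3 := :- (num 3 :* (:- d :- num 1)) :- num 1) refl (κ /ℕ 3)))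
    cover κ (suc (suc (suc r))) (s≤s (s≤s (s≤s ()))) eq

module Parity = Glue parity-partition
module Mod3 = Glue mod3-partition

PSum-split : ∀ {K : Set} {_≟I_ : DecidableEquality I} {_≟J_ : DecidableEquality J} {_≟K_ : DecidableEquality K} {e₁ : I → K} {e₂ : J → K} → Partition e₁ e₂ → ∀ {F s t} →
             PSum _≟I_ (F ∘ e₁) s → PSum _≟J_ (F ∘ e₂) t → PSum _≟K_ F (s S.+ t)
PSum-split P p q n = HasSum-split P (p n) (q n)

PSum-+ᶻ : ∀ c {F s} → PSum ℤ._≟_ (λ r → F (c ℤ.+ r)) s → PSum ℤ._≟_ F s
PSum-+ᶻ c h n = HasSum-reindex (λ r → c ℤ.+ r) (∙-cancelˡ c _ _) (λ k → k ℤ.- c , solve 2 (λ c k → k := c :+ (k :- c)) refl c k) (h n)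
  where open ℤSolver

PSum--ᶻ : ∀ c {F s} → PSum ℤ._≟_ (λ r → F (c ℤ.- r)) s → PSum ℤ._≟_ F s
PSum--ᶻ c h n = HasSum-reindex (λ r → c ℤ.- r) (λ eq → ℤₚ.neg-injective (∙-cancelˡ c _ _ eq)) (λ k → c ℤ.- k , solve 2 (λ c k → k := c :- (c :- k)) refl c k) (h n)
  where open ℤSolver

-- Coefficients of z^m in J(z), J(z)² and J(z)³, where J(z) = Σ z^m q^(m(m+1)/2).
J₁ J₂ J₃ : ℤ → PS
J₁ m = qpow (W 1 0 m)
J₂ = Parity.glue (λ s → qpow (W 2 0 s) · φ) (λ s → qpow (W 1 1 s) · ψ)
J₃ = Mod3.glue (λ j → qpow (W 3 0 j) · a₂) [ (λ j → qpow (W 1 2 j) · c₂) , (λ j → qpow (W 1 2 j) · c₂) ]′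

module _ where
  private
    open ℤSolver

    qpow-term : ∀ {x} a b c r → x ≡ c ℕ.+ W a b r → qpow x ≋ qpow c · term 1ℚ a b r
    qpow-term a b c r refl = S.trans (S.sym (qpow-+ c (W a b r))) (S.*-congˡ {qpow c} (S.sym (term-1 a b r)))

    sum-θ : ∀ c a b → PSum ℤ._≟_ (λ r → qpow c · term 1ℚ (suc a) b r) (qpow c · θ 1ℚ (suc a) b)
    sum-θ c a b = PSum-· (qpow c) (PSum-θ 1ℚ a b)

  -- Completing the square: with m = s + r for κ = 2s, or m = -s + r for κ = -(2s + 1), the exponent
  -- becomes a part depending on κ alone plus that of `φ` or `ψ`.
  J₂-sum : ∀ κ → PSum ℤ._≟_ (λ m → J₁ m · J₁ (κ ℤ.- m)) (J₂ κ)
  J₂-sum κ with halve κ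
  ... | inj₁ (s , refl) = PSum-+ᶻ s (PSum-cong (λ r → S.sym (S.trans (qpow-+ (W 1 0 (s ℤ.+ r)) (W 1 0 (s ℤ.+ s ℤ.- (s ℤ.+ r)))) (qpow-term 1 1 (W 2 0 s) r (weight r)))) S.refl (sum-θ (W 2 0 s) 0 1))
    where
    weight : ∀ r → W 1 0 (s ℤ.+ r) ℕ.+ W 1 0 (s ℤ.+ s ℤ.- (s ℤ.+ r)) ≡ W 2 0 s ℕ.+ W 1 1 r
    weight r = Twice-injective (Twice-+ (Twice-W 1 0 (s ℤ.+ r)) (Twice-W 1 0 (s ℤ.+ s ℤ.- (s ℤ.+ r)))) (Twice-+ (Twice-W 2 0 s) (Twice-W 1 1 r))
      (solve 2 (λ s r → wt 1 0 (s :+ r) :+ wt 1 0 (s :+ s :- (s :+ r)) := wt 2 0 s :+ wt 1 1 r) refl s r)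
  ... | inj₂ (s , refl) = PSum-+ᶻ (ℤ.- s) (PSum-cong (λ r → S.sym (S.trans (qpow-+ (W 1 0 (ℤ.- s ℤ.+ r)) (W 1 0 (o ℤ.- (ℤ.- s ℤ.+ r)))) (qpow-term 2 0 (W 1 1 s) r (weight r)))) S.refl (sum-θ (W 1 1 s) 1 0))
    where
    o = ℤ.- (s ℤ.+ s ℤ.+ ℤ.+ 1)
    weight : ∀ r → W 1 0 (ℤ.- s ℤ.+ r) ℕ.+ W 1 0 (o ℤ.- (ℤ.- s ℤ.+ r)) ≡ W 1 1 s ℕ.+ W 2 0 r
    weight r = Twice-injective (Twice-+ (Twice-W 1 0 (ℤ.- s ℤ.+ r)) (Twice-W 1 0 (o ℤ.- (ℤ.- s ℤ.+ r)))) (Twice-+ (Twice-W 1 1 s) (Twice-W 2 0 r))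
      (solve 2 (λ s r → wt 1 0 (:- s :+ r) :+ wt 1 0 (:- (s :+ s :+ num 1) :- (:- s :+ r)) := wt 1 1 s :+ wt 2 0 r) refl s r)

  private
    shape : ∀ {a b d} (g : PS) x y c → x ≡ qpow a · g → a ℕ.+ b ≡ c ℕ.+ d → y ≡ d → x · qpow b ≋ qpow c · (g · qpow y)
    shape {a} {b} {d} g _ y c refl e refl = S.trans (PSolver.solve 3 (λ a g b → (a PSolver.:* g) PSolver.:* b PSolver.:= (a PSolver.:* b) PSolver.:* g) S.refl (qpow a) g (qpow b))
      (S.trans (S.*-congʳ (S.trans (qpow-+ a b) (S.trans (S.reflexive (cong qpow e)) (S.sym (qpow-+ c d)))))
      (PSolver.solve 3 (λ c d g → (c PSolver.:* d) PSolver.:* g PSolver.:= c PSolver.:* (g PSolver.:* d)) S.refl (qpow c) (qpow d) g))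

    -- The sum is split by the parity of m, as `J₂` is. The substitutions g and h complete the
    -- square in the even and in the odd part; u and v are the powers of q left over.
    J₃-parts : ∀ κ j₁ j₂ j (g h : ℤ → ℤ) u v a b a′ b′ → let c = W j₁ j₂ j in
      (∀ {F s} → PSum ℤ._≟_ (F ∘ g) s → PSum ℤ._≟_ F s) → (∀ {F s} → PSum ℤ._≟_ (F ∘ h) s → PSum ℤ._≟_ F s) →
      (∀ r → 2W 2 0 (g r) ℤ.+ 2W 1 0 (κ ℤ.- (g r ℤ.+ g r)) ≡ 2W j₁ j₂ j ℤ.+ (ℤ.+ u ℤ.* ℤ.+ 2 ℤ.+ 2W (suc a) b r)) →
      (∀ r → 2W 1 1 (h r) ℤ.+ 2W 1 0 (κ ℤ.- ℤ.- (h r ℤ.+ h r ℤ.+ ℤ.+ 1)) ≡ 2W j₁ j₂ j ℤ.+ (ℤ.+ v ℤ.* ℤ.+ 2 ℤ.+ 2W (suc a′) b′ r)) →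
      PSum ℤ._≟_ (λ m → J₂ m · J₁ (κ ℤ.- m)) (qpow c · (qpow u · (φ · θ 1ℚ (suc a) b) S.+ qpow v · (ψ · θ 1ℚ (suc a′) b′)))
    J₃-parts κ j₁ j₂ j g h u v a b a′ b′ reindex-g reindex-h even odd = PSum-cong {_≟_ = ℤ._≟_} (λ _ → S.refl) (S.sym (S.distribˡ (qpow c) _ _)) (PSum-split parity-partition
      (reindex-g (PSum-cong (λ r → S.sym (part φ u a b (λ s → W 2 0 s) (λ s → s ℤ.+ s) (g r) r (Parity.glue₁ _ _ (g r)) (doubled u (even r) (Twice-W 2 0 (g r)) (Twice-W 1 0 (κ ℤ.- (g r ℤ.+ g r))) (Twice-W (suc a) b r)))) (assemble φ u a b) (family φ u a b)))
      (reindex-h (PSum-cong (λ r → S.sym (part ψ v a′ b′ (λ s → W 1 1 s) (λ s → ℤ.- (s ℤ.+ s ℤ.+ ℤ.+ 1)) (h r) r (Parity.glue₂ _ _ (h r)) (doubled v (odd r) (Twice-W 1 1 (h r)) (Twice-W 1 0 (κ ℤ.- ℤ.- (h r ℤ.+ h r ℤ.+ ℤ.+ 1))) (Twice-W (suc a′) b′ r)))) (assemble ψ v a′ b′) (family ψ v a′ b′))))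
      where
      c = W j₁ j₂ j
      doubled : ∀ {x y z} {x₂ y₂ z₂ : ℤ} u → x₂ ℤ.+ y₂ ≡ 2W j₁ j₂ j ℤ.+ (ℤ.+ u ℤ.* ℤ.+ 2 ℤ.+ z₂) → Twice x x₂ → Twice y y₂ → Twice z z₂ → x ℕ.+ y ≡ c ℕ.+ (u ℕ.+ z)
      doubled u eq X Y Z = Twice-injective (Twice-+ X Y) (Twice-+ (Twice-W j₁ j₂ j) (Twice-+ (Twice-id u) Z)) eq
      family : ∀ G u a b → PSum ℤ._≟_ (λ r → (qpow c · (qpow u · G)) · term 1ℚ (suc a) b r) ((qpow c · (qpow u · G)) · θ 1ℚ (suc a) b)
      family G u a b = PSum-· (qpow c · (qpow u · G)) (PSum-θ 1ℚ a b)
      assemble : ∀ G u a b → (qpow c · (qpow u · G)) · θ 1ℚ (suc a) b ≋ qpow c · (qpow u · (G · θ 1ℚ (suc a) b))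
      assemble G u a b = PSolver.solve 4 (λ c u G t → (c PSolver.:* (u PSolver.:* G)) PSolver.:* t PSolver.:= c PSolver.:* (u PSolver.:* (G PSolver.:* t))) S.refl (qpow c) (qpow u) G (θ 1ℚ (suc a) b)
      part : ∀ G u a b (w : ℤ → ℕ) (e : ℤ → ℤ) s r → J₂ (e s) ≡ qpow (w s) · G → w s ℕ.+ W 1 0 (κ ℤ.- e s) ≡ c ℕ.+ (u ℕ.+ W (suc a) b r) →
             J₂ (e s) · J₁ (κ ℤ.- e s) ≋ (qpow c · (qpow u · G)) · term 1ℚ (suc a) b r
      part G u a b w e s r eq wt-eq = S.trans (shape G _ (u ℕ.+ W (suc a) b r) c eq wt-eq refl)
        (S.trans (S.*-congˡ {qpow c} (S.*-congˡ {G} (S.trans (S.sym (qpow-+ u (W (suc a) b r))) (S.*-congˡ {qpow u} (S.sym (term-1 (suc a) b r))))))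
        (PSolver.solve 4 (λ c u G t → c PSolver.:* (G PSolver.:* (u PSolver.:* t)) PSolver.:= (c PSolver.:* (u PSolver.:* G)) PSolver.:* t) S.refl (qpow c) (qpow u) G (term 1ℚ (suc a) b r)))

    drop-q⁰ : ∀ c x y → qpow c · (qpow 0 · x S.+ qpow 0 · y) ≋ qpow c · (x S.+ y)
    drop-q⁰ c x y = S.*-congˡ {qpow c} (S.+-cong (S.trans (S.*-congʳ qpow-0) (S.*-identityˡ x)) (S.trans (S.*-congʳ qpow-0) (S.*-identityˡ y)))

  J₃-sum : ∀ κ → PSum ℤ._≟_ (λ m → J₂ m · J₁ (κ ℤ.- m)) (J₃ κ)
  J₃-sum κ with Partition.cover mod3-partition κ
  ... | inj₁ (j , refl) = PSum-cong (λ _ → S.refl) (S.*-congˡ {qpow (W 3 0 j)} (S.+-congʳ {q · (ψ · B0)} (S.trans (S.*-congʳ qpow-0) (S.*-identityˡ (φ · B3)))))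
    (J₃-parts κ 3 0 j (λ r → j ℤ.+ r) (λ r → ℤ.- j ℤ.+ r) 0 1 2 3 5 0 (PSum-+ᶻ j) (PSum-+ᶻ (ℤ.- j))
      (solve 2 (λ j r → wt 2 0 (j :+ r) :+ wt 1 0 (num 3 :* j :- (j :+ r :+ (j :+ r))) := wt 3 0 j :+ (num 0 :* num 2 :+ wt 3 3 r)) refl j)
      (solve 2 (λ j r → wt 1 1 (:- j :+ r) :+ wt 1 0 (num 3 :* j :- :- (:- j :+ r :+ (:- j :+ r) :+ num 1)) := wt 3 0 j :+ (num 1 :* num 2 :+ wt 6 0 r)) refl j))
  ... | inj₂ (inj₁ j , refl) = PSum-cong (λ _ → S.refl) (drop-q⁰ (W 1 2 j) (φ · B1) (ψ · B2))
    -- Here r runs backwards; otherwise the theta functions would appear with their arguments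
    -- exchanged, as `θ 1ℚ 1 5` and `θ 1ℚ 2 4`.
    (J₃-parts κ 1 2 j (λ r → j ℤ.- ℤ.+ 1 ℤ.- r) (λ r → ℤ.- j ℤ.- r) 0 0 4 1 3 2 (PSum--ᶻ (j ℤ.- ℤ.+ 1)) (PSum--ᶻ (ℤ.- j))
      (solve 2 (λ j r → let s = j :- num 1 :- r in wt 2 0 s :+ wt 1 0 (num 3 :* j :- num 2 :- (s :+ s)) := wt 1 2 j :+ (num 0 :* num 2 :+ wt 5 1 r)) refl j)
      (solve 2 (λ j r → let s = :- j :- r in wt 1 1 s :+ wt 1 0 (num 3 :* j :- num 2 :- :- (s :+ s :+ num 1)) := wt 1 2 j :+ (num 0 :* num 2 :+ wt 4 2 r)) refl j))
  ... | inj₂ (inj₂ j , refl) = PSum-cong (λ _ → S.refl) (drop-q⁰ (W 1 2 j) (φ · B1) (ψ · B2))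
    (J₃-parts κ 1 2 j (λ r → ℤ.- j ℤ.+ r) (λ r → j ℤ.+ r) 0 0 4 1 3 2 (PSum-+ᶻ (ℤ.- j)) (PSum-+ᶻ j)
      (solve 2 (λ j r → let s = :- j :+ r in wt 2 0 s :+ wt 1 0 (:- (num 3 :* j) :- num 1 :- (s :+ s)) := wt 1 2 j :+ (num 0 :* num 2 :+ wt 5 1 r)) refl j)
      (solve 2 (λ j r → let s = j :+ r in wt 1 1 s :+ wt 1 0 (:- (num 3 :* j) :- num 1 :- :- (s :+ s :+ num 1)) := wt 1 2 j :+ (num 0 :* num 2 :+ wt 4 2 r)) refl j))

-- Since m and -m are multiplied, the class of multiples of 3 pairs with itself and the two other
-- classes pair with each other. Those two contributions are equal, whence the repeated summand of
-- `a₅`.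
a₅-sum : PSum ℤ._≟_ (λ m → J₃ m · J₃ (ℤ.+ 0 ℤ.- m)) a₅
a₅-sum = PSum-cong {_≟_ = ℤ._≟_} (λ _ → S.refl) (S.sym (S.+-assoc (B3 · (a₂ · a₂)) (q · (B1 · (c₂ · c₂))) (q · (B1 · (c₂ · c₂))))) (PSum-split mod3-partition zeroth
  (PSum-split {_≟K_ = ⊎ₚ.≡-dec ℤ._≟_ ℤ._≟_} ⊎-partition (PSum-+ᶻ (ℤ.+ 1) first) second))
  where
  open ℤSolver
  J₃-e₀ : ∀ j → J₃ (e₀ j) ≡ qpow (W 3 0 j) · a₂
  J₃-e₀ j = Mod3.glue₁ _ _ j
  J₃-e₊ : ∀ j → J₃ (e₊ j) ≡ qpow (W 1 2 j) · c₂
  J₃-e₊ j = Mod3.glue₂ _ _ (inj₁ j)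
  J₃-e₋ : ∀ j → J₃ (e₋ j) ≡ qpow (W 1 2 j) · c₂
  J₃-e₋ j = Mod3.glue₂ _ _ (inj₂ j)
  family : ∀ e a b g → PSum ℤ._≟_ (λ r → (qpow e · (g · g)) · term 1ℚ (suc a) b r) (qpow e · (θ 1ℚ (suc a) b · (g · g)))
  family e a b g = PSum-cong (λ _ → S.refl) (PSolver.solve 3 (λ e g t → (e PSolver.:* (g PSolver.:* g)) PSolver.:* t PSolver.:= e PSolver.:* (t PSolver.:* (g PSolver.:* g))) S.refl (qpow e) g (θ 1ℚ (suc a) b))
    (PSum-· (qpow e · (g · g)) (PSum-θ 1ℚ a b))
  pair : ∀ e a b g {u v x y} r → x ≡ qpow u · g → y ≡ qpow v · g → u ℕ.+ v ≡ e ℕ.+ W (suc a) b r → (qpow e · (g · g)) · term 1ℚ (suc a) b r ≋ x · y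
  pair e a b g {u} {v} r refl refl eq = S.trans (S.*-congˡ {qpow e · (g · g)} (term-1 (suc a) b r))
    (S.trans (PSolver.solve 3 (λ e g t → (e PSolver.:* (g PSolver.:* g)) PSolver.:* t PSolver.:= (e PSolver.:* t) PSolver.:* (g PSolver.:* g)) S.refl (qpow e) g (qpow (W (suc a) b r)))
    (S.trans (S.*-congʳ (S.trans (qpow-+ e (W (suc a) b r)) (S.trans (S.reflexive (cong qpow (sym eq))) (S.sym (qpow-+ u v)))))
    (PSolver.solve 3 (λ u g v → (u PSolver.:* v) PSolver.:* (g PSolver.:* g) PSolver.:= (u PSolver.:* g) PSolver.:* (v PSolver.:* g)) S.refl (qpow u) g (qpow v))))
  zeroth : PSum ℤ._≟_ (λ j → J₃ (e₀ j) · J₃ (ℤ.+ 0 ℤ.- e₀ j)) (B3 · (a₂ · a₂))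
  zeroth = PSum-cong (λ j → pair 0 2 3 a₂ j (J₃-e₀ j) (trans (cong J₃ (solve 1 (λ j → num 0 :- num 3 :* j := num 3 :* (:- j)) refl j)) (J₃-e₀ (ℤ.- j)))
      (Twice-injective (Twice-+ (Twice-W 3 0 j) (Twice-W 3 0 (ℤ.- j))) (Twice-+ (Twice-id 0) (Twice-W 3 3 j))
        (solve 1 (λ j → wt 3 0 j :+ wt 3 0 (:- j) := num 0 :* num 2 :+ wt 3 3 j) refl j)))
    (S.trans (S.*-congʳ qpow-0) (S.*-identityˡ _)) (family 0 2 3 a₂)
  first : PSum ℤ._≟_ (λ r → J₃ (e₊ (ℤ.+ 1 ℤ.+ r)) · J₃ (ℤ.+ 0 ℤ.- e₊ (ℤ.+ 1 ℤ.+ r))) (q · (B1 · (c₂ · c₂)))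
  first = PSum-cong (λ r → pair 1 4 1 c₂ r (J₃-e₊ (ℤ.+ 1 ℤ.+ r)) (trans (cong J₃ (solve 1 (λ r → num 0 :- (num 3 :* (num 1 :+ r) :- num 2) := :- (num 3 :* r) :- num 1) refl r)) (J₃-e₋ r))
      (Twice-injective (Twice-+ (Twice-W 1 2 (ℤ.+ 1 ℤ.+ r)) (Twice-W 1 2 r)) (Twice-+ (Twice-id 1) (Twice-W 5 1 r))
        (solve 1 (λ r → wt 1 2 (num 1 :+ r) :+ wt 1 2 r := num 1 :* num 2 :+ wt 5 1 r) refl r)))
    S.refl (family 1 4 1 c₂)
  second : PSum ℤ._≟_ (λ r → J₃ (e₋ r) · J₃ (ℤ.+ 0 ℤ.- e₋ r)) (q · (B1 · (c₂ · c₂)))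
  second = PSum-cong (λ r → pair 1 4 1 c₂ r (J₃-e₋ r) (trans (cong J₃ (solve 1 (λ r → num 0 :- (:- (num 3 :* r) :- num 1) := num 3 :* (num 1 :+ r) :- num 2) refl r)) (J₃-e₊ (ℤ.+ 1 ℤ.+ r)))
      (Twice-injective (Twice-+ (Twice-W 1 2 r) (Twice-W 1 2 (ℤ.+ 1 ℤ.+ r))) (Twice-+ (Twice-id 1) (Twice-W 5 1 r))
        (solve 1 (λ r → wt 1 2 r :+ wt 1 2 (num 1 :+ r) := num 1 :* num 2 :+ wt 5 1 r) refl r)))
    S.refl (family 1 4 1 c₂)

-- Power series in z over PS

infixl 7 _⊛_
opaque
  _⊛_ : (ℕ → PS) → (ℕ → PS) → ℕ → PS
  (a ⊛ b) zero    = a 0 · b 0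
  (a ⊛ b) (suc k) = a 0 · b (suc k) S.+ ((a ∘ suc) ⊛ b) k

  ⊛-zero : ∀ a b → (a ⊛ b) 0 ≋ a 0 · b 0
  ⊛-zero a b = S.refl

  ⊛-suc : ∀ a b k → (a ⊛ b) (suc k) ≋ a 0 · b (suc k) S.+ ((a ∘ suc) ⊛ b) k
  ⊛-suc a b k = S.refl

module Z-series = PowerSeries PS-ring _⊛_ ⊛-zero ⊛-suc
module Z = CommutativeRing Z-series.seriesRing
module ZSolver = IntegerSolver Z-series.seriesRing

linear : PS → PS → ℕ → PS
linear u v zero          = u
linear u v (suc zero)    = v
linear u v (suc (suc _)) = S.0#

linear-⊛-suc : ∀ u v a k → (linear u v ⊛ a) (suc k) ≋ u · a (suc k) S.+ v · a k
linear-⊛-suc u v a k = S.trans (⊛-suc (linear u v) a k) (S.+-congˡ {u · a (suc k)} (tail k))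
  where
  tail : ∀ k → ((linear u v ∘ suc) ⊛ a) k ≋ v · a k
  tail zero    = ⊛-zero (linear u v ∘ suc) a
  tail (suc k) = S.trans (⊛-suc (linear u v ∘ suc) a k)
    (S.trans (S.+-congˡ {v · a (suc k)} (Z.zeroˡ a k)) (S.+-identityʳ (v · a (suc k))))

constant-⊛ : ∀ u a k → (linear u S.0# ⊛ a) k ≋ u · a k
constant-⊛ u a zero    = ⊛-zero (linear u S.0#) a
constant-⊛ u a (suc k) = S.trans (linear-⊛-suc u S.0# a k) (S.trans (S.+-congˡ {u · a (suc k)} (S.zeroˡ (a k))) (S.+-identityʳ (u · a (suc k))))

poly : List (PS × PS) → ℕ → PS
poly []             = Z.1#
poly ((u , v) ∷ fs) = linear u v ⊛ poly fs

poly-coef : ∀ fs k → poly fs k ≋ coef fs k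
poly-coef []             zero    = S.refl
poly-coef []             (suc k) = S.refl
poly-coef ((u , v) ∷ fs) zero    = S.trans (⊛-zero (linear u v) (poly fs)) (S.*-congˡ {u} (poly-coef fs 0))
poly-coef ((u , v) ∷ fs) (suc k) = S.trans (linear-⊛-suc u v (poly fs) k) (S.+-cong (S.*-congˡ {u} (poly-coef fs (suc k))) (S.*-congˡ {v} (poly-coef fs k)))

poly-++ : ∀ fs gs → poly (fs ++ gs) Z.≈ poly fs ⊛ poly gs
poly-++ []             gs = Z.sym (Z.*-identityˡ (poly gs))
poly-++ ((u , v) ∷ fs) gs = Z.trans (Z.*-congˡ {linear u v} (poly-++ fs gs)) (Z.sym (Z.*-assoc (linear u v) (poly fs) (poly gs)))

-- G (k - i), but 0 for i > k, where truncated subtraction would return G 0.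
entry : (ℕ → PS) → ℕ → ℕ → PS
entry G k       zero    = G k
entry G zero    (suc i) = S.0#
entry G (suc k) (suc i) = entry G k i

PSum-⊛ : ∀ F G k → PSum ℕ._≟_ (λ i → F i · entry G k i) ((F ⊛ G) k)
PSum-⊛ F G zero n = HasSum-cong (λ _ → refl) (trans (ℚₚ.+-identityʳ ((F 0 · G 0) n)) (sym (⊛-zero F G n)))
  (HasSum-split {_≟J_ = ℕ._≟_} ℕ-partition HasSum-⊤ (HasSum-cong (λ i → sym (S.zeroʳ (F (suc i)) n)) refl HasSum-0))
PSum-⊛ F G (suc k) n = HasSum-cong (λ _ → refl) (sym (⊛-suc F G k n)) (HasSum-split ℕ-partition HasSum-⊤ (PSum-⊛ (F ∘ suc) G k n))

-- Modulo q^(M+1), F is the Laurent series Σ f(m) z^m multiplied by z^A.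
record Shifted (M A : ℕ) (F : ℕ → PS) (f : ℤ → PS) : Set where
  field
    approx : ∀ k → F k ≋[ M ] f (k ⊟ A)
    below  : ∀ j → f -[1+ A ℕ.+ j ] ≋[ M ] S.0#

module _ {M A B : ℕ} {F G : ℕ → PS} {f g : ℤ → PS} (sF : Shifted M A F f) (sG : Shifted M B G g) where
  private
    open Shifted
    module T = CommutativeRing (PS-truncRing M)
    open ℤSolver using (solve; _:=_; _:+_; _:-_; :-_; num)

    minus : ∀ m n → m ⊟ n ≡ ℤ.+ m ℤ.- ℤ.+ n
    minus m n = sym (ℤₚ.m-n≡m⊖n m n)

    entry-approx : ∀ k i → entry G k i ≋[ M ] g (k ⊟ (A ℕ.+ B) ℤ.- (i ⊟ A))
    entry-approx k zero = T.trans (approx sG k) (T.reflexive (cong g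
      (trans (minus k B) (trans (solve 3 (λ k a b → k :- b := (k :- (a :+ b)) :- (num 0 :- a)) refl (ℤ.+ k) (ℤ.+ A) (ℤ.+ B))
        (cong₂ ℤ._-_ (sym (minus k (A ℕ.+ B))) (sym (minus 0 A)))))))
    entry-approx zero (suc i) = T.trans (T.sym (below sG i)) (T.reflexive (cong g
      (trans (solve 3 (λ a b i → :- (num 1 :+ (b :+ i)) := (num 0 :- (a :+ b)) :- ((num 1 :+ i) :- a)) refl (ℤ.+ A) (ℤ.+ B) (ℤ.+ i))
        (cong₂ ℤ._-_ (sym (minus 0 (A ℕ.+ B))) (sym (minus (suc i) A))))))
    entry-approx (suc k) (suc i) = T.trans (entry-approx k i) (T.reflexive (cong g
      (trans (cong₂ ℤ._-_ (minus k (A ℕ.+ B)) (minus i A))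
        (trans (solve 4 (λ k i a b → (k :- (a :+ b)) :- (i :- a) := ((num 1 :+ k) :- (a :+ b)) :- ((num 1 :+ i) :- a)) refl (ℤ.+ k) (ℤ.+ i) (ℤ.+ A) (ℤ.+ B))
        (cong₂ ℤ._-_ (sym (minus (suc k) (A ℕ.+ B))) (sym (minus (suc i) A)))))))

  -- The finite convolution is extended to all of ℤ: new indices m < -A contribute 0 by `below` for
  -- F, and indices beyond k, where `entry` is 0, contribute 0 by `below` for G.
  ⊛-approx : ∀ k {s} → PSum ℤ._≟_ (λ m → f m · g (k ⊟ (A ℕ.+ B) ℤ.- m)) s → (F ⊛ G) k ≋[ M ] s
  ⊛-approx k sum n n≤M = HasSum-unique
    (HasSum-cong (λ _ → refl) (ℚₚ.+-identityʳ _) (HasSum-split (⊖-partition A)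
      (HasSum-cong (λ i → T.*-cong (approx sF i) (entry-approx k i) n n≤M) refl (PSum-⊛ F G k n))
      (HasSum-cong {_≟_ = ℕ._≟_} (λ j → sym (T.trans (T.*-congʳ {g (k ⊟ (A ℕ.+ B) ℤ.- -[1+ A ℕ.+ j ])} (below sF j)) (T.zeroˡ (g (k ⊟ (A ℕ.+ B) ℤ.- -[1+ A ℕ.+ j ]))) n n≤M)) refl HasSum-0)))
    (sum n)

  -- If κ < -(A + B), then m < -A or κ - m < -B, so one factor always vanishes.
  Shifted-⊛ : ∀ {h} → (∀ κ → PSum ℤ._≟_ (λ m → f m · g (κ ℤ.- m)) (h κ)) → Shifted M (A ℕ.+ B) (F ⊛ G) h
  Shifted-⊛ {h} h-sum = record { approx = λ k → ⊛-approx k (h-sum (k ⊟ (A ℕ.+ B))) ; below = below′ }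
    where
    vanish : ∀ j m → f m · g (-[1+ A ℕ.+ B ℕ.+ j ] ℤ.- m) ≋[ M ] S.0#
    vanish j m with ⊖-cover A m
    ... | inj₂ (i , refl) = T.trans (T.*-congʳ {g (-[1+ A ℕ.+ B ℕ.+ j ] ℤ.- m)} (below sF i)) (T.zeroˡ (g (-[1+ A ℕ.+ B ℕ.+ j ] ℤ.- m)))
    ... | inj₁ (i , refl) = T.trans (T.*-congˡ {f m} (T.trans (T.reflexive (cong g
        (trans (cong (λ x → -[1+ A ℕ.+ B ℕ.+ j ] ℤ.- x) (minus i A))
          (solve 4 (λ a b i j → :- (num 1 :+ ((a :+ b) :+ j)) :- (i :- a) := :- (num 1 :+ (b :+ (j :+ i)))) refl (ℤ.+ A) (ℤ.+ B) (ℤ.+ i) (ℤ.+ j)))))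
        (below sG (j ℕ.+ i)))) (T.zeroʳ (f m))
    below′ : ∀ j → h -[1+ A ℕ.+ B ℕ.+ j ] ≋[ M ] S.0#
    below′ j n n≤M = HasSum-unique (h-sum -[1+ A ℕ.+ B ℕ.+ j ] n) (HasSum-cong (λ m → sym (vanish j m n n≤M)) refl HasSum-0)

-- The constant term of J(z)^6

module TP = TripleProduct 0 0

bigFactors : ℕ → List (PS × PS)
bigFactors N = TP.factors N N

-- w is z^N J(z) modulo q^(M+1), so index 6N of w^6 is the constant term of J^6. The triple product
-- describes (q;q)_∞ J instead of J; the six Euler factors enter as constant polynomials in z and
-- are then divided out.
sixth-power : ∀ M N → 2 ℕ.+ (M ℕ.+ M) ≤ N →
  let w = poly (bigFactors N) in ((w ⊛ w ⊛ w) ⊛ (w ⊛ w ⊛ w)) ((N ℕ.+ N ℕ.+ N) ℕ.+ (N ℕ.+ N ℕ.+ N)) ≋[ M ] inv (qPoch 1) ^ 6 · a₅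
sixth-power M N big = begin
  ((w ⊛ w ⊛ w) ⊛ (w ⊛ w ⊛ w)) L
    ≈⟨ (λ n _ → rescale n) ⟩
  inv (qPoch 1) ^ 6 · ((x ⊛ x ⊛ x) ⊛ (x ⊛ x ⊛ x)) L
    ≈⟨ T.*-congˡ {inv (qPoch 1) ^ 6} (⊛-approx s₃ s₃ L (subst (λ κ → PSum ℤ._≟_ (λ m → J₃ m · J₃ (κ ℤ.- m)) a₅) (sym (ℤₚ.n⊖n≡0 L)) a₅-sum)) ⟩
  inv (qPoch 1) ^ 6 · a₅ ∎
  where
  module T = CommutativeRing (PS-truncRing M)
  open import Relation.Binary.Reasoning.Setoid T.setoid
  e = TP.qfac-∞
  w = poly (bigFactors N)
  x = linear e S.0# ⊛ w
  L = (N ℕ.+ N ℕ.+ N) ℕ.+ (N ℕ.+ N ℕ.+ N)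
  rescale : ((w ⊛ w ⊛ w) ⊛ (w ⊛ w ⊛ w)) L ≋ inv (qPoch 1) ^ 6 · ((x ⊛ x ⊛ x) ⊛ (x ⊛ x ⊛ x)) L
  rescale = S.sym (S.trans (S.*-congˡ {inv (qPoch 1) ^ 6} (S.trans (collect L) (expand L))) cancel)
    where
    c = linear e S.0#
    w⁶ = (w ⊛ w ⊛ w) ⊛ (w ⊛ w ⊛ w)
    collect : (x ⊛ x ⊛ x) ⊛ (x ⊛ x ⊛ x) Z.≈ c ⊛ (c ⊛ (c ⊛ (c ⊛ (c ⊛ (c ⊛ w⁶)))))
    collect = solve 2 (λ c w → let x = c :* w in (x :* x :* x) :* (x :* x :* x) := c :* (c :* (c :* (c :* (c :* (c :* ((w :* w :* w) :* (w :* w :* w)))))))) Z.refl c w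
      where open ZSolver
    expand : ∀ k → (c ⊛ (c ⊛ (c ⊛ (c ⊛ (c ⊛ (c ⊛ w⁶)))))) k ≋ e · (e · (e · (e · (e · (e · w⁶ k)))))
    expand k = step (step (step (step (step (constant-⊛ e w⁶ k)))))
      where
      step : ∀ {a b} → a k ≋ b → (c ⊛ a) k ≋ e · b
      step {a} p = S.trans (constant-⊛ e a k) (S.*-congˡ {e} p)
    cancel : inv (qPoch 1) ^ 6 · (e · (e · (e · (e · (e · (e · w⁶ L)))))) ≋ w⁶ L
    cancel = S.trans (solve 3 (λ i e w → i :^ 6 :* (e :* (e :* (e :* (e :* (e :* (e :* w)))))) := (i :* e) :^ 6 :* w) S.refl (inv (qPoch 1)) e (w⁶ L))
      (S.trans (S.*-congʳ (S.trans (^-congˡ 6 ie≋1) (solve 0 (num 1 :^ 6 := num 1) S.refl))) (S.*-identityˡ (w⁶ L)))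
      where
      open PSolver
      ie≋1 : inv (qPoch 1) · e ≋ S.1#
      ie≋1 = S.trans (S.*-comm (inv (qPoch 1)) e) (S.trans (S.*-congʳ (S.trans (qfac-∞-poch 0) (S.sym (qPoch-poch 0)))) (·-inverseʳ (qPoch 1) refl))
  s₁ : Shifted M N x J₁
  s₁ = record
    { approx = λ k → T.trans (λ n _ → S.trans (constant-⊛ e w k) (S.*-congˡ {e} (poly-coef (bigFactors N) k)) n) (coef-limit 0 0 M N big k)
    ; below  = λ j → qpow-vanish (ℕₚ.≤-pred (ℕₚ.≤-trans (s≤s (ℕₚ.≤-trans (ℕₚ.≤-trans (s≤s (ℕₚ.m≤m+n M M)) (ℕₚ.<⇒≤ big)) (ℕₚ.m≤m+n N j))) (∣m∣≤1+W 0 0 -[1+ N ℕ.+ j ]))) }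
  s₃ : Shifted M (N ℕ.+ N ℕ.+ N) (x ⊛ x ⊛ x) J₃
  s₃ = Shifted-⊛ (Shifted-⊛ s₁ s₁ J₂-sum) s₁ J₃-sum

private
  variable
    A B : Set

-- Frobenius partitions

sublists : List A → List (List A)
sublists []       = [] ∷ []
sublists (x ∷ xs) = map (x ∷_) (sublists xs) ++ sublists xs

All-sublists : ∀ {P : A → Set} {xs r} → All P xs → r ∈ sublists xs → All P r
All-sublists []         (here refl) = []
All-sublists {xs = x ∷ xs} (px ∷ pxs) r∈ with ∈-++⁻ (map (x ∷_) (sublists xs)) r∈
... | inj₂ r∈ʳ = All-sublists pxs r∈ʳ
... | inj₁ r∈ˡ with ∈-map⁻ (x ∷_) r∈ˡ
...   | r′ , r′∈ , refl = px ∷ All-sublists pxs r′∈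

[]∈sublists : ∀ (xs : List A) → [] ∈ sublists xs
[]∈sublists []       = here refl
[]∈sublists (x ∷ xs) = ∈-++⁺ʳ (map (x ∷_) (sublists xs)) ([]∈sublists xs)

module _ {A : Set} {R : Rel A 0ℓ} (R-trans : Transitive R) (R-irrefl : Irreflexive _≡_ R) where

  sublists-sound : ∀ {xs r} → AllPairs R xs → r ∈ sublists xs → AllPairs R r
  sublists-sound [] (here refl) = []
  sublists-sound {xs = x ∷ xs} (rx ∷ rxs) r∈ with ∈-++⁻ (map (x ∷_) (sublists xs)) r∈
  ... | inj₂ r∈ʳ = sublists-sound rxs r∈ʳ
  ... | inj₁ r∈ˡ with ∈-map⁻ (x ∷_) r∈ˡ
  ...   | r′ , r′∈ , refl = All-sublists rx r′∈ ∷ sublists-sound rxs r′∈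

  -- If r begins with some y other than x, then x cannot occur later in r: it would come after y
  -- there, while y comes after x in the whole list.
  sublists-complete : ∀ {xs r} → AllPairs R xs → AllPairs R r → All (_∈ xs) r → r ∈ sublists xs
  sublists-complete {xs = xs} _ [] [] = []∈sublists xs
  sublists-complete {xs = x ∷ xs} (rx ∷ rxs) (ry ∷ rr) (here refl ∷ r⊆) =
    ∈-++⁺ˡ (∈-map⁺ (x ∷_) (sublists-complete rxs rr (All.zipWith (λ { (x<x , here refl) → contradiction x<x (R-irrefl refl) ; (_ , there z∈) → z∈ }) (ry , r⊆))))
  sublists-complete {xs = x ∷ xs} (rx ∷ rxs) (ry ∷ rr) (there y∈ ∷ r⊆) =
    ∈-++⁺ʳ (map (x ∷_) (sublists xs)) (sublists-complete rxs (ry ∷ rr)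
      (y∈ ∷ All.zipWith (λ { (y<x , here refl) → contradiction (R-trans y<x (All.lookup rx y∈)) (R-irrefl refl) ; (_ , there z∈) → z∈ }) (ry , r⊆)))

  sublists-unique : ∀ {xs} → AllPairs R xs → Unique (sublists xs)
  sublists-unique [] = [] ∷ []
  sublists-unique {x ∷ xs} (rx ∷ rxs) = Uniqueₚ.++⁺ (Uniqueₚ.map⁺ Listₚ.∷-injectiveʳ (sublists-unique rxs)) (sublists-unique rxs) disjoint
    where
    disjoint : ∀ {r} → ¬ (r ∈ map (x ∷_) (sublists xs) × r ∈ sublists xs)
    disjoint (r∈ˡ , r∈ʳ) with ∈-map⁻ (x ∷_) r∈ˡ
    ... | r′ , _ , refl = R-irrefl refl (All.head (All-sublists rx r∈ʳ))

lookup-unique : ∀ {xs : List A} → Unique xs → ∀ i j → lookup xs i ≡ lookup xs j → i ≡ j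
lookup-unique (_ ∷ _)  zero    zero    _  = refl
lookup-unique (x≢ ∷ _) zero    (suc j) eq = contradiction eq (All.lookup x≢ (∈-lookup j))
lookup-unique (x≢ ∷ _) (suc i) zero    eq = contradiction (sym eq) (All.lookup x≢ (∈-lookup i))
lookup-unique (_ ∷ u)  (suc i) (suc j) eq = cong suc (lookup-unique u i j eq)

enumeration : ∀ {Q : A → Set} {xs} → Unique xs → (∀ {x} → x ∈ xs → Q x) → (∀ {x} → Q x → x ∈ xs) → U.Irrelevant Q →
              Fin (length xs) ↔ Σ A Q
enumeration {Q = Q} {xs} unique sound complete irrelevant = mk↔ₛ′
  (λ i → lookup xs i , sound (∈-lookup i))
  (λ (x , qx) → index (complete qx))
  (λ (x , qx) → pair-≡ (sym (lookup-index (complete qx))))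
  (λ i → lookup-unique unique _ i (sym (lookup-index (complete (sound (∈-lookup i))))))
  where
  pair-≡ : ∀ {x y} {qx : Q x} {qy : Q y} → x ≡ y → (x , qx) ≡ (y , qy)
  pair-≡ {qx = qx} {qy} refl = cong (_ ,_) (irrelevant qx qy)

-- Sums over lists, and counting as a sum of indicators

sumL : List A → (A → ℚ) → ℚ
sumL []       f = 0ℚ
sumL (x ∷ xs) f = f x + sumL xs f

sumL-cong : ∀ (xs : List A) {f g} → (∀ x → f x ≡ g x) → sumL xs f ≡ sumL xs g
sumL-cong []       p = refl
sumL-cong (x ∷ xs) p = cong₂ _+_ (p x) (sumL-cong xs p)

sumL-++ : ∀ (xs ys : List A) f → sumL (xs ++ ys) f ≡ sumL xs f + sumL ys f
sumL-++ []       ys f = sym (ℚₚ.+-identityˡ _)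
sumL-++ (x ∷ xs) ys f = trans (cong (f x +_) (sumL-++ xs ys f)) (sym (ℚₚ.+-assoc (f x) (sumL xs f) (sumL ys f)))

sumL-map : ∀ (g : A → B) xs f → sumL (map g xs) f ≡ sumL xs (f ∘ g)
sumL-map g []       f = refl
sumL-map g (x ∷ xs) f = cong (f (g x) +_) (sumL-map g xs f)

sumL-product : ∀ (xs : List A) (ys : List B) f → sumL (cartesianProduct xs ys) f ≡ sumL xs (λ x → sumL ys (λ y → f (x , y)))
sumL-product []       ys f = refl
sumL-product (x ∷ xs) ys f = trans (sumL-++ (map (x ,_) ys) (cartesianProduct xs ys) f) (cong₂ _+_ (sumL-map (x ,_) ys f) (sumL-product xs ys f))

-- `_/_` divides by a gcd that does not compute for a variable c. Coprimality with 1 puts c / 1 into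
-- normal form, after which the addition computes.
natural-suc : ∀ c → ℤ.+ (suc c) / 1 ≡ 1ℚ + ℤ.+ c / 1
natural-suc c = sym (trans (cong (1ℚ +_) (ℚₚ.normalize-coprime (coprime-sym (1-coprimeTo c)))) (cong (λ x → (ℤ.+ 1 ℤ.+ x) / 1) (ℤₚ.*-identityʳ (ℤ.+ c))))

indicator : Bool → ℚ
indicator b = if b then 1ℚ else 0ℚ

count-filter : ∀ {P : A → Set} (P? : U.Decidable P) xs → ℤ.+ length (filter P? xs) / 1 ≡ sumL xs (λ x → indicator (does (P? x)))
count-filter P? []       = refl
count-filter P? (x ∷ xs) with does (P? x)
... | true  = trans (natural-suc (length (filter P? xs))) (cong (1ℚ +_) (count-filter P? xs))
... | false = trans (count-filter P? xs) (sym (ℚₚ.+-identityˡ _))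

ΣL : List A → (A → PS) → PS
ΣL xs f n = sumL xs (λ x → f x n)

ΣL-cong : ∀ (xs : List A) {f g} → (∀ x → f x ≋ g x) → ΣL xs f ≋ ΣL xs g
ΣL-cong xs p n = sumL-cong xs (λ x → p x n)

ΣL-· : ∀ a (xs : List A) f → a · ΣL xs f ≋ ΣL xs (λ x → a · f x)
ΣL-· a []       f = S.zeroʳ a
ΣL-· a (x ∷ xs) f = S.trans (S.distribˡ a (f x) (ΣL xs f)) (S.+-congˡ {a · f x} (ΣL-· a xs f))

ΣL-sublists : ∀ (x : A) xs f → ΣL (sublists (x ∷ xs)) f ≋ ΣL (sublists xs) (λ r → f (x ∷ r)) S.+ ΣL (sublists xs) f
ΣL-sublists x xs f n = trans (sumL-++ (map (x ∷_) (sublists xs)) (sublists xs) _) (cong (_+ sumL (sublists xs) (λ r → f r n)) (sumL-map (x ∷_) (sublists xs) _))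

ΣL-0 : ∀ (xs : List A) → ΣL xs (λ _ → S.0#) ≋ S.0#
ΣL-0 []       n = refl
ΣL-0 (x ∷ xs) n = trans (ℚₚ.+-identityˡ _) (ΣL-0 xs n)

pick : ℕ → ℕ → PS → PS
pick i j a = if does (i ℕ.≟ j) then a else S.0#

·-pick : ∀ b i j a → b · pick i j a ≋ pick i j (b · a)
·-pick b i j a with does (i ℕ.≟ j)
... | true  = S.refl
... | false = S.zeroʳ b

pick-cong : ∀ i j {a b} → a ≋ b → pick i j a ≋ pick i j b
pick-cong i j p with does (i ℕ.≟ j)
... | true  = p
... | false = S.refl

-- The factor 1 + z q^(v+1) decides whether v_c is in the top row; the factor z + q^v whether it is in the bottom row.
topFactors bottomFactors : ∀ {k} → List (Colored k) → List (PS × PS)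
topFactors    = map (λ x → S.1# , qpow (suc (proj₁ x)))
bottomFactors = map (λ x → qpow (proj₁ x) , S.1#)

topWeight : ∀ {k} → List (Colored k) → ℕ
topWeight r = length r ℕ.+ rowValueSum r

module _ {k : ℕ} where
  open PSolver

  -- Taking the summand z q^(v+1) from a factor puts the entry into t, so t uses up z^(length t) and
  -- the rest must come from fs. The 1 in v + 1 counts the columns, hence `topWeight`.
  coef-top : ∀ (xs : List (Colored k)) fs m →
    coef (topFactors xs ++ fs) m ≋ ΣL (sublists xs) (λ t → qpow (topWeight t) · entry (coef fs) m (length t))
  coef-top [] fs m = S.sym (S.trans (S.+-identityʳ (qpow 0 · coef fs m)) (S.trans (S.*-congʳ qpow-0) (S.*-identityˡ (coef fs m))))
  coef-top (x ∷ xs) fs zero = S.sym (begin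
    ΣL (sublists (x ∷ xs)) Φ
      ≈⟨ ΣL-sublists x xs Φ ⟩
    ΣL (sublists xs) (λ t → Φ (x ∷ t)) S.+ ΣL (sublists xs) Φ
      ≈⟨ S.+-cong (S.trans (ΣL-cong (sublists xs) (λ t → S.zeroʳ (qpow (topWeight (x ∷ t))))) (ΣL-0 (sublists xs))) (S.sym (coef-top xs fs 0)) ⟩
    S.0# S.+ coef rest 0
      ≈⟨ solve 1 (λ c → num 0 :+ c := num 1 :* c) S.refl (coef rest 0) ⟩
    S.1# · coef rest 0 ∎)
    where
    open ≋-Reasoning
    rest = topFactors xs ++ fs
    Φ = λ t → qpow (topWeight t) · entry (coef fs) 0 (length t)
  coef-top (x ∷ xs) fs (suc m) = S.sym (begin
    ΣL (sublists (x ∷ xs)) (Φ (suc m))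
      ≈⟨ ΣL-sublists x xs (Φ (suc m)) ⟩
    ΣL (sublists xs) (λ t → Φ (suc m) (x ∷ t)) S.+ ΣL (sublists xs) (Φ (suc m))
      ≈⟨ S.+-cong (S.trans (ΣL-cong (sublists xs) shift-row) (S.sym (ΣL-· (qpow (suc (proj₁ x))) (sublists xs) (Φ m)))) (S.sym (coef-top xs fs (suc m))) ⟩
    qpow (suc (proj₁ x)) · ΣL (sublists xs) (Φ m) S.+ coef rest (suc m)
      ≈⟨ S.+-congʳ (S.*-congˡ {qpow (suc (proj₁ x))} (S.sym (coef-top xs fs m))) ⟩
    qpow (suc (proj₁ x)) · coef rest m S.+ coef rest (suc m)
      ≈⟨ solve 3 (λ v c d → v :* c :+ d := num 1 :* d :+ v :* c) S.refl (qpow (suc (proj₁ x))) (coef rest m) (coef rest (suc m)) ⟩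
    S.1# · coef rest (suc m) S.+ qpow (suc (proj₁ x)) · coef rest m ∎)
    where
    open ≋-Reasoning
    rest = topFactors xs ++ fs
    Φ : ℕ → List (Colored k) → PS
    Φ m t = qpow (topWeight t) · entry (coef fs) m (length t)
    weight : ∀ t → topWeight (x ∷ t) ≡ suc (proj₁ x) ℕ.+ topWeight t
    weight t = cong suc (x∙yz≈y∙xz (length t) (proj₁ x) (rowValueSum t))
      where open import Algebra.Properties.CommutativeSemigroup ℕₚ.+-commutativeSemigroup using (x∙yz≈y∙xz)
    shift-row : ∀ t → Φ (suc m) (x ∷ t) ≋ qpow (suc (proj₁ x)) · Φ m t
    shift-row t = S.trans (S.*-congʳ (S.trans (S.reflexive (cong qpow (weight t))) (S.sym (qpow-+ (suc (proj₁ x)) (topWeight t)))))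
      (S.*-assoc (qpow (suc (proj₁ x))) (qpow (topWeight t)) (entry (coef fs) m (length t)))

entry-cons : ∀ u v fs k i → entry (coef ((u , v) ∷ fs)) k i ≋ u · entry (coef fs) k i S.+ v · entry (coef fs) k (suc i)
entry-cons u v fs zero    zero    = S.sym (S.trans (S.+-congˡ {u · coef fs 0} (S.zeroʳ v)) (S.+-identityʳ (u · coef fs 0)))
entry-cons u v fs (suc k) zero    = S.refl
entry-cons u v fs zero    (suc i) = solve 2 (λ u v → num 0 := u :* num 0 :+ v :* num 0) S.refl u v
  where open PSolver
entry-cons u v fs (suc k) (suc i) = entry-cons u v fs k i

coef-length : ∀ fs k → length fs < k → coef fs k ≋ S.0#
coef-length []             (suc k) _        = S.refl
coef-length ((u , v) ∷ fs) (suc k) (s≤s lt) = S.trans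
  (S.+-cong (S.*-congˡ {u} (coef-length fs (suc k) (ℕₚ.m≤n⇒m≤1+n lt))) (S.*-congˡ {v} (coef-length fs k lt)))
  (solve 2 (λ u v → u :* num 0 :+ v :* num 0 := num 0) S.refl u v)
  where open PSolver

module _ {k : ℕ} where
  open PSolver

  -- An entry of the bottom row contributes q^v and no z, an omitted one contributes z. Hence
  -- z^(length xs - s) selects the rows with s entries.
  coef-bottom : ∀ (xs : List (Colored k)) s →
    entry (coef (bottomFactors xs)) (length xs) s ≋ ΣL (sublists xs) (λ b → pick s (length b) (qpow (rowValueSum b)))
  coef-bottom [] zero    = S.trans (S.sym qpow-0) (S.sym (S.+-identityʳ (qpow 0)))
  coef-bottom [] (suc s) = S.sym (S.+-identityʳ S.0#)
  coef-bottom (x ∷ xs) zero = S.sym (begin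
    ΣL (sublists (x ∷ xs)) Φ
      ≈⟨ ΣL-sublists x xs Φ ⟩
    ΣL (sublists xs) (λ b → Φ (x ∷ b)) S.+ ΣL (sublists xs) Φ
      ≈⟨ S.+-cong (ΣL-0 (sublists xs)) (S.sym (coef-bottom xs 0)) ⟩
    S.0# S.+ coef rest (length xs)
      ≈⟨ solve 2 (λ v c → num 0 :+ c := v :* num 0 :+ num 1 :* c) S.refl (qpow (proj₁ x)) (coef rest (length xs)) ⟩
    qpow (proj₁ x) · S.0# S.+ S.1# · coef rest (length xs)
      ≈⟨ S.+-congʳ (S.*-congˡ {qpow (proj₁ x)} (coef-length rest (suc (length xs)) (s≤s (ℕₚ.≤-reflexive (Listₚ.length-map _ xs))))) ⟨
    qpow (proj₁ x) · coef rest (suc (length xs)) S.+ S.1# · coef rest (length xs) ∎)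
    where
    open ≋-Reasoning
    rest = bottomFactors xs
    Φ = λ b → pick 0 (length b) (qpow (rowValueSum b))
  coef-bottom (x ∷ xs) (suc s) = begin
    entry (coef (bottomFactors (x ∷ xs))) (length xs) s
      ≈⟨ entry-cons (qpow (proj₁ x)) S.1# rest (length xs) s ⟩
    qpow (proj₁ x) · entry (coef rest) (length xs) s S.+ S.1# · entry (coef rest) (length xs) (suc s)
      ≈⟨ S.+-cong (S.*-congˡ {qpow (proj₁ x)} (coef-bottom xs s)) (S.trans (S.*-identityˡ _) (coef-bottom xs (suc s))) ⟩
    qpow (proj₁ x) · ΣL (sublists xs) (Φ s) S.+ ΣL (sublists xs) (Φ (suc s))
      ≈⟨ S.+-congʳ (S.trans (ΣL-· (qpow (proj₁ x)) (sublists xs) (Φ s)) (ΣL-cong (sublists xs) (λ b →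
           S.trans (·-pick (qpow (proj₁ x)) s (length b) (qpow (rowValueSum b))) (pick-cong s (length b) (qpow-+ (proj₁ x) (rowValueSum b)))))) ⟩
    ΣL (sublists xs) (λ b → Φ (suc s) (x ∷ b)) S.+ ΣL (sublists xs) (Φ (suc s))
      ≈⟨ ΣL-sublists x xs (Φ (suc s)) ⟨
    ΣL (sublists (x ∷ xs)) (Φ (suc s)) ∎
    where
    open ≋-Reasoning
    rest = bottomFactors xs
    Φ : ℕ → List (Colored k) → PS
    Φ s b = pick s (length b) (qpow (rowValueSum b))

module _ {k : ℕ} where
  ≻-trans : Transitive (flip (_≺_ {k}))
  ≻-trans y≺x z≺y = ×-transitive {_<₁_ = ℕ._<_} {_<₂_ = Fin._<_} ≡.isEquivalence (≡.resp₂ ℕ._<_) ℕₚ.<-trans Finₚ.<-trans z≺y y≺x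

  ≻-irrefl : Irreflexive _≡_ (flip (_≺_ {k}))
  ≻-irrefl refl = ×-irreflexive {_<₁_ = ℕ._<_} {_<₂_ = Fin._<_} ℕₚ.<-irrefl Finₚ.<-irrefl (refl , refl)

  ≺-irrelevant : Irrelevant (_≺_ {k})
  ≺-irrelevant (inj₁ p)          (inj₁ q)            = cong inj₁ (ℕₚ.<-irrelevant p q)
  ≺-irrelevant (inj₁ p)          (inj₂ (refl , _))   = contradiction p (ℕₚ.<-irrefl refl)
  ≺-irrelevant (inj₂ (refl , _)) (inj₁ q)            = contradiction q (ℕₚ.<-irrefl refl)
  ≺-irrelevant (inj₂ (e , p))    (inj₂ (e′ , q))     = cong inj₂ (cong₂ _,_ (ℕₚ.≡-irrelevant e e′) (ℕₚ.<-irrelevant p q))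

-- Enumeration of the rows with bounded entries

descendingColors : List (Fin 6)
descendingColors = # 5 ∷ # 4 ∷ # 3 ∷ # 2 ∷ # 1 ∷ # 0 ∷ []

-- Listed in decreasing order, so that the sublists are exactly the admissible rows with values
-- below N.
entriesBelow : ℕ → List (Colored 6)
entriesBelow zero    = []
entriesBelow (suc N) = map (N ,_) descendingColors ++ entriesBelow N

entriesBelow-< : ∀ N → All (λ x → proj₁ x < N) (entriesBelow N)
entriesBelow-< zero    = []
entriesBelow-< (suc N) = Allₚ.++⁺ (Allₚ.map⁺ {f = (N ,_)} (All.universal (λ _ → ℕₚ.n<1+n N) descendingColors)) (All.map ℕₚ.m≤n⇒m≤1+n (entriesBelow-< N))

entriesBelow-descending : ∀ N → AllPairs (flip _≺_) (entriesBelow N)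
entriesBelow-descending zero    = []
entriesBelow-descending (suc N) = AllPairsₚ.++⁺
  (AllPairsₚ.map⁺ {f = (N ,_)} (AllPairs.map (λ c → inj₂ (refl , c)) (from-yes (allPairs? (flip Fin._<?_) descendingColors))))
  (entriesBelow-descending N)
  (Allₚ.map⁺ {f = (N ,_)} (All.universal (λ _ → All.map inj₁ (entriesBelow-< N)) descendingColors))

entriesBelow-complete : ∀ {N v} c → v < N → (v , c) ∈ entriesBelow N
entriesBelow-complete {suc N} {v} c v<1+N with ℕₚ.m≤n⇒m<n∨m≡n (ℕₚ.≤-pred v<1+N)
... | inj₁ v<N  = ∈-++⁺ʳ (map (N ,_) descendingColors) (entriesBelow-complete c v<N)
... | inj₂ refl = ∈-++⁺ˡ (∈-map⁺ (N ,_) (all-colors c))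
  where
  all-colors : ∀ c → c ∈ descendingColors
  all-colors = from-yes (Finₚ.all? (λ c → any? (c Finₚ.≟_) descendingColors))

entriesBelow-length : ∀ N → length (entriesBelow N) ≡ (N ℕ.+ N ℕ.+ N) ℕ.+ (N ℕ.+ N ℕ.+ N)
entriesBelow-length zero    = refl
entriesBelow-length (suc N) = trans (cong (6 ℕ.+_) (entriesBelow-length N))
  (solve 1 (λ N → con 6 :+ ((N :+ N :+ N) :+ (N :+ N :+ N)) := let M = con 1 :+ N in (M :+ M :+ M) :+ (M :+ M :+ M)) refl N)
  where open ℕSolver

rows : ℕ → List (List (Colored 6))
rows N = sublists (entriesBelow N)

Pair : Set
Pair = List (Colored 6) × List (Colored 6)

-- The weight equation has n on the left so that deciding it is the very test made by `qpow`, and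
-- the two indicators agree by computation.
IsFrobenius : ℕ → Pair → Set
IsFrobenius n (t , b) = length t ≡ length b × n ≡ topWeight t ℕ.+ rowValueSum b

isFrobenius? : ∀ n → U.Decidable (IsFrobenius n)
isFrobenius? n (t , b) = (length t ℕ.≟ length b) ×-dec (n ℕ.≟ topWeight t ℕ.+ rowValueSum b)

frobeniusPairs : ℕ → ℕ → List Pair
frobeniusPairs n N = filter (isFrobenius? n) (cartesianProduct (rows N) (rows N))

value≤rowValueSum : ∀ {k} {x : Colored k} {r} → x ∈ r → proj₁ x ≤ rowValueSum r
value≤rowValueSum {r = y ∷ r} (here refl) = ℕₚ.m≤m+n _ (rowValueSum r)
value≤rowValueSum {r = y ∷ r} (there x∈)  = ℕₚ.≤-trans (value≤rowValueSum x∈) (ℕₚ.m≤n+m _ (proj₁ y))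

row-complete : ∀ {n N r} → n < N → StrictlyDecreasing r → rowValueSum r ≤ n → r ∈ rows N
row-complete {N = N} n<N decr bound = sublists-complete ≻-trans ≻-irrefl (entriesBelow-descending N) (Linked⇒AllPairs ≻-trans decr)
  (All.tabulate (λ x∈ → entriesBelow-complete _ (ℕₚ.≤-<-trans (ℕₚ.≤-trans (value≤rowValueSum x∈) bound) n<N)))

row-sound : ∀ {N r} → r ∈ rows N → StrictlyDecreasing r
row-sound {N} r∈ = AllPairs⇒Linked (sublists-sound ≻-trans ≻-irrefl (entriesBelow-descending N) r∈)

Rows : ℕ → Pair → Set
Rows n (t , b) = IsFrobenius n (t , b) × StrictlyDecreasing t × StrictlyDecreasing b

frobeniusPairs↔ : ∀ n N → n < N → Fin (length (frobeniusPairs n N)) ↔ FrobeniusPartition 6 n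
frobeniusPairs↔ n N n<N = mk↔ₛ′
  (λ ((t , b) , (len , w) , dt , db) → frob t b len dt db (sym w))
  (λ (frob t b len dt db w) → (t , b) , (len , sym w) , dt , db)
  (λ (frob t b len dt db w) → cong (frob t b len dt db) (ℕₚ.≡-irrelevant _ w))
  (λ ((t , b) , (len , w) , dt , db) → cong (λ w → (t , b) , (len , w) , dt , db) (ℕₚ.≡-irrelevant _ w))
  ↔-∘ enumeration (Uniqueₚ.filter⁺ (isFrobenius? n) (Uniqueₚ.cartesianProduct⁺ unique unique)) sound complete
    (λ ((l , w) , dt , db) ((l′ , w′) , dt′ , db′) → cong₂ _,_ (cong₂ _,_ (ℕₚ.≡-irrelevant l l′) (ℕₚ.≡-irrelevant w w′))
      (cong₂ _,_ (Linked.irrelevant ≺-irrelevant dt dt′) (Linked.irrelevant ≺-irrelevant db db′)))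
  where
  unique = sublists-unique ≻-trans ≻-irrefl (entriesBelow-descending N)
  sound : ∀ {x} → x ∈ frobeniusPairs n N → Rows n x
  sound {t , b} x∈ with ∈-filter⁻ (isFrobenius? n) x∈
  ... | x∈′ , p with ∈-cartesianProduct⁻ (rows N) (rows N) x∈′
  ...   | t∈ , b∈ = p , row-sound {N} t∈ , row-sound {N} b∈
  complete : ∀ {x} → Rows n x → x ∈ frobeniusPairs n N
  complete {t , b} (p@(_ , w) , dt , db) = ∈-filter⁺ (isFrobenius? n) (∈-cartesianProduct⁺
    (row-complete n<N dt (ℕₚ.≤-trans (ℕₚ.≤-trans (ℕₚ.m≤n+m _ (length t)) (ℕₚ.m≤m+n _ (rowValueSum b))) (ℕₚ.≤-reflexive (sym w))))
    (row-complete n<N db (ℕₚ.≤-trans (ℕₚ.m≤n+m _ (topWeight t)) (ℕₚ.≤-reflexive (sym w))))) p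

allFactors : ℕ → List (PS × PS)
allFactors N = topFactors (entriesBelow N) ++ bottomFactors (entriesBelow N)

-- A pair of rows contributes at z to the power 6N plus the length of the top row minus that of the
-- bottom row, so the coefficient of z^(6N) collects the pairs of equal length.
frobenius-count : ∀ n N → ℤ.+ length (frobeniusPairs n N) / 1 ≡ coef (allFactors N) (length (entriesBelow N)) n
frobenius-count n N = trans (count-filter (isFrobenius? n) (cartesianProduct (rows N) (rows N)))
  (trans (sumL-product (rows N) (rows N) _) (sym (trans (generating n) (sumL-cong (rows N) (λ t → sumL-cong (rows N) (λ b → indicate t b))))))
  where
  generating : coef (allFactors N) (length (entriesBelow N)) ≋ ΣL (rows N) (λ t → ΣL (rows N) (λ b → pick (length t) (length b) (qpow (topWeight t ℕ.+ rowValueSum b))))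
  generating = S.trans (coef-top (entriesBelow N) (bottomFactors (entriesBelow N)) (length (entriesBelow N)))
    (ΣL-cong (rows N) (λ t → S.trans (S.*-congˡ {qpow (topWeight t)} (coef-bottom (entriesBelow N) (length t)))
      (S.trans (ΣL-· (qpow (topWeight t)) (rows N) _) (ΣL-cong (rows N) (λ b → S.trans (·-pick (qpow (topWeight t)) (length t) (length b) (qpow (rowValueSum b)))
        (pick-cong (length t) (length b) (qpow-+ (topWeight t) (rowValueSum b))))))))
  indicate : ∀ t b → pick (length t) (length b) (qpow (topWeight t ℕ.+ rowValueSum b)) n ≡ indicator (does (isFrobenius? n (t , b)))
  indicate t b with does (length t ℕ.≟ length b)
  ... | true  = refl
  ... | false = refl

-- From six colors to a sixth power, and the conclusion

private
  sixth : (ℕ → PS) → ℕ → PS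
  sixth a = (a ⊛ a ⊛ a) ⊛ (a ⊛ a ⊛ a)

  linear-cong : ∀ {u u′ v v′} → u ≡ u′ → v ≡ v′ → linear u v Z.≈ linear u′ v′
  linear-cong refl refl = Z.refl

  -- A factor depends on the value of an entry but not on its color, so each new value brings six
  -- equal linear factors.
  six-factors : ∀ l a b → b Z.≈ sixth a → l ⊛ (l ⊛ (l ⊛ (l ⊛ (l ⊛ (l ⊛ b))))) Z.≈ sixth (l ⊛ a)
  six-factors l a b b≈ = Z.trans (Z.*-congˡ {l} (Z.*-congˡ {l} (Z.*-congˡ {l} (Z.*-congˡ {l} (Z.*-congˡ {l} (Z.*-congˡ {l} b≈))))))
    (solve 2 (λ l a → l :* (l :* (l :* (l :* (l :* (l :* ((a :* a :* a) :* (a :* a :* a)))))))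
       := let la = l :* a in (la :* la :* la) :* (la :* la :* la)) Z.refl l a)
    where open ZSolver

  sixth-cong : ∀ {a b} → a Z.≈ b → sixth a Z.≈ sixth b
  sixth-cong e = Z.*-cong (Z.*-cong (Z.*-cong e e) e) (Z.*-cong (Z.*-cong e e) e)

  topPoly : ℕ → ℕ → PS
  topPoly zero    = Z.1#
  topPoly (suc i) = linear S.1# (qpow (suc i)) ⊛ topPoly i

  bottomPoly : ℕ → ℕ → PS
  bottomPoly zero    = Z.1#
  bottomPoly (suc i) = linear (qpow i) S.1# ⊛ bottomPoly i

  sixth-1 : Z.1# Z.≈ sixth Z.1#
  sixth-1 = solve 0 (num 1 := (num 1 :* num 1 :* num 1) :* (num 1 :* num 1 :* num 1)) Z.refl
    where open ZSolver

  top-sixth : ∀ N → poly (topFactors (entriesBelow N)) Z.≈ sixth (topPoly N)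
  top-sixth zero    = sixth-1
  top-sixth (suc N) = six-factors (linear S.1# (qpow (suc N))) (topPoly N) _ (top-sixth N)

  bottom-sixth : ∀ N → poly (bottomFactors (entriesBelow N)) Z.≈ sixth (bottomPoly N)
  bottom-sixth zero    = sixth-1
  bottom-sixth (suc N) = six-factors (linear (qpow N) S.1#) (bottomPoly N) _ (bottom-sixth N)

  poly-factorsʸ : ∀ j → poly (TP.factorsʸ j) Z.≈ bottomPoly j
  poly-factorsʸ zero    = Z.refl
  poly-factorsʸ (suc j) = Z.*-cong (linear-cong (cong qpow (ℕₚ.*-identityˡ j)) refl) (poly-factorsʸ j)

  poly-factors : ∀ i j → poly (TP.factors i j) Z.≈ topPoly i ⊛ bottomPoly j
  poly-factors zero    j = Z.trans (poly-factorsʸ j) (Z.sym (Z.*-identityˡ (bottomPoly j)))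
  poly-factors (suc i) j = Z.trans (Z.*-cong (linear-cong refl (cong (qpow ∘ suc) (ℕₚ.*-identityˡ i))) (poly-factors i j))
    (Z.sym (Z.*-assoc (linear S.1# (qpow (suc i))) (topPoly i) (bottomPoly j)))

poly-allFactors : ∀ N → poly (allFactors N) Z.≈ sixth (poly (bigFactors N))
poly-allFactors N = Z.trans (poly-++ (topFactors (entriesBelow N)) (bottomFactors (entriesBelow N)))
  (Z.trans (Z.*-cong (top-sixth N) (bottom-sixth N))
  (Z.trans (solve 2 (λ a b → ((a :* a :* a) :* (a :* a :* a)) :* ((b :* b :* b) :* (b :* b :* b)) := let ab = a :* b in (ab :* ab :* ab) :* (ab :* ab :* ab)) Z.refl (topPoly N) (bottomPoly N))
  (sixth-cong (Z.sym (poly-factors N N)))))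
  where open ZSolver

frobenius-generating : ∀ n → Σ ℕ (λ c → (Fin c ↔ FrobeniusPartition 6 n) × (etaQuotients n ≡ ℤ.+ c / 1))
frobenius-generating n = length (frobeniusPairs n N) , frobeniusPairs↔ n N n<N , sym (begin
  ℤ.+ length (frobeniusPairs n N) / 1                   ≡⟨ frobenius-count n N ⟩
  coef (allFactors N) (length (entriesBelow N)) n       ≡⟨ cong (λ l → coef (allFactors N) l n) (entriesBelow-length N) ⟩
  coef (allFactors N) L n                               ≡⟨ poly-coef (allFactors N) L n ⟨
  poly (allFactors N) L n                               ≡⟨ poly-allFactors N L n ⟩
  sixth (poly (bigFactors N)) L n                       ≡⟨ sixth-power n N ℕₚ.≤-refl n ℕₚ.≤-refl ⟩
  (inv (qPoch 1) ^ 6 · a₅) n                            ≡⟨ etaQuotients-a₅ n ⟨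
  etaQuotients n                                        ∎)
  where
  open ≡.≡-Reasoning
  -- The least N that `sixth-power` admits for precision n. It exceeds n, so no row of a partition
  -- of n is missed.
  N = 2 ℕ.+ (n ℕ.+ n)
  L = (N ℕ.+ N ℕ.+ N) ℕ.+ (N ℕ.+ N ℕ.+ N)
  n<N : n < N
  n<N = s≤s (ℕₚ.m≤n⇒m≤1+n (ℕₚ.m≤m+n n n))

open import Data.Integer using (+_)

opaque
  unfolding _·_

  -- Once `_·_` is unfolded, both sides have the same coefficients by computation; only here is the
  -- opacity lifted.
  etaQuotients-⊗ : etaQuotients ≋ ((const (+ 4 / 9) ⊗ pow (qPoch 1) 5 ⊗ pow (qPoch 4) 2 ⊗ inv (pow (qPoch 2) 5 ⊗ pow (qPoch 3) 3)) ⊖ (const (+ 1 / 3) ⊗ pow (qPoch 2) 4 ⊗ pow (qPoch 4) 2 ⊗ inv (pow (qPoch 1) 4 ⊗ pow (qPoch 6) 3)) ⊕ (const (+ 8 / 9) ⊗ pow (qPoch 4) 11 ⊗ inv (pow (qPoch 1) 4 ⊗ pow (qPoch 2) 5 ⊗ pow (qPoch 12) 3)) ⊕ (const (+ 36 / 1) ⊗ qpow 1 ⊗ pow (qPoch 4) 2 ⊗ pow (qPoch 3) 9 ⊗ inv (pow (qPoch 1) 7 ⊗ pow (qPoch 2) 5)) ⊕ (const (+ 27 / 1) ⊗ qpow 2 ⊗ pow (qPoch 4) 2 ⊗ pow (qPoch 6) 9 ⊗ inv (pow (qPoch 1) 4 ⊗ pow (qPoch 2) 8)) ⊕ (const (+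 72 / 1) ⊗ qpow 4 ⊗ pow (qPoch 12) 9 ⊗ inv (pow (qPoch 1) 4 ⊗ pow (qPoch 2) 5 ⊗ qPoch 4)))
  etaQuotients-⊗ n = refl {x = etaQuotients n}

theorem6p2 : (n : ℕ) → Σ ℕ (λ cφ6n → (Fin cφ6n ↔ FrobeniusPartition 6 n) × (((const (+ 4 / 9) ⊗ pow (qPoch 1) 5 ⊗ pow (qPoch 4) 2 ⊗ inv (pow (qPoch 2) 5 ⊗ pow (qPoch 3) 3)) ⊖ (const (+ 1 / 3) ⊗ pow (qPoch 2) 4 ⊗ pow (qPoch 4) 2 ⊗ inv (pow (qPoch 1) 4 ⊗ pow (qPoch 6) 3)) ⊕ (const (+ 8 / 9) ⊗ pow (qPoch 4) 11 ⊗ inv (pow (qPoch 1) 4 ⊗ pow (qPoch 2) 5 ⊗ pow (qPoch 12) 3)) ⊕ (const (+ 36 / 1) ⊗ qpow 1 ⊗ pow (qPoch 4) 2 ⊗ pow (qPoch 3) 9 ⊗ inv (pow (qPoch 1) 7 ⊗ pow (qPoch 2) 5)) ⊕ (const (+ 27 / 1) ⊗ qpow 2 ⊗ pow (qPoch 4) 2 ⊗ pow (qPoch 6) 9 ⊗ inv (pow (qPoch 1) 4 ⊗ pow (qPoch 2) 8)) ⊕ (const (+ 72 / 1) ⊗ qpow 4 ⊗ pow (qPoch 12) 9 ⊗ inv (pow (qPoch 1) 4 ⊗ pow (qPoch 2) 5 ⊗ qPoch 4))) n ≡ (+ cφ6n) / 1))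
theorem6p2 n = map₂ (map₂ (trans (sym (etaQuotients-⊗ n)))) (frobenius-generating n)
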